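{- Fix an integer $r \ge 3$. If $m = m(n)$ satisfies $m = (1+o(1))n^{r/2}$, then $z(m,n,2,r) = (1+o(1))\sqrt{n}\,m$ as $n \to \infty$.
   Context: The Zarankiewicz number $z(m,n,s,t)$ is the maximum number of edges in a bipartite graph with parts $A$, $B$ of sizes $|A| = m$, $|B| = n$ that contains no complete bipartite subgraph with $s$ vertices in $A$ and $t$ vertices in $B$ (equivalently, the maximum number of $1$s in an $m \times n$ $0/1$ matrix with no $s \times t$ all-ones submatrix). -}

module Defs where

open import Data.Nat as ℕ using (ℕ; _^_)
open import Data.Bool using (Bool; true; false)
open import Data.Fin using (Fin)
open import Data.Fin.Subset using (Subset; _∈_; ∣_∣)
open import Data.Product using (Σ; ∃; _×_)
open import Data.Integer using (+_)
open import Data.Rational using (ℚ; _/_; 0ℚ; 1ℚ; _*_; _+_; _-_; _≤_; _<_)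
open import Data.Vec.Functional using (Vector)
open import Data.Vec.Functional as VF using ()
open import Relation.Binary.PropositionalEquality using (_≡_)

-- A 0/1 matrix with m rows and n columns (equivalently a bipartite graph
-- with parts A = Fin m, B = Fin n; entry true = edge).
Matrix : ℕ → ℕ → Set
Matrix m n = Fin m → Fin n → Bool

rowOnes : ∀ {n} → (Fin n → Bool) → ℕ
rowOnes {ℕ.zero} f = 0
rowOnes {ℕ.suc n} f = (Data.Bool.if f Fin.zero then 1 else 0) ℕ.+ rowOnes (λ j → f (Fin.suc j))
  where import Data.Fin as Fin; import Data.Bool

ones : ∀ {m n} → Matrix m n → ℕ
ones {ℕ.zero} M = 0
ones {ℕ.suc m} M = rowOnes (M Fin.zero) ℕ.+ ones (λ i → M (Fin.suc i))
  where import Data.Fin as Fin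

ContainsAllOnes : ∀ {m n} → ℕ → ℕ → Matrix m n → Set
ContainsAllOnes {m} {n} s t M =
  Σ (Subset m) λ S → Σ (Subset n) λ T →
    (∣ S ∣ ≡ s) × (∣ T ∣ ≡ t) × (∀ i j → i ∈ S → j ∈ T → M i j ≡ true)

Free : ∀ {m n} → ℕ → ℕ → Matrix m n → Set
Free s t M = ContainsAllOnes s t M → Data.Empty.⊥
  where import Data.Empty

IsZarankiewicz : ℕ → ℕ → ℕ → ℕ → ℕ → Set
IsZarankiewicz m n s t k =
  (Σ (Matrix m n) λ M → Free s t M × (ones M ≡ k)) ×
  (∀ (M : Matrix m n) → Free s t M → ones M ℕ.≤ k)

ℕ→ℚ : ℕ → ℚ
ℕ→ℚ k = + k / 1

-- AsympSqrt f g  :  f(n) = (1 + o(1)) √(g(n)) as n → ∞.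
-- Since f ≥ 0, for 0 < ε < 1 the condition (1-ε)√g ≤ f ≤ (1+ε)√g is
-- equivalent to (1-ε)² g ≤ f² ≤ (1+ε)² g, which avoids irrationals.
AsympSqrt : (ℕ → ℕ) → (ℕ → ℕ) → Set
AsympSqrt f g =
  ∀ (ε : ℚ) → 0ℚ < ε → ε < 1ℚ →
  ∃ λ N → ∀ n → N ℕ.≤ n →
    ((1ℚ - ε) * (1ℚ - ε) * ℕ→ℚ (g n) ≤ ℕ→ℚ (f n ^ 2)) ×
    (ℕ→ℚ (f n ^ 2) ≤ (1ℚ + ε) * (1ℚ + ε) * ℕ→ℚ (g n))

{-# OPTIONS --safe #-}
-- Upper bound.  Two rows share fewer than r columns, so an r-set of columns lies in at most one row and the row
-- sums satisfy Σ d(d-1)⋯(d-r+1) ≤ n(n-1)⋯(n-r+1); the tangent of d ↦ d^r at √n turns this into a bound for Σ d.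
--
-- Lower bound.  For a prime p with p² ≤ n take the points of the plane over F_p as columns and the graphs of the
-- polynomials of degree less than r as rows: two graphs meet in fewer than r points.  This is optimal once p ~ √n.
--
-- Primes in (x, (1 + c) x] come from Selberg's formula ψ(x) log x + Σ Λ(j) ψ(x/j) = 2 x log x + O(x).  It bounds
-- the density of primes in every short interval by 2, and if (x, (1 + c) x] is free of primes it forces density 2
-- on (x/m, (1 + c) x/m] for almost all m.  Going from m to some n just above x/m and back to x/n, which is just
-- below m, density 2 spreads to the right of m over a long range, against the average density 1 of Mertens.
--
-- All of this takes place in ℚ: for every X there is a completely additive rational function ℓ with
-- 1/(n+1) ≤ ℓ(n+1) - ℓ(n) ≤ 1/n for n < X, and the constants do not depend on X.
module Submission where

open import Defs
open import Data.Nat as ℕ using (ℕ; zero; suc; z≤n; s≤s; NonZero) renaming (_+_ to _+ℕ_; _*_ to _*ℕ_; _≤_ to _≤ℕ_; _<_ to _<ℕ_)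
import Data.Nat.Properties as ℕₚ
open import Data.Nat.Divisibility using (_∣_; _∤_; divides; _∣?_)
import Data.Nat.Divisibility as ∣ₚ
import Data.Nat.DivMod as DM
open import Data.Nat.Induction using (<-rec)
open import Data.Nat.Primality using (Prime; prime?)
import Data.Nat.Primality as Pr
open import Data.Nat.Primality.Factorisation using (PrimeFactorisation; factors; factorise; factorisationUnique; factorisationHasAllPrimeFactors)
open import Data.Nat.ListAction using (product)
import Data.Nat.ListAction.Properties as LAₚ
import Data.Nat.Coprimality as Cop
open import Data.Bool using (Bool; true; false; T; _∧_; if_then_else_)
open import Data.Bool.Properties using (T-∧)
open import Data.Unit using (⊤; tt)
open import Data.Empty using (⊥; ⊥-elim)
open import Data.Sum using (_⊎_; inj₁; inj₂; [_,_]′)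
open import Data.Product using (Σ; ∃; _×_; _,_; proj₁; proj₂)
open import Data.List using (List; []; _∷_; _++_)
open import Data.List.Membership.DecPropositional ℕₚ._≟_ using (_∈?_)
open import Data.List.Membership.Propositional using (_∈_)
open import Data.List.Relation.Unary.All using (All; []; _∷_)
import Data.List.Relation.Unary.All.Properties as Allₚ
open import Data.List.Relation.Unary.Any using (here; there)
open import Data.List.Relation.Binary.Permutation.Propositional as Perm using (_↭_)
import Data.List.Relation.Binary.Permutation.Propositional.Properties as Permₚ
import Data.Integer as ℤ
import Data.Integer.Properties as ℤₚ
open import Data.Rational as ℚ using (ℚ; 0ℚ; 1ℚ)
import Data.Rational.Properties as ℚₚ
import Data.Rational.Unnormalised as ℚᵘ
import Data.Rational.Unnormalised.Properties as ℚᵘₚ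
open import Function using (_∘_; Equivalence)
open import Relation.Nullary using (¬_; Dec; yes; no)
open import Relation.Nullary.Decidable using (dec⇒maybe)
open import Relation.Binary.PropositionalEquality
open import Tactic.RingSolver.Core.AlmostCommutativeRing using (AlmostCommutativeRing; fromCommutativeRing)
open import Tactic.RingSolver using (solve-∀)
open import Data.Nat.Tactic.RingSolver using () renaming (solve-∀ to solveℕ-∀)
open import Data.Fin as Fin using (Fin; toℕ)
import Data.Fin.Properties as Finₚ
import Data.Fin.Subset as Sub
import Data.Fin.Subset.Properties as Subₚ
open import Data.Vec using (Vec; []; _∷_; here; there)
import Data.Integer.Divisibility.Signed as ℤ∣
open import Data.Integer.Tactic.RingSolver using () renaming (solve-∀ to solveℤ-∀)
import Data.Bool.Properties as Boolₚ

-- Linear arithmetic over the rationals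

-- The rows need a prime p with p/√n tending to 1, hence primes in (x, (1 + c) x] for every fixed c
-- > 0. That is beyond Chebyshev's bounds, and Selberg's formula by itself leaves every density
-- between 0 and 2 possible. Density close to 2 is absurd on a long range because it makes Σ Λ(m)/m
-- grow at least 3/2 times as fast as log m, while by Mertens their difference varies by at most 7.
-- The obstacle is the exceptional m. Their total weight in Λ(m)/m is a small multiple of log x,
-- hence unbounded, so density cannot be spread over the whole range. The pigeonhole principle
-- supplies a bounded range instead: the scale is cut into about log x / log K windows, each is
-- paired with its reflection under m ↦ x/m, and some pair has exceptional weight at most 1/(8 g).
-- Inside such a pair every interval (t, (1 + 1/g) t] of density near 2 contains an m that is not
-- exceptional. The length K of a window depends only on the constants in Mertens' estimate; E, U
-- and x₀ are chosen after it.

ℚ-ring : AlmostCommutativeRing _ _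
ℚ-ring = fromCommutativeRing ℚₚ.+-*-commutativeRing λ x → dec⇒maybe (0ℚ ℚₚ.≟ x)

-- The field operations are sealed so that they stay neutral: unification then infers operands, and no
-- normalisation of fractions is ever attempted.
infixl 6 _+_ _-_
infixl 7 _*_
infix 4 _≤_ _≤?_

opaque
  _+_ _*_ : ℚ → ℚ → ℚ
  _+_ = ℚ._+_
  _*_ = ℚ._*_

  neg : ℚ → ℚ
  neg = ℚ.-_

  _≤_ : ℚ → ℚ → Set
  _≤_ = ℚ._≤_

  ι : ℕ → ℚ
  ι n = ℤ.+ n ℚ./ 1

  recip : ℕ → ℚ
  recip zero = 0ℚ
  recip (suc n) = ℤ.+ 1 ℚ./ suc n

_-_ : ℚ → ℚ → ℚ
a - b = a + neg b

opaque
  unfolding _+_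

  private
    ι-toℚᵘ : ∀ n → ℚ.toℚᵘ (ι n) ℚᵘ.≃ ℚᵘ.mkℚᵘ (ℤ.+ n) 0
    ι-toℚᵘ n = ℚₚ.toℚᵘ-fromℚᵘ (ℚᵘ.mkℚᵘ (ℤ.+ n) 0)

  +-comm : ∀ a b → a + b ≡ b + a
  +-comm = ℚₚ.+-comm

  +-assoc : ∀ a b c → (a + b) + c ≡ a + (b + c)
  +-assoc = ℚₚ.+-assoc

  +-identityˡ : ∀ a → ι 0 + a ≡ a
  +-identityˡ = ℚₚ.+-identityˡ

  -‿inverseʳ : ∀ a → a - a ≡ ι 0
  -‿inverseʳ = ℚₚ.+-inverseʳ

  *-comm : ∀ a b → a * b ≡ b * a
  *-comm = ℚₚ.*-comm

  *-assoc : ∀ a b c → (a * b) * c ≡ a * (b * c)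
  *-assoc = ℚₚ.*-assoc

  *-identityˡ : ∀ a → ι 1 * a ≡ a
  *-identityˡ = ℚₚ.*-identityˡ

  *-zeroˡ : ∀ a → ι 0 * a ≡ ι 0
  *-zeroˡ = ℚₚ.*-zeroˡ

  *-distribˡ-+ : ∀ a b c → a * (b + c) ≡ a * b + a * c
  *-distribˡ-+ = ℚₚ.*-distribˡ-+

  ι-+ : ∀ m n → ι (m +ℕ n) ≡ ι m + ι n
  ι-+ m n = ℚₚ.toℚᵘ-injective (ℚᵘₚ.≃-trans (ι-toℚᵘ (m +ℕ n)) (ℚᵘₚ.≃-trans core
    (ℚᵘₚ.≃-sym (ℚᵘₚ.≃-trans (ℚₚ.toℚᵘ-homo-+ (ι m) (ι n)) (ℚᵘₚ.+-cong (ι-toℚᵘ m) (ι-toℚᵘ n))))))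
    where
    core : ℚᵘ.mkℚᵘ (ℤ.+ (m +ℕ n)) 0 ℚᵘ.≃ ℚᵘ.mkℚᵘ (ℤ.+ m) 0 ℚᵘ.+ ℚᵘ.mkℚᵘ (ℤ.+ n) 0
    core = ℚᵘ.*≡* (cong (ℤ._* ℤ.+ 1) (sym (cong₂ ℤ._+_ (ℤₚ.*-identityʳ (ℤ.+ m)) (ℤₚ.*-identityʳ (ℤ.+ n)))))

  ι-* : ∀ m n → ι (m *ℕ n) ≡ ι m * ι n
  ι-* m n = ℚₚ.toℚᵘ-injective (ℚᵘₚ.≃-trans (ι-toℚᵘ (m *ℕ n)) (ℚᵘₚ.≃-trans core
    (ℚᵘₚ.≃-sym (ℚᵘₚ.≃-trans (ℚₚ.toℚᵘ-homo-* (ι m) (ι n)) (ℚᵘₚ.*-cong (ι-toℚᵘ m) (ι-toℚᵘ n))))))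
    where
    core : ℚᵘ.mkℚᵘ (ℤ.+ (m *ℕ n)) 0 ℚᵘ.≃ ℚᵘ.mkℚᵘ (ℤ.+ m) 0 ℚᵘ.* ℚᵘ.mkℚᵘ (ℤ.+ n) 0
    core = ℚᵘ.*≡* (cong (ℤ._* ℤ.+ 1) (ℤₚ.pos-* m n))

  recip-inverse : ∀ n → ι (suc n) * recip (suc n) ≡ ι 1
  recip-inverse n = ℚₚ.toℚᵘ-injective (ℚᵘₚ.≃-trans (ℚₚ.toℚᵘ-homo-* (ι (suc n)) (recip (suc n)))
    (ℚᵘₚ.≃-trans (ℚᵘₚ.*-cong (ι-toℚᵘ (suc n)) (ℚₚ.toℚᵘ-fromℚᵘ (ℚᵘ.mkℚᵘ (ℤ.+ 1) n))) core))
    where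
    core : ℚᵘ.mkℚᵘ (ℤ.+ suc n) 0 ℚᵘ.* ℚᵘ.mkℚᵘ (ℤ.+ 1) n ℚᵘ.≃ ℚᵘ.mkℚᵘ (ℤ.+ 1) 0
    core = ℚᵘ.*≡* (cong ℤ.+_ (trans (ℕₚ.*-identityʳ _) (trans (ℕₚ.*-identityʳ _)
      (sym (trans (ℕₚ.+-identityʳ _) (ℕₚ.+-identityʳ _))))))

  ≤-refl : ∀ {a} → a ≤ a
  ≤-refl = ℚₚ.≤-refl

  ≤-trans : ∀ {a b c} → a ≤ b → b ≤ c → a ≤ c
  ≤-trans = ℚₚ.≤-trans

  ≤-antisym : ∀ {a b} → a ≤ b → b ≤ a → a ≡ b
  ≤-antisym = ℚₚ.≤-antisym

  ≤-total : ∀ a b → a ≤ b ⊎ b ≤ a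
  ≤-total = ℚₚ.≤-total

  _≤?_ : ∀ a b → Dec (a ≤ b)
  _≤?_ = ℚₚ._≤?_

  +-mono-≤ : ∀ {a b c d} → a ≤ b → c ≤ d → a + c ≤ b + d
  +-mono-≤ = ℚₚ.+-mono-≤

  *-nonneg : ∀ {a b} → ι 0 ≤ a → ι 0 ≤ b → ι 0 ≤ a * b
  *-nonneg {a} {b} p q = subst (ℚ._≤ a ℚ.* b) (ℚₚ.*-zeroʳ a)
    (ℚₚ.*-monoˡ-≤-nonNeg a {{ℚ.nonNegative p}} q)

  ι-mono : ∀ {m n} → m ≤ℕ n → ι m ≤ ι n
  ι-mono {m} {n} le = ℚₚ.toℚᵘ-cancel-≤ (ℚᵘₚ.≤-respˡ-≃ (ℚᵘₚ.≃-sym (ι-toℚᵘ m))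
    (ℚᵘₚ.≤-respʳ-≃ (ℚᵘₚ.≃-sym (ι-toℚᵘ n)) (ℚᵘ.*≤* (ℤₚ.*-monoʳ-≤-nonNeg (ℤ.+ 1) (ℤ.+≤+ le)))))

  ι-cancel : ∀ {m n} → ι m ≤ ι n → m ≤ℕ n
  ι-cancel {m} {n} le with ℚᵘₚ.≤-respˡ-≃ (ι-toℚᵘ m) (ℚᵘₚ.≤-respʳ-≃ (ι-toℚᵘ n) (ℚₚ.toℚᵘ-mono-≤ le))
  ... | ℚᵘ.*≤* p = ℤₚ.drop‿+≤+ (subst₂ ℤ._≤_ (ℤₚ.*-identityʳ (ℤ.+ m)) (ℤₚ.*-identityʳ (ℤ.+ n)) p)

  private
    merge-terms : ∀ a b c d m p →
      ((a + c) + neg (b + d)) * m + p ≡ (a + neg b) * m + ((c + neg d) * m + p)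
    merge-terms = solve-∀ ℚ-ring

    swap-terms : ∀ a b c → a + (b + c) ≡ b + (a + c)
    swap-terms = solve-∀ ℚ-ring

    mul-terms : ∀ a b c d m k →
      ((a * c + b * d) + neg (a * d + b * c)) * (m * k) ≡ ((a + neg b) * m) * ((c + neg d) * k)
    mul-terms = solve-∀ ℚ-ring

    neg-term : ∀ a b m p → (b + neg a) * m + neg p ≡ neg ((a + neg b) * m + p)
    neg-term = solve-∀ ℚ-ring

    distrib : ∀ a b c → (a + b) * c ≡ a * c + b * c
    distrib = solve-∀ ℚ-ring


    rearr : ∀ a b → (b + neg a) + a ≡ b
    rearr = solve-∀ ℚ-ring

  +-identityʳ : ∀ a → a + ι 0 ≡ a
  +-identityʳ = ℚₚ.+-identityʳ

≡⇒≤ : ∀ {a b} → a ≡ b → a ≤ b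
≡⇒≤ refl = ≤-refl

0≤⇒≤ : ∀ {a b} → ι 0 ≤ b - a → a ≤ b
0≤⇒≤ {a} {b} p = subst₂ _≤_ (+-identityˡ a) (rearr a b) (+-mono-≤ p (≤-refl {a}))

≤⇒0≤ : ∀ {a b} → a ≤ b → ι 0 ≤ b - a
≤⇒0≤ {a} {b} p = subst (_≤ b - a) (-‿inverseʳ a) (+-mono-≤ p (≤-refl {neg a}))

0≤ι : ∀ n → ι 0 ≤ ι n
0≤ι n = ι-mono ℕ.z≤n

-- Certificates for linear arithmetic, checked by normalising polynomials

infixl 8 _:+_ _:-_
infixl 9 _:*_
infix 7 _:≤_ _:=_
infix 6 _·_ _−·_
infix 4 _⊢_

data Ex : Set where
  var con : ℕ → Ex
  _:+_ _:-_ _:*_ : Ex → Ex → Ex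

data Rel : Set where
  _:≤_ _:=_ : Ex → Ex → Rel

-- A relation with its multiplier; equations may be used with a negative one.
data Item : Set where
  _·_ _−·_ : ℕ → Rel → Item

data Sequent : Set where
  _⊢_ : List Item → Item → Sequent

lookupOr0 : List ℚ → ℕ → ℚ
lookupOr0 [] _ = ι 0
lookupOr0 (x ∷ ρ) zero = x
lookupOr0 (x ∷ ρ) (suc i) = lookupOr0 ρ i

⟦_⟧ : Ex → List ℚ → ℚ
⟦ var i ⟧ ρ = lookupOr0 ρ i
⟦ con n ⟧ ρ = ι n
⟦ e :+ f ⟧ ρ = ⟦ e ⟧ ρ + ⟦ f ⟧ ρ
⟦ e :- f ⟧ ρ = ⟦ e ⟧ ρ - ⟦ f ⟧ ρ
⟦ e :* f ⟧ ρ = ⟦ e ⟧ ρ * ⟦ f ⟧ ρ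

⟦_⟧ᴿ : Rel → List ℚ → Set
⟦ e :≤ f ⟧ᴿ ρ = ⟦ e ⟧ ρ ≤ ⟦ f ⟧ ρ
⟦ e := f ⟧ᴿ ρ = ⟦ e ⟧ ρ ≡ ⟦ f ⟧ ρ

relation : Item → Rel
relation (_ · r) = r
relation (_ −· r) = r

⟦_⟧ˢ : Sequent → List ℚ → Set
⟦ [] ⊢ g ⟧ˢ ρ = ⟦ relation g ⟧ᴿ ρ
⟦ h ∷ hs ⊢ g ⟧ˢ ρ = ⟦ relation h ⟧ᴿ ρ → ⟦ hs ⊢ g ⟧ˢ ρ

-- A polynomial is a list of terms; the coefficient (a , b) stands for the integer a - b.
Term : Set
Term = (ℕ × ℕ) × List ℕ

private
  _==_ : List ℕ → List ℕ → Bool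
  [] == [] = true
  [] == (_ ∷ _) = false
  (_ ∷ _) == [] = false
  (x ∷ xs) == (y ∷ ys) = (x ℕ.≡ᵇ y) ∧ (xs == ys)

  ==-sound : ∀ xs ys → T (xs == ys) → xs ≡ ys
  ==-sound [] [] _ = refl
  ==-sound (x ∷ xs) (y ∷ ys) t with Equivalence.to T-∧ t
  ... | p , q = cong₂ _∷_ (ℕₚ.≡ᵇ⇒≡ x y p) (==-sound xs ys q)

  -- Monomials are kept as sorted lists of variables, so that `_==_` recognises equal monomials.
  insert : ℕ → List ℕ → List ℕ
  insert v [] = v ∷ []
  insert v (w ∷ ws) = if v ℕ.≤ᵇ w then v ∷ w ∷ ws else w ∷ insert v ws

  mulMon : List ℕ → List ℕ → List ℕ
  mulMon [] k = k
  mulMon (v ∷ m) k = insert v (mulMon m k)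

  addTerm : Term → List Term → List Term
  addTerm t [] = t ∷ []
  addTerm ((a , b) , m) (((c , d) , k) ∷ p) =
    if m == k then ((a +ℕ c , b +ℕ d) , m) ∷ p else ((c , d) , k) ∷ addTerm ((a , b) , m) p

  addPoly : List Term → List Term → List Term
  addPoly [] q = q
  addPoly (t ∷ p) q = addTerm t (addPoly p q)

  mulTerm : Term → Term → Term
  mulTerm ((a , b) , m) ((c , d) , k) = (a *ℕ c +ℕ b *ℕ d , a *ℕ d +ℕ b *ℕ c) , mulMon m k

  mulTermPoly : Term → List Term → List Term
  mulTermPoly t [] = []
  mulTermPoly t (s ∷ p) = addTerm (mulTerm t s) (mulTermPoly t p)

  mulPoly : List Term → List Term → List Term
  mulPoly [] q = []
  mulPoly (t ∷ p) q = addPoly (mulTermPoly t q) (mulPoly p q)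

  negPoly : List Term → List Term
  negPoly [] = []
  negPoly (((a , b) , m) ∷ p) = ((b , a) , m) ∷ negPoly p

  norm : Ex → List Term
  norm (var i) = ((1 , 0) , i ∷ []) ∷ []
  norm (con n) = ((n , 0) , []) ∷ []
  norm (e :+ f) = addPoly (norm e) (norm f)
  norm (e :- f) = addPoly (norm e) (negPoly (norm f))
  norm (e :* f) = mulPoly (norm e) (norm f)

  -- Nothing is known about the sign of a monomial, so every nonconstant coefficient has to cancel.
  -- Cancelled terms stay in the list with equal components.
  nonneg? : List Term → Bool
  nonneg? [] = true
  nonneg? (((a , b) , []) ∷ p) = (b ℕ.≤ᵇ a) ∧ nonneg? p
  nonneg? (((a , b) , _ ∷ _) ∷ p) = (a ℕ.≡ᵇ b) ∧ nonneg? p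

  zero? : List Term → Bool
  zero? [] = true
  zero? (((a , b) , _) ∷ p) = (a ℕ.≡ᵇ b) ∧ zero? p

  module Sound (ρ : List ℚ) where
    mon : List ℕ → ℚ
    mon [] = ι 1
    mon (v ∷ m) = lookupOr0 ρ v * mon m

    term : Term → ℚ
    term ((a , b) , m) = (ι a - ι b) * mon m

    poly : List Term → ℚ
    poly [] = ι 0
    poly (t ∷ p) = term t + poly p

    insert-sound : ∀ v m → mon (insert v m) ≡ lookupOr0 ρ v * mon m
    insert-sound v [] = refl
    insert-sound v (w ∷ ws) with v ℕ.≤ᵇ w
    ... | true = refl
    ... | false = trans (cong (lookupOr0 ρ w *_) (insert-sound v ws))
      (trans (sym (*-assoc _ _ _)) (trans (cong (_* mon ws) (*-comm _ _)) (*-assoc _ _ _)))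

    mulMon-sound : ∀ m k → mon (mulMon m k) ≡ mon m * mon k
    mulMon-sound [] k = sym (*-identityˡ _)
    mulMon-sound (v ∷ m) k = trans (insert-sound v (mulMon m k))
      (trans (cong (lookupOr0 ρ v *_) (mulMon-sound m k)) (sym (*-assoc _ _ _)))

    addTerm-sound : ∀ t p → poly (addTerm t p) ≡ term t + poly p
    addTerm-sound t [] = refl
    addTerm-sound ((a , b) , m) (((c , d) , k) ∷ p) with m == k in eq
    ... | true rewrite ==-sound m k (subst T (sym eq) tt) | ι-+ a c | ι-+ b d =
      merge-terms (ι a) (ι b) (ι c) (ι d) (mon k) (poly p)
    ... | false = trans (cong (term ((c , d) , k) +_) (addTerm-sound ((a , b) , m) p))
      (swap-terms _ _ _)

    addPoly-sound : ∀ p q → poly (addPoly p q) ≡ poly p + poly q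
    addPoly-sound [] q = sym (+-identityˡ _)
    addPoly-sound (t ∷ p) q = trans (addTerm-sound t (addPoly p q))
      (trans (cong (term t +_) (addPoly-sound p q)) (sym (+-assoc _ _ _)))

    mulTerm-sound : ∀ t s → term (mulTerm t s) ≡ term t * term s
    mulTerm-sound ((a , b) , m) ((c , d) , k)
      rewrite mulMon-sound m k | ι-+ (a *ℕ c) (b *ℕ d) | ι-+ (a *ℕ d) (b *ℕ c)
            | ι-* a c | ι-* b d | ι-* a d | ι-* b c =
      mul-terms (ι a) (ι b) (ι c) (ι d) (mon m) (mon k)

    mulTermPoly-sound : ∀ t p → poly (mulTermPoly t p) ≡ term t * poly p
    mulTermPoly-sound t [] = sym (trans (*-comm _ _) (*-zeroˡ _))
    mulTermPoly-sound t (s ∷ p) = trans (addTerm-sound (mulTerm t s) (mulTermPoly t p))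
      (trans (cong₂ _+_ (mulTerm-sound t s) (mulTermPoly-sound t p)) (sym (*-distribˡ-+ _ _ _)))

    mulPoly-sound : ∀ p q → poly (mulPoly p q) ≡ poly p * poly q
    mulPoly-sound [] q = sym (*-zeroˡ _)
    mulPoly-sound (t ∷ p) q = trans (addPoly-sound (mulTermPoly t q) (mulPoly p q))
      (trans (cong₂ _+_ (mulTermPoly-sound t q) (mulPoly-sound p q)) (sym (distrib _ _ _)))

    negPoly-sound : ∀ p → poly (negPoly p) ≡ neg (poly p)
    negPoly-sound [] = sym (trans (sym (+-identityˡ _)) (-‿inverseʳ (ι 0)))
    negPoly-sound (((a , b) , m) ∷ p) = trans (cong (term ((b , a) , m) +_) (negPoly-sound p))
      (neg-term (ι a) (ι b) (mon m) (poly p))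

    norm-sound : ∀ e → poly (norm e) ≡ ⟦ e ⟧ ρ
    norm-sound (var i) = trans (+-identityʳ _)
      (trans (cong (_* mon (i ∷ [])) (trans (cong (_+ neg (ι 0)) (sym (+-identityʳ (ι 1))))
        (trans (+-assoc _ _ _) (trans (cong (ι 1 +_) (-‿inverseʳ (ι 0))) (+-identityʳ _)))))
      (trans (*-identityˡ _) (trans (*-comm _ _) (*-identityˡ _))))
    norm-sound (con n) = trans (+-identityʳ _) (trans (*-comm _ _) (trans (*-identityˡ _)
      (trans (cong (_+ neg (ι 0)) (sym (+-identityʳ (ι n))))
        (trans (+-assoc _ _ _) (trans (cong (ι n +_) (-‿inverseʳ (ι 0))) (+-identityʳ _))))))
    norm-sound (e :+ f) = trans (addPoly-sound (norm e) (norm f))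
      (cong₂ _+_ (norm-sound e) (norm-sound f))
    norm-sound (e :- f) = trans (addPoly-sound (norm e) (negPoly (norm f)))
      (cong₂ _+_ (norm-sound e) (trans (negPoly-sound (norm f)) (cong neg (norm-sound f))))
    norm-sound (e :* f) = trans (mulPoly-sound (norm e) (norm f))
      (cong₂ _*_ (norm-sound e) (norm-sound f))

    zero-sound : ∀ p → T (zero? p) → poly p ≡ ι 0
    zero-sound [] _ = refl
    zero-sound (((a , b) , m) ∷ p) t with Equivalence.to T-∧ t
    ... | a≡b , t′ with ℕₚ.≡ᵇ⇒≡ a b a≡b
    ... | refl = trans (cong₂ _+_ (trans (cong (_* mon m) (-‿inverseʳ (ι a))) (*-zeroˡ _)) (zero-sound p t′))
        (+-identityˡ _)

    nonneg-sound : ∀ p → T (nonneg? p) → ι 0 ≤ poly p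
    nonneg-sound [] _ = ≤-refl
    nonneg-sound (((a , b) , []) ∷ p) t with Equivalence.to T-∧ t
    ... | b≤a , t′ = ≤-trans (≡⇒≤ (sym (+-identityˡ _)))
      (+-mono-≤ (*-nonneg (≤⇒0≤ (ι-mono (ℕₚ.≤ᵇ⇒≤ b a b≤a))) (0≤ι 1)) (nonneg-sound p t′))
    nonneg-sound (((a , b) , m@(_ ∷ _)) ∷ p) t with Equivalence.to T-∧ t
    ... | a≡b , t′ with ℕₚ.≡ᵇ⇒≡ a b a≡b
    ... | refl = ≤-trans (≡⇒≤ (sym (+-identityˡ _)))
      (+-mono-≤ (≡⇒≤ (sym (trans (cong (_* mon m) (-‿inverseʳ (ι a))) (*-zeroˡ _)))) (nonneg-sound p t′))

  slack : Item → Ex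
  slack (c · e :≤ f) = con c :* (f :- e)
  slack (c · e := f) = con c :* (f :- e)
  -- An inequality with a negative multiplier contributes nothing, which keeps soundness free of
  -- side conditions.
  slack (c −· e :≤ f) = con 0
  slack (c −· e := f) = con c :* (e :- f)

  slacks : List Item → Ex
  slacks [] = con 0
  slacks (h ∷ hs) = slack h :+ slacks hs

-- This is Farkas' criterion with the multipliers supplied: k times the slack of the goal minus the
-- combined slacks must reduce to a nonnegative constant. The test 1 ≤ k permits division by k.
check : Sequent → Bool
check (hs ⊢ k · e :≤ f) = (1 ℕ.≤ᵇ k) ∧ nonneg? (norm (con k :* (f :- e) :- slacks hs))
check (_ ⊢ _) = false

*-cancel-0≤ : ∀ k {a} → 1 ≤ℕ k → ι 0 ≤ ι k * a → ι 0 ≤ a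
*-cancel-0≤ (suc k) {a} _ p = ≤-trans (*-nonneg (recip-nonneg k) p)
    (≡⇒≤ (trans (sym (*-assoc _ _ _)) (trans (cong (_* a) (trans (*-comm _ _) (recip-inverse k))) (*-identityˡ a))))
  where
  opaque
    unfolding _+_
    recip-nonneg : ∀ n → ι 0 ≤ recip (suc n)
    recip-nonneg n = ℚₚ.nonNegative⁻¹ (recip (suc n)) {{ℚₚ.normalize-nonNeg 1 (suc n)}}

private
  module Entail (ρ : List ℚ) where
    open Sound ρ

    slack-nonneg : ∀ i → ⟦ relation i ⟧ᴿ ρ → ι 0 ≤ ⟦ slack i ⟧ ρ
    slack-nonneg (c · e :≤ f) h = *-nonneg (0≤ι c) (≤⇒0≤ h)
    slack-nonneg (c · e := f) h = *-nonneg (0≤ι c) (≤⇒0≤ (≡⇒≤ h))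
    slack-nonneg (c −· e :≤ f) h = ≤-refl
    slack-nonneg (c −· e := f) h = *-nonneg (0≤ι c) (≤⇒0≤ (≡⇒≤ (sym h)))

    -- A sequent denotes a curried function, so the slacks of the hypotheses received so far are
    -- collected in `done`, and the final argument is passed as a continuation.
    check-sound : ∀ hs g (done : Ex) → ι 0 ≤ ⟦ done ⟧ ρ →
      (∀ (acc : Ex) → ι 0 ≤ ⟦ acc ⟧ ρ → ⟦ acc ⟧ ρ ≡ ⟦ slacks hs ⟧ ρ + ⟦ done ⟧ ρ → ⟦ g ⟧ᴿ ρ) → ∀ k →
      ⟦ hs ⊢ k · g ⟧ˢ ρ
    check-sound [] g done p cont k = cont done p (sym (+-identityˡ _))
    check-sound (h ∷ hs) g done p cont k hyp =
      check-sound hs g (slack h :+ done)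
        (≤-trans (≡⇒≤ (sym (+-identityˡ _))) (+-mono-≤ (slack-nonneg h hyp) p))
        (λ acc q eq → cont acc q (trans eq (trans (sym (+-assoc _ _ _)) (cong (_+ ⟦ done ⟧ ρ) (+-comm _ _))))) k

    difference : ∀ k e f hs → ι 0 ≤ ⟦ slacks hs ⟧ ρ →
      T (nonneg? (norm (con k :* (f :- e) :- slacks hs))) → ι 0 ≤ ι k * (⟦ f ⟧ ρ - ⟦ e ⟧ ρ)
    difference k e f hs p t =
      ≤-trans p (0≤⇒≤ (subst (ι 0 ≤_) (norm-sound (con k :* (f :- e) :- slacks hs))
          (nonneg-sound (norm (con k :* (f :- e) :- slacks hs)) t)))

≤-by-certificate : ∀ ρ hs k e f → T (check (hs ⊢ k · e :≤ f)) → ⟦ hs ⊢ k · e :≤ f ⟧ˢ ρ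
≤-by-certificate ρ hs k e f t with Equivalence.to T-∧ t
... | pos , t′ = check-sound hs (e :≤ f) (con 0) ≤-refl
    (λ acc q eq → 0≤⇒≤ (*-cancel-0≤ k (ℕₚ.≤ᵇ⇒≤ 1 k pos)
      (difference k e f hs (subst (ι 0 ≤_) (trans eq (+-identityʳ _)) q) t′))) k
  where open Entail ρ

≡-by-ring : ∀ ρ e f → T (zero? (norm (f :- e))) → ⟦ e ⟧ ρ ≡ ⟦ f ⟧ ρ
≡-by-ring ρ e f t = trans (sym (+-identityˡ _)) (trans (cong (_+ ⟦ e ⟧ ρ) (sym z)) (rearr _ _))
  where
  open Sound ρ
  z : ⟦ f ⟧ ρ - ⟦ e ⟧ ρ ≡ ι 0
  z = trans (sym (norm-sound (f :- e))) (zero-sound (norm (f :- e)) t)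

Curry : ℕ → (List ℚ → Set) → Set
Curry zero P = P []
Curry (suc n) P = (x : ℚ) → Curry n λ ρ → P (x ∷ ρ)

private
  curry-intro : ∀ n {P : List ℚ → Set} → (∀ ρ → P ρ) → Curry n P
  curry-intro zero p = p []
  curry-intro (suc n) p x = curry-intro n λ ρ → p (x ∷ ρ)

Fun : ℕ → Set → Set
Fun zero A = A
Fun (suc n) A = Ex → Fun n A

private
  instantiate : ∀ {A} n → ℕ → Fun n A → A
  instantiate zero i s = s
  instantiate (suc n) i f = instantiate n (suc i) (f (var i))

-- Linear arithmetic with a certificate: hypotheses carry the multipliers whose combination, up to a
-- nonnegative constant, is the indicated multiple of the conclusion.
lin : ∀ n (f : Fun n Sequent) {_ : T (check (instantiate n 0 f))} → Curry n ⟦ instantiate n 0 f ⟧ˢ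
lin n f {t} = curry-intro n λ ρ → go (instantiate n 0 f) t ρ
  where
  go : ∀ s → T (check s) → ∀ ρ → ⟦ s ⟧ˢ ρ
  go (hs ⊢ k · e :≤ f) t ρ = ≤-by-certificate ρ hs k e f t

Identity? : Rel → Set
Identity? (e :≤ f) = ⊥
Identity? (e := f) = T (zero? (norm (f :- e)))

ring : ∀ n (f : Fun n Rel) {_ : Identity? (instantiate n 0 f)} → Curry n ⟦ instantiate n 0 f ⟧ᴿ
ring n f {t} = curry-intro n λ ρ → go (instantiate n 0 f) t ρ
  where
  go : ∀ r → Identity? r → ∀ ρ → ⟦ r ⟧ᴿ ρ
  go (e := f) t ρ = ≡-by-ring ρ e f t

-- Finite sums and floor division

*-monoʳ-0≤ : ∀ {c a b} → ι 0 ≤ c → a ≤ b → c * a ≤ c * b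
*-monoʳ-0≤ {c} {a} {b} p q = lin 3 (λ c a b → 1 · con 0 :≤ c :* (b :- a) ∷ [] ⊢ 1 · c :* a :≤ c :* b)
  c a b (*-nonneg p (≤⇒0≤ q))

*-mono-0≤ : ∀ {a b c d} → ι 0 ≤ a → a ≤ b → ι 0 ≤ c → c ≤ d → a * c ≤ b * d
*-mono-0≤ {a} {b} {c} {d} 0≤a a≤b 0≤c c≤d =
  lin 4 (λ a b c d → 1 · con 0 :≤ a :* (d :- c) ∷ 1 · con 0 :≤ d :* (b :- a) ∷ [] ⊢ 1 · a :* c :≤ b :* d)
    a b c d (*-nonneg 0≤a (≤⇒0≤ c≤d)) (*-nonneg (≤-trans 0≤c c≤d) (≤⇒0≤ a≤b))

-- With c ≥ 1 neither division nor strict inequality is needed: if b ≤ a, then (c - 1)(a - b) ≥ 0,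
-- and the hypothesis leaves a - b ≤ 0.
*-cancel-≤ : ∀ {c a b} → ι 1 ≤ c → c * a ≤ c * b → a ≤ b
*-cancel-≤ {c} {a} {b} 1≤c le with ≤-total a b
... | inj₁ p = p
... | inj₂ p = lin 3 (λ c a b → 1 · c :* a :≤ c :* b ∷ 1 · con 0 :≤ (c :- con 1) :* (a :- b) ∷ [] ⊢ 1 · a :≤ b)
  c a b le (*-nonneg (≤⇒0≤ 1≤c) (≤⇒0≤ p))

ι-suc : ∀ n → ι (suc n) ≡ ι 1 + ι n
ι-suc n = ι-+ 1 n

recip-inv : ∀ {m} → 1 ≤ℕ m → ι m * recip m ≡ ι 1
recip-inv {suc m} _ = recip-inverse m

0≤recip : ∀ m → ι 0 ≤ recip m
0≤recip zero = recip0
  where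
  opaque
    unfolding _+_
    recip0 : ι 0 ≤ recip 0
    recip0 = ℚₚ.≤-refl
0≤recip (suc m) = *-cancel-0≤ (suc m) (s≤s z≤n) (≤-trans (0≤ι 1) (≡⇒≤ (sym (recip-inverse m))))

recip-anti : ∀ {m n} → 1 ≤ℕ m → m ≤ℕ n → recip n ≤ recip m
recip-anti {m} {n} 1≤m m≤n = ≤-trans (≡⇒≤ (trans (sym (*-identityˡ _)) (cong (_* recip n) (sym (recip-inv 1≤m)))))
  (≤-trans (lin 4 (λ m n r s → 1 · con 0 :≤ (r :* s) :* (n :- m) ∷ [] ⊢ 1 · m :* r :* s :≤ r :* (n :* s)) _ _ _ _
     (*-nonneg (*-nonneg (0≤recip m) (0≤recip n)) (≤⇒0≤ (ι-mono m≤n))))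
    (≡⇒≤ (trans (cong (recip m *_) (recip-inv (ℕₚ.≤-trans 1≤m m≤n))) (trans (*-comm _ _) (*-identityˡ _)))))

ind : ∀ {P : Set} → Dec P → ℚ
ind (yes _) = ι 1
ind (no _) = ι 0

ind-cong : ∀ {P Q : Set} (p : Dec P) (q : Dec Q) → (P → Q) → (Q → P) → ind p ≡ ind q
ind-cong (yes p) (yes q) f g = refl
ind-cong (yes p) (no q) f g = ⊥-elim (q (f p))
ind-cong (no p) (yes q) f g = ⊥-elim (p (g q))
ind-cong (no p) (no q) f g = refl

ind-yes : ∀ {P : Set} (d : Dec P) → P → ind d ≡ ι 1
ind-yes (yes _) p = refl
ind-yes (no ¬p) p = ⊥-elim (¬p p)

ind-no : ∀ {P : Set} (d : Dec P) → ¬ P → ind d ≡ ι 0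
ind-no (yes p) ¬p = ⊥-elim (¬p p)
ind-no (no _) ¬p = refl

0≤ind : ∀ {P : Set} (d : Dec P) → ι 0 ≤ ind d
0≤ind (yes _) = 0≤ι 1
0≤ind (no _) = ≤-refl

ind≤1 : ∀ {P : Set} (d : Dec P) → ind d ≤ ι 1
ind≤1 (yes _) = ≤-refl
ind≤1 (no _) = 0≤ι 1

∑ : ℕ → (ℕ → ℚ) → ℚ
∑ zero f = ι 0
∑ (suc n) f = ∑ n f + f (suc n)

∑-cong : ∀ n {f g : ℕ → ℚ} → (∀ k → 1 ≤ℕ k → k ≤ℕ n → f k ≡ g k) → ∑ n f ≡ ∑ n g
∑-cong zero e = refl
∑-cong (suc n) e = cong₂ _+_ (∑-cong n λ k p q → e k p (ℕₚ.m≤n⇒m≤1+n q)) (e (suc n) (s≤s z≤n) ℕₚ.≤-refl)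

∑-mono : ∀ n {f g : ℕ → ℚ} → (∀ k → 1 ≤ℕ k → k ≤ℕ n → f k ≤ g k) → ∑ n f ≤ ∑ n g
∑-mono zero e = ≤-refl
∑-mono (suc n) e = +-mono-≤ (∑-mono n λ k p q → e k p (ℕₚ.m≤n⇒m≤1+n q)) (e (suc n) (s≤s z≤n) ℕₚ.≤-refl)

∑-+ : ∀ n (f g : ℕ → ℚ) → ∑ n (λ k → f k + g k) ≡ ∑ n f + ∑ n g
∑-+ zero f g = sym (+-identityˡ _)
∑-+ (suc n) f g = trans (cong (_+ (f (suc n) + g (suc n))) (∑-+ n f g))
  (ring 4 (λ a b c d → a :+ b :+ (c :+ d) := a :+ c :+ (b :+ d)) _ _ _ _)

∑-* : ∀ n c (f : ℕ → ℚ) → ∑ n (λ k → c * f k) ≡ c * ∑ n f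
∑-* zero c f = sym (trans (*-comm _ _) (*-zeroˡ _))
∑-* (suc n) c f = trans (cong (_+ c * f (suc n)) (∑-* n c f)) (sym (*-distribˡ-+ _ _ _))

∑-*ʳ : ∀ n c (f : ℕ → ℚ) → ∑ n (λ k → f k * c) ≡ ∑ n f * c
∑-*ʳ n c f = trans (∑-cong n λ k _ _ → *-comm _ _) (trans (∑-* n c f) (*-comm _ _))

∑-- : ∀ n (f g : ℕ → ℚ) → ∑ n (λ k → f k - g k) ≡ ∑ n f - ∑ n g
∑-- zero f g = sym (-‿inverseʳ _)
∑-- (suc n) f g = trans (cong (_+ (f (suc n) - g (suc n))) (∑-- n f g))
  (ring 4 (λ a b c d → a :- b :+ (c :- d) := a :+ c :- (b :+ d)) _ _ _ _)

∑-zero : ∀ n {f : ℕ → ℚ} → (∀ k → 1 ≤ℕ k → k ≤ℕ n → f k ≡ ι 0) → ∑ n f ≡ ι 0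
∑-zero zero e = refl
∑-zero (suc n) e = trans (cong₂ _+_ (∑-zero n λ k p q → e k p (ℕₚ.m≤n⇒m≤1+n q)) (e (suc n) (s≤s z≤n) ℕₚ.≤-refl))
    (+-identityˡ _)

∑-nonneg : ∀ n {f : ℕ → ℚ} → (∀ k → 1 ≤ℕ k → k ≤ℕ n → ι 0 ≤ f k) → ι 0 ≤ ∑ n f
∑-nonneg n e = ≤-trans (≡⇒≤ (sym (∑-zero n {λ _ → ι 0} λ _ _ _ → refl))) (∑-mono n e)

∑-const : ∀ n c → ∑ n (λ _ → c) ≡ ι n * c
∑-const zero c = sym (*-zeroˡ c)
∑-const (suc n) c = trans (cong (_+ c) (∑-const n c)) (trans (ring 2 (λ n c → n :* c :+ c := (con 1 :+ n) :* c) _ _)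
    (cong (_* c) (sym (ι-suc n))))

∑-swap : ∀ m n (f : ℕ → ℕ → ℚ) → ∑ m (λ a → ∑ n (f a)) ≡ ∑ n (λ b → ∑ m (λ a → f a b))
∑-swap zero n f = sym (∑-zero n λ _ _ _ → refl)
∑-swap (suc m) n f = trans (cong (_+ ∑ n (f (suc m))) (∑-swap m n f)) (sym (∑-+ n _ _))

∑-extend : ∀ {m n} (f : ℕ → ℚ) → m ≤ℕ n → (∀ k → m <ℕ k → k ≤ℕ n → f k ≡ ι 0) → ∑ n f ≡ ∑ m f
∑-extend {m} {n} f m≤n e with ℕₚ.m≤n⇒m<n∨m≡n m≤n
... | inj₂ refl = refl
∑-extend {m} {suc n} f m≤n e | inj₁ (s≤s m≤n′) = trans (cong₂ _+_ (∑-extend f m≤n′ λ k p q → e k p (ℕₚ.m≤n⇒m≤1+n q))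
    (e (suc n) (s≤s m≤n′) ℕₚ.≤-refl)) (+-identityʳ _)

∑-mono-range : ∀ {m n} (f : ℕ → ℚ) → m ≤ℕ n → (∀ k → m <ℕ k → k ≤ℕ n → ι 0 ≤ f k) → ∑ m f ≤ ∑ n f
∑-mono-range {m} {n} f m≤n e with ℕₚ.m≤n⇒m<n∨m≡n m≤n
... | inj₂ refl = ≤-refl
∑-mono-range {m} {suc n} f m≤n e | inj₁ (s≤s m≤n′) =
  ≤-trans (≡⇒≤ (sym (+-identityʳ _))) (+-mono-≤ (∑-mono-range f m≤n′ λ k p q → e k p (ℕₚ.m≤n⇒m≤1+n q))
      (e (suc n) (s≤s m≤n′) ℕₚ.≤-refl))

∑-range-≤ : ∀ {m n} (f g : ℕ → ℚ) → m ≤ℕ n → (∀ k → m <ℕ k → k ≤ℕ n → f k ≤ g k) → ∑ n f - ∑ m f ≤ ∑ n g - ∑ m g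
∑-range-≤ {m} {n} f g m≤n e = lin 4 (λ a b c d → 1 · a :- b :≤ c :- d ∷ [] ⊢ 1 · d :- b :≤ c :- a) _ _ _ _
  (subst₂ _≤_ (∑-- m g f) (∑-- n g f) (∑-mono-range (λ k → g k - f k) m≤n λ k p q → ≤⇒0≤ (e k p q)))

∑-remove-first : ∀ n (f : ℕ → ℚ) → 1 ≤ℕ n → (∀ k → 2 ≤ℕ k → k ≤ℕ n → f k ≡ ι 0) → ∑ n f ≡ f 1
∑-remove-first n f 1≤n e = trans (∑-extend f 1≤n e) (+-identityˡ _)

infixl 7 _÷_

-- Division is total so that a summation index can be a divisor without carrying a proof that it is
-- nonzero.
_÷_ : ℕ → ℕ → ℕ
x ÷ zero = 0
x ÷ suc k = x ℕ./ suc k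

÷*≤ : ∀ x k → x ÷ k *ℕ k ≤ℕ x
÷*≤ x zero = z≤n
÷*≤ x (suc k) = DM.m/n*n≤m x (suc k)

<÷* : ∀ x {k} → 1 ≤ℕ k → x <ℕ suc (x ÷ k) *ℕ k
<÷* x {suc k} _ = subst (_<ℕ suc (x ÷ suc k) *ℕ suc k) (sym (DM.m≡m%n+[m/n]*n x (suc k)))
  (ℕₚ.+-monoˡ-< (x ÷ suc k *ℕ suc k) (DM.m%n<n x (suc k)))

*≤⇒≤÷ : ∀ {x k m} → 1 ≤ℕ k → m *ℕ k ≤ℕ x → m ≤ℕ x ÷ k
*≤⇒≤÷ {x} {k} {m} 1≤k le = ℕ.s≤s⁻¹ (ℕₚ.*-cancelʳ-< k m (suc (x ÷ k)) (ℕₚ.≤-<-trans le (<÷* x 1≤k)))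
  where instance _ = ℕ.>-nonZero 1≤k

≤÷⇒*≤ : ∀ {x k m} → m ≤ℕ x ÷ k → m *ℕ k ≤ℕ x
≤÷⇒*≤ {x} {k} le = ℕₚ.≤-trans (ℕₚ.*-monoˡ-≤ k le) (÷*≤ x k)

÷-mono : ∀ {x y} k → x ≤ℕ y → x ÷ k ≤ℕ y ÷ k
÷-mono zero _ = z≤n
÷-mono (suc k) le = DM./-monoˡ-≤ (suc k) le

÷-anti : ∀ x {k m} → 1 ≤ℕ k → k ≤ℕ m → x ÷ m ≤ℕ x ÷ k
÷-anti x {k} {m} 1≤k k≤m = *≤⇒≤÷ 1≤k (ℕₚ.≤-trans (ℕₚ.*-monoʳ-≤ (x ÷ m) k≤m) (÷*≤ x m))

÷-÷ : ∀ x {k m} → 1 ≤ℕ k → 1 ≤ℕ m → x ÷ k ÷ m ≡ x ÷ (k *ℕ m)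
÷-÷ x {suc k} {suc m} _ _ = DM.m/n/o≡m/[n*o] x (suc k) (suc m)

÷1 : ∀ x → x ÷ 1 ≡ x
÷1 x = DM.n/1≡n x

÷≤ : ∀ x k → x ÷ k ≤ℕ x
÷≤ x zero = z≤n
÷≤ x (suc k) = DM.m/n≤m x (suc k)

*÷ : ∀ {k} n → 1 ≤ℕ k → (k *ℕ n) ÷ k ≡ n
*÷ {suc k} n _ = trans (cong (ℕ._/ suc k) (ℕₚ.*-comm (suc k) n)) (DM.m*n/n≡m n (suc k))

1≤÷ : ∀ {x k} → 1 ≤ℕ k → k ≤ℕ x → 1 ≤ℕ x ÷ k
1≤÷ {x} {k} 1≤k k≤x = *≤⇒≤÷ 1≤k (subst (_≤ℕ x) (sym (ℕₚ.*-identityˡ k)) k≤x)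

÷>⇒0 : ∀ {x k} → x <ℕ k → x ÷ k ≡ 0
÷>⇒0 {x} {suc k} lt = DM.m<n⇒m/n≡0 lt

ι÷≤ : ∀ x {k} → 1 ≤ℕ k → ι (x ÷ k) ≤ ι x * recip k
ι÷≤ x {k} 1≤k = ≤-trans (≡⇒≤ (trans (sym (trans (*-comm _ _) (*-identityˡ _)))
    (trans (cong (ι (x ÷ k) *_) (sym (recip-inv 1≤k))) (sym (*-assoc _ _ _)))))
  (≤-trans (≡⇒≤ (cong (_* recip k) (sym (ι-* (x ÷ k) k)))) (*-mono-0≤ (0≤ι _) (ι-mono (÷*≤ x k)) (0≤recip k) ≤-refl))

≤ι÷+1 : ∀ x {k} → 1 ≤ℕ k → ι x * recip k ≤ ι (x ÷ k) + ι 1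
≤ι÷+1 x {k} 1≤k = ≤-trans (*-mono-0≤ (0≤ι _) (ι-mono (ℕₚ.<⇒≤ (<÷* x 1≤k))) (0≤recip k) ≤-refl)
  (≡⇒≤ (trans (cong (_* recip k) (ι-* (suc (x ÷ k)) k)) (trans (*-assoc _ _ _)
    (trans (cong (ι (suc (x ÷ k)) *_) (recip-inv 1≤k)) (trans (*-comm _ _) (trans (*-identityˡ _) (trans (ι-suc _)
        (+-comm _ _))))))))

-- Induction on x: the quotient `x ÷ k` increases, and by one, exactly when the new index is a
-- multiple of k.
∑-multiples : ∀ x {k} (g : ℕ → ℚ) → 1 ≤ℕ k → ∑ x (λ j → ind (k ∣? j) * g j) ≡ ∑ (x ÷ k) (λ m → g (k *ℕ m))
∑-multiples zero {suc k} g _ = refl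
∑-multiples (suc x) {k} g 1≤k with k ∣? suc x
... | no k∤ = trans (cong₂ _+_ (∑-multiples x g 1≤k) (*-zeroˡ _)) (trans (+-identityʳ _)
    (cong (λ q → ∑ q (λ m → g (k *ℕ m))) same))
  where
  same : x ÷ k ≡ suc x ÷ k
  same = ℕₚ.≤-antisym (÷-mono k (ℕₚ.n≤1+n x)) (*≤⇒≤÷ 1≤k (ℕ.s≤s⁻¹ (ℕₚ.≤∧≢⇒< (÷*≤ (suc x) k) λ e → k∤
      (divides (suc x ÷ k) (sym e)))))
... | yes (divides zero ())
... | yes (divides (suc q) e) = trans (cong₂ _+_ (∑-multiples x g 1≤k) (*-identityˡ _))
    (trans (cong₂ _+_ (cong (λ q → ∑ q (λ m → g (k *ℕ m))) x÷k) (cong g (trans e (ℕₚ.*-comm (suc q) k))))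
      (sym (cong (λ q → ∑ q (λ m → g (k *ℕ m))) sx÷k)))
  where
  sx÷k : suc x ÷ k ≡ suc q
  sx÷k = trans (cong (_÷ k) (trans e (ℕₚ.*-comm (suc q) k))) (*÷ (suc q) 1≤k)
  x÷k : x ÷ k ≡ q
  x÷k = ℕₚ.≤-antisym
    (ℕ.s≤s⁻¹ (ℕₚ.*-cancelʳ-< k (x ÷ k) (suc q) (ℕₚ.≤-<-trans (÷*≤ x k) (subst (x <ℕ_) e ℕₚ.≤-refl))))
    (*≤⇒≤÷ 1≤k (ℕ.s≤s⁻¹ (ℕₚ.≤-trans (ℕₚ.+-monoˡ-≤ (q *ℕ k) 1≤k) (ℕₚ.≤-reflexive (sym e)))))
    where instance _ = ℕ.>-nonZero 1≤k

-- Divisor sums and exchange of summation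

dsum : ℕ → (ℕ → ℚ) → ℚ
dsum n f = ∑ n λ d → ind (d ∣? n) * f d

dsum-cong : ∀ n {f g : ℕ → ℚ} → (∀ d → 1 ≤ℕ d → d ∣ n → f d ≡ g d) → dsum n f ≡ dsum n g
dsum-cong n {f} {g} e = ∑-cong n λ d 1≤d _ → go d 1≤d
  where
  go : ∀ d → 1 ≤ℕ d → ind (d ∣? n) * f d ≡ ind (d ∣? n) * g d
  go d 1≤d with d ∣? n
  ... | yes p = cong (ι 1 *_) (e d 1≤d p)
  ... | no _ = trans (*-zeroˡ _) (sym (*-zeroˡ _))

dsum-extend : ∀ {n x} (f : ℕ → ℚ) → 1 ≤ℕ n → n ≤ℕ x → ∑ x (λ d → ind (d ∣? n) * f d) ≡ dsum n f
dsum-extend {suc n} f _ n≤x = ∑-extend _ n≤x λ k n<k _ →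
  trans (cong (_* f k) (ind-no (k ∣? suc n) (∣ₚ.>⇒∤ n<k))) (*-zeroˡ _)

∑-dsum : ∀ x (f : ℕ → ℕ → ℚ) → ∑ x (λ j → dsum j (λ k → f k j)) ≡ ∑ x (λ k → ∑ (x ÷ k) (λ m → f k (k *ℕ m)))
∑-dsum x f = trans (∑-cong x λ j 1≤j j≤x → sym (dsum-extend (λ k → f k j) 1≤j j≤x))
  (trans (∑-swap x x _) (∑-cong x λ k 1≤k _ → ∑-multiples x (f k) 1≤k))

∑-truncate : ∀ y {m} (g : ℕ → ℚ) → 1 ≤ℕ m → ∑ (y ÷ m) g ≡ ∑ y (λ j → ind (j *ℕ m ℕ.≤? y) * g j)
∑-truncate y {m} g 1≤m = trans
  (∑-cong (y ÷ m) λ j _ j≤ → sym (trans (cong (_* g j) (ind-yes (j *ℕ m ℕ.≤? y) (≤÷⇒*≤ {y} {m} j≤))) (*-identityˡ _)))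
  (sym (∑-extend (λ j → ind (j *ℕ m ℕ.≤? y) * g j) (÷≤ y m) λ j lt _ →
    trans (cong (_* g j) (ind-no (j *ℕ m ℕ.≤? y) λ le → ℕₚ.<⇒≱ lt (*≤⇒≤÷ 1≤m le))) (*-zeroˡ _)))

-- Both sides run over the pairs with m j ≤ y. Written as an indicator, this condition is symmetric
-- and the two sums become independent.
∑-hyperbola : ∀ y (f : ℕ → ℕ → ℚ) → ∑ y (λ m → ∑ (y ÷ m) (f m)) ≡ ∑ y (λ j → ∑ (y ÷ j) (λ m → f m j))
∑-hyperbola y f = trans (∑-cong y λ m 1≤m _ → ∑-truncate y (f m) 1≤m) (trans (∑-swap y y _)
  (∑-cong y λ j 1≤j _ → trans (∑-cong y λ m _ _ → cong (λ n → ind (n ℕ.≤? y) * f m j) (ℕₚ.*-comm j m))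
    (sym (∑-truncate y (λ m → f m j) 1≤j))))

÷-lower : ∀ x {k} → 1 ≤ℕ k → ι x ≤ ι (x ÷ k) * ι k + ι k
÷-lower x {k} 1≤k = ≤-trans (ι-mono (ℕₚ.<⇒≤ (<÷* x 1≤k))) (≡⇒≤ (trans (ι-* (suc (x ÷ k)) k)
  (trans (cong (_* ι k) (ι-suc _)) (ring 2 (λ q k → (con 1 :+ q) :* k := q :* k :+ k) _ _))))

÷-upper : ∀ x k → ι (x ÷ k) * ι k ≤ ι x
÷-upper x k = ≤-trans (≡⇒≤ (sym (ι-* (x ÷ k) k))) (ι-mono (÷*≤ x k))

ι-*-mono : ∀ {a b c} → a *ℕ b ≤ℕ c → ι a * ι b ≤ ι c
ι-*-mono {a} {b} le = ≤-trans (≡⇒≤ (sym (ι-* a b))) (ι-mono le)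

-- Prime factorisations and the Möbius function

-- The Möbius function on a list of primes: a prime that occurs again later gives the factor 0, any
-- other the factor -1.
sgn : List ℕ → ℚ
sgn [] = ι 1
sgn (p ∷ ps) = (ind (p ∈? ps) - ι 1) * sgn ps

sgn-∈ : ∀ {p ps} → p ∈ ps → sgn (p ∷ ps) ≡ ι 0
sgn-∈ {p} {ps} p∈ = trans (cong (λ i → (i - ι 1) * sgn ps) (ind-yes (p ∈? ps) p∈))
  (trans (cong (_* sgn ps) (-‿inverseʳ _)) (*-zeroˡ _))

-- Invariance under permutation allows μ (p n) to be read off from p followed by the factors of n,
-- whatever order the factorisation has.
sgn-↭ : ∀ {ps qs} → ps ↭ qs → sgn ps ≡ sgn qs
sgn-↭ Perm.refl = refl
sgn-↭ (Perm.prep {ps} {qs} x p) = cong₂ (λ i s → (i - ι 1) * s)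
  (ind-cong (x ∈? ps) (x ∈? qs) (Permₚ.∈-resp-↭ p) (Permₚ.∈-resp-↭ (Perm.↭-sym p))) (sgn-↭ p)
sgn-↭ (Perm.swap {ps} {qs} x y p) = go (x ℕₚ.≟ y)
  where
  go : Dec (x ≡ y) → sgn (x ∷ y ∷ ps) ≡ sgn (y ∷ x ∷ qs)
  go (yes refl) = trans (sgn-∈ {x} {y ∷ ps} (here refl)) (sym (sgn-∈ {y} {x ∷ qs} (here refl)))
  go (no x≢y) = trans (cong₂ (λ i s → (i - ι 1) * s) (ind-cong (x ∈? (y ∷ ps)) (x ∈? qs)
      (λ { (here e) → ⊥-elim (x≢y e) ; (there h) → Permₚ.∈-resp-↭ p h }) (λ h → there (Permₚ.∈-resp-↭ (Perm.↭-sym p) h)))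
      (cong₂ (λ i s → (i - ι 1) * s) (ind-cong (y ∈? ps) (y ∈? (x ∷ qs))
      (λ h → there (Permₚ.∈-resp-↭ p h)) (λ { (here e) → ⊥-elim (x≢y (sym e)) ; (there h) → Permₚ.∈-resp-↭
          (Perm.↭-sym p) h })) (sgn-↭ p)))
    (ring 3 (λ a b s → a :* (b :* s) := b :* (a :* s)) _ _ _)
sgn-↭ (Perm.trans p q) = trans (sgn-↭ p) (sgn-↭ q)

sgn-bounded : ∀ ps → ι 0 - ι 1 ≤ sgn ps × sgn ps ≤ ι 1
sgn-bounded [] = lin 0 ([] ⊢ 1 · con 0 :- con 1 :≤ con 1) , ≤-refl
sgn-bounded (p ∷ ps) with p ∈? ps | sgn-bounded ps
... | yes _ | _ = lin 1 (λ s → [] ⊢ 1 · con 0 :- con 1 :≤ (con 1 :- con 1) :* s) _ , lin 1 (λ s → [] ⊢ 1 ·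
    (con 1 :- con 1) :* s :≤ con 1) _
... | no _ | l , u = lin 1 (λ s → 1 · s :≤ con 1 ∷ [] ⊢ 1 · con 0 :- con 1 :≤ (con 0 :- con 1) :* s) _ u ,
                     lin 1 (λ s → 1 · con 0 :- con 1 :≤ s ∷ [] ⊢ 1 · (con 0 :- con 1) :* s :≤ con 1) _ l

fac : ℕ → List ℕ
fac zero = []
fac (suc n) = factors (factorise (suc n))

fac-product : ∀ {n} → 1 ≤ℕ n → product (fac n) ≡ n
fac-product {suc n} _ = sym (PrimeFactorisation.isFactorisation (factorise (suc n)))

fac-prime : ∀ n → All Prime (fac n)
fac-prime zero = []
fac-prime (suc n) = PrimeFactorisation.factorsPrime (factorise (suc n))

fac-unique : ∀ {n ps} → 1 ≤ℕ n → product ps ≡ n → All Prime ps → fac n ↭ ps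
fac-unique {suc n} {ps} _ e pr = factorisationUnique (factorise (suc n))
  (record { factors = ps ; isFactorisation = sym e ; factorsPrime = pr })

1≤* : ∀ {a b} → 1 ≤ℕ a → 1 ≤ℕ b → 1 ≤ℕ a *ℕ b
1≤* p q = ℕₚ.*-mono-≤ p q

1≤*ʳ : ∀ a {b} → 1 ≤ℕ a *ℕ b → 1 ≤ℕ b
1≤*ʳ a {zero} p = subst (1 ≤ℕ_) (ℕₚ.*-zeroʳ a) p
1≤*ʳ a {suc b} p = s≤s z≤n

prime≥1 : ∀ {p} → Prime p → 1 ≤ℕ p
prime≥1 pr = ℕ.>-nonZero⁻¹ _ {{Pr.prime⇒nonZero pr}}

prime≥2 : ∀ {p} → Prime p → 2 ≤ℕ p
prime≥2 pr = ℕ.nonTrivial⇒n>1 _ {{Pr.prime⇒nonTrivial pr}}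

fac-* : ∀ {a b} → 1 ≤ℕ a → 1 ≤ℕ b → fac (a *ℕ b) ↭ fac a ++ fac b
fac-* {a} {b} 1≤a 1≤b = fac-unique (1≤* 1≤a 1≤b)
  (trans (LAₚ.product-++ (fac a) (fac b)) (cong₂ _*ℕ_ (fac-product 1≤a) (fac-product 1≤b)))
  (Allₚ.++⁺ (fac-prime a) (fac-prime b))

fac-prime-* : ∀ {p b} → Prime p → 1 ≤ℕ b → fac (p *ℕ b) ↭ p ∷ fac b
fac-prime-* {p} {b} pr 1≤b = fac-unique (1≤* (prime≥1 pr) 1≤b) (cong (p *ℕ_) (fac-product 1≤b)) (pr ∷ fac-prime b)

-- One prime is split off at a time and p may divide n, so no decomposition into coprime prime
-- powers is needed.
prime-induction : (P : ℕ → Set) → P 1 → (∀ p n → Prime p → 1 ≤ℕ n → P n → P (p *ℕ n)) → ∀ n → 1 ≤ℕ n → P n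
prime-induction P P1 step n 1≤n = subst P (fac-product 1≤n) (proj₂ (go (fac n) (fac-prime n)))
  where
  go : ∀ ps → All Prime ps → 1 ≤ℕ product ps × P (product ps)
  go [] [] = s≤s z≤n , P1
  go (p ∷ ps) (pr ∷ prs) with go ps prs
  ... | 1≤m , Pm = 1≤* (prime≥1 pr) 1≤m , step p (product ps) pr 1≤m Pm

coprime-divisor : ∀ {p d n} → Prime p → p ∤ d → d ∣ p *ℕ n → d ∣ n
coprime-divisor {p} {d} pr p∤d = Cop.coprime-divisor {d} {p} coprime
  where
  coprime : Cop.Coprime d p
  coprime (c∣d , c∣p) with Pr.prime⇒irreducible pr c∣p
  ... | inj₁ c≡1 = c≡1
  ... | inj₂ refl = ⊥-elim (p∤d c∣d)

-- A divisor of p n is either prime to p, and then divides n, or p times a divisor of n. As p may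
-- divide n, an indicator cuts out the first kind.
dsum-prime-* : ∀ {p n} (h : ℕ → ℚ) → Prime p → 1 ≤ℕ n →
  dsum (p *ℕ n) h ≡ dsum n (λ d → (ι 1 - ind (p ∣? d)) * h d + h (p *ℕ d))
dsum-prime-* {p} {n} h pr 1≤n = trans (∑-cong (p *ℕ n) λ d _ _ → split d)
  (trans (∑-+ (p *ℕ n) _ _) (trans (cong₂ _+_ coprime-part multiple-part)
    (trans (sym (∑-+ n _ _)) (∑-cong n λ d _ _ → sym (*-distribˡ-+ _ _ _)))))
  where
  N = p *ℕ n
  split : ∀ d → ind (d ∣? N) * h d ≡ ind (d ∣? N) * ((ι 1 - ind (p ∣? d)) * h d) + ind (p ∣? d) * (ind (d ∣? N) * h d)
  split d = ring 3 (λ a b h → a :* h := a :* ((con 1 :- b) :* h) :+ b :* (a :* h)) _ _ _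
  same : ∀ d → ind (d ∣? N) * ((ι 1 - ind (p ∣? d)) * h d) ≡ ind (d ∣? n) * ((ι 1 - ind (p ∣? d)) * h d)
  same d with p ∣? d
  ... | yes _ = ring 3 (λ a b h → a :* ((con 1 :- con 1) :* h) := b :* ((con 1 :- con 1) :* h)) _ _ _
  ... | no p∤d = cong (_* ((ι 1 - ι 0) * h d)) (ind-cong (d ∣? N) (d ∣? n) (coprime-divisor pr p∤d) (∣ₚ.∣n⇒∣m*n p))
  coprime-part : ∑ N (λ d → ind (d ∣? N) * ((ι 1 - ind (p ∣? d)) * h d)) ≡ dsum n (λ d → (ι 1 - ind (p ∣? d)) * h d)
  coprime-part = trans (∑-cong N λ d _ _ → same d) (dsum-extend _ 1≤n
      (ℕₚ.≤-trans (ℕₚ.≤-reflexive (sym (ℕₚ.*-identityˡ n))) (ℕₚ.*-monoˡ-≤ n (prime≥1 pr))))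
  multiple-part : ∑ N (λ d → ind (p ∣? d) * (ind (d ∣? N) * h d)) ≡ dsum n (λ d → h (p *ℕ d))
  multiple-part = trans (∑-multiples N (λ d → ind (d ∣? N) * h d) (prime≥1 pr))
    (trans (cong (λ q → ∑ q (λ m → ind (p *ℕ m ∣? N) * h (p *ℕ m))) (*÷ n (prime≥1 pr)))
      (∑-cong n λ d _ _ → cong (_* h (p *ℕ d)) (ind-cong (p *ℕ d ∣? N) (d ∣? n) (∣ₚ.*-cancelˡ-∣ p
          {{Pr.prime⇒nonZero pr}}) (∣ₚ.*-monoʳ-∣ p))))

μ : ℕ → ℚ
μ n = sgn (fac n)

∣⇔∈fac : ∀ {p n} → Prime p → 1 ≤ℕ n → ind (p ∈? fac n) ≡ ind (p ∣? n)
∣⇔∈fac {p} {n} pr 1≤n = ind-cong (p ∈? fac n) (p ∣? n)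
  (λ h → subst (p ∣_) (fac-product 1≤n) (LAₚ.∈⇒∣product h))
  (λ h → factorisationHasAllPrimeFactors pr (subst (p ∣_) (sym (fac-product 1≤n)) h) (fac-prime n))

μ-prime-* : ∀ {p n} → Prime p → 1 ≤ℕ n → μ (p *ℕ n) ≡ (ind (p ∣? n) - ι 1) * μ n
μ-prime-* {p} {n} pr 1≤n = trans (sgn-↭ (fac-prime-* pr 1≤n)) (cong (λ i → (i - ι 1) * μ n) (∣⇔∈fac pr 1≤n))

-- Divisors of p n are paired as d and p d with p not dividing d; the Möbius function changes sign within a pair.
dsum-μ-prime-* : ∀ {p n} (g : ℕ → ℚ) → Prime p → 1 ≤ℕ n →
  dsum (p *ℕ n) (λ d → μ d * g d) ≡ dsum n (λ d → (ι 1 - ind (p ∣? d)) * (μ d * (g d - g (p *ℕ d))))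
dsum-μ-prime-* {p} {n} g pr 1≤n = trans (dsum-prime-* _ pr 1≤n) (dsum-cong n λ d 1≤d _ →
  trans (cong (λ m → (ι 1 - ind (p ∣? d)) * (μ d * g d) + m * g (p *ℕ d)) (μ-prime-* pr 1≤d))
    (ring 4 (λ i m a b → (con 1 :- i) :* (m :* a) :+ (i :- con 1) :* m :* b := (con 1 :- i) :* (m :* (a :- b))) _ _ _ _))

dsum-zero : ∀ n {f : ℕ → ℚ} → (∀ d → 1 ≤ℕ d → d ∣ n → f d ≡ ι 0) → dsum n f ≡ ι 0
dsum-zero n e = trans (dsum-cong n e) (∑-zero n λ _ _ _ → trans (*-comm _ _) (*-zeroˡ _))

dsum-1 : ∀ f → dsum 1 f ≡ f 1
dsum-1 f = trans (+-identityˡ _) (*-identityˡ _)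

dsum-* : ∀ n c (f : ℕ → ℚ) → dsum n (λ d → c * f d) ≡ c * dsum n f
dsum-* n c f = trans (∑-cong n λ _ _ _ → ring 3 (λ i c f → i :* (c :* f) := c :* (i :* f)) _ _ _) (∑-* n c _)

dsum-- : ∀ n (f g : ℕ → ℚ) → dsum n (λ d → f d - g d) ≡ dsum n f - dsum n g
dsum-- n f g = trans (∑-cong n λ _ _ _ → ring 3 (λ i a b → i :* (a :- b) := i :* a :- i :* b) _ _ _) (∑-- n _ _)

dsum-+ : ∀ n (f g : ℕ → ℚ) → dsum n (λ d → f d + g d) ≡ dsum n f + dsum n g
dsum-+ n f g = trans (∑-cong n λ _ _ _ → *-distribˡ-+ _ _ _) (∑-+ n _ _)

dsum-μ : ∀ {n} → 1 ≤ℕ n → dsum n μ ≡ ind (n ℕₚ.≟ 1)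
dsum-μ {n} = prime-induction (λ n → dsum n μ ≡ ind (n ℕₚ.≟ 1)) (dsum-1 μ) step n
  where
  step : ∀ p n → Prime p → 1 ≤ℕ n → dsum n μ ≡ ind (n ℕₚ.≟ 1) → dsum (p *ℕ n) μ ≡ ind (p *ℕ n ℕₚ.≟ 1)
  step p n pr 1≤n _ = trans (dsum-cong (p *ℕ n) λ d _ _ → sym (trans (*-comm _ _) (*-identityˡ _)))
    (trans (dsum-μ-prime-* (λ _ → ι 1) pr 1≤n) (trans
      (dsum-zero n λ d _ _ → ring 2 (λ i m → (con 1 :- i) :* (m :* (con 1 :- con 1)) := con 0) _ _)
      (sym (ind-no (p *ℕ n ℕₚ.≟ 1) λ e → ℕₚ.<⇒≢ (ℕₚ.≤-trans (prime≥2 pr)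
          (ℕₚ.≤-trans (ℕₚ.≤-reflexive (sym (ℕₚ.*-identityʳ p))) (ℕₚ.*-monoʳ-≤ p 1≤n))) (sym e)))))

-- The indicator of the powers of p.
pow : ℕ → ℕ → ℚ
pow p n = dsum n λ d → μ d * (ι 1 - ind (p ∣? d))

-- Only d prime to p contribute, and their partners p d have value 0, so pairing divisors returns
-- the sum for n.
pow-self : ∀ {p n} → Prime p → 1 ≤ℕ n → pow p (p *ℕ n) ≡ pow p n
pow-self {p} {n} pr 1≤n = trans (dsum-μ-prime-* _ pr 1≤n) (dsum-cong n λ d _ _ →
  trans (cong (λ i → (ι 1 - ind (p ∣? d)) * (μ d * ((ι 1 - ind (p ∣? d)) - (ι 1 - i)))) (ind-yes (p ∣? p *ℕ d)
      (∣ₚ.m∣m*n d))) (idem d))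
  where
  idem : ∀ d → (ι 1 - ind (p ∣? d)) * (μ d * ((ι 1 - ind (p ∣? d)) - (ι 1 - ι 1))) ≡ μ d * (ι 1 - ind (p ∣? d))
  idem d with p ∣? d
  ... | yes _ = ring 1 (λ m → (con 1 :- con 1) :* (m :* ((con 1 :- con 1) :- (con 1 :- con 1))) := m :* (con 1 :- con 1)) _
  ... | no _ = ring 1 (λ m → (con 1 :- con 0) :* (m :* ((con 1 :- con 0) :- (con 1 :- con 1))) := m :* (con 1 :- con 0)) _

-- Multiplication by q does not affect divisibility by p, so the two members of every pair cancel.
pow-other : ∀ {p q n} → Prime p → Prime q → p ≢ q → 1 ≤ℕ n → pow p (q *ℕ n) ≡ ι 0
pow-other {p} {q} {n} pr qr p≢q 1≤n = trans (dsum-μ-prime-* _ qr 1≤n) (dsum-zero n λ d _ _ →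
  trans (cong (λ i → (ι 1 - ind (q ∣? d)) * (μ d * ((ι 1 - ind (p ∣? d)) - (ι 1 - i)))) (same d))
    (ring 3 (λ a m i → (con 1 :- a) :* (m :* ((con 1 :- i) :- (con 1 :- i))) := con 0) _ _ _))
  where
  same : ∀ d → ind (p ∣? q *ℕ d) ≡ ind (p ∣? d)
  same d = ind-cong (p ∣? q *ℕ d) (p ∣? d) to (∣ₚ.∣n⇒∣m*n q)
    where
    to : p ∣ q *ℕ d → p ∣ d
    to h with Pr.euclidsLemma q d pr h
    ... | inj₂ p∣d = p∣d
    ... | inj₁ p∣q with Pr.prime⇒irreducible qr p∣q
    ... | inj₁ refl = ⊥-elim (Pr.¬prime[1] pr)
    ... | inj₂ p≡q = ⊥-elim (p≢q p≡q)

pow-cases : ∀ {p} → Prime p → ∀ {n} → 1 ≤ℕ n → pow p n ≡ ι 0 ⊎ (pow p n ≡ ι 1 × ∃ λ k → n ≡ p ℕ.^ k)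
pow-cases {p} pr {n} = prime-induction _ (inj₂ (trans (dsum-1 (λ d → μ d * (ι 1 - ind (p ∣? d)))) base , 0 , refl)) step n
  where
  base : μ 1 * (ι 1 - ind (p ∣? 1)) ≡ ι 1
  base = trans (cong (λ i → ι 1 * (ι 1 - i)) (ind-no (p ∣? 1) λ h → Pr.¬prime[1] (subst Prime (∣ₚ.∣1⇒≡1 h) pr)))
    (ring 0 (con 1 :* (con 1 :- con 0) := con 1))
  step : ∀ q n → Prime q → 1 ≤ℕ n → pow p n ≡ ι 0 ⊎ (pow p n ≡ ι 1 × ∃ λ k → n ≡ p ℕ.^ k) →
    pow p (q *ℕ n) ≡ ι 0 ⊎ (pow p (q *ℕ n) ≡ ι 1 × ∃ λ k → q *ℕ n ≡ p ℕ.^ k)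
  step q n qr 1≤n ih with p ℕₚ.≟ q
  ... | no p≢q = inj₁ (pow-other pr qr p≢q 1≤n)
  step q n qr 1≤n (inj₁ z) | yes refl = inj₁ (trans (pow-self pr 1≤n) z)
  step q n qr 1≤n (inj₂ (o , k , e)) | yes refl = inj₂ (trans (pow-self pr 1≤n) o , suc k , cong (p *ℕ_) e)

pow-coprime : ∀ {p n} → Prime p → 1 ≤ℕ n → p ∤ n → pow p n ≡ ind (n ℕₚ.≟ 1)
pow-coprime {p} {n} pr 1≤n p∤n = trans (dsum-cong n λ d _ d∣n →
  trans (cong (λ i → μ d * (ι 1 - i)) (ind-no (p ∣? d) λ h → p∤n (∣ₚ.∣-trans h d∣n)))
    (ring 1 (λ m → m :* (con 1 :- con 0) := m) _)) (dsum-μ 1≤n)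

recip-* : ∀ {k m} → 1 ≤ℕ k → 1 ≤ℕ m → recip (k *ℕ m) ≡ recip k * recip m
recip-* {k} {m} 1≤k 1≤m = trans (sym (*-identityˡ _)) (trans (cong (_* recip (k *ℕ m))
    (sym (trans (cong₂ _*_ (recip-inv 1≤k) (recip-inv 1≤m)) (*-identityˡ _))))
  (trans (ring 5 (λ k r m s t → k :* r :* (m :* s) :* t := k :* m :* t :* (r :* s)) _ _ _ _ _)
    (trans (cong (_* (recip k * recip m)) (trans (cong (_* recip (k *ℕ m)) (sym (ι-* k m)))
        (recip-inv (1≤* 1≤k 1≤m)))) (*-identityˡ _))))

1≤^ : ∀ {K} n → 1 ≤ℕ K → 1 ≤ℕ K ℕ.^ n
1≤^ zero _ = s≤s z≤n
1≤^ (suc n) p = 1≤* p (1≤^ n p)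

suc≤^ : ∀ {K} n → 2 ≤ℕ K → suc n ≤ℕ K ℕ.^ n
suc≤^ zero _ = s≤s z≤n
suc≤^ {K} (suc n) 2≤K = ℕₚ.≤-trans (ℕₚ.≤-trans (ℕₚ.≤-reflexive (ℕₚ.+-comm 1 (suc n))) (ℕₚ.+-monoʳ-≤ (suc n) (s≤s z≤n)))
  (ℕₚ.≤-trans (ℕₚ.*-monoʳ-≤ 2 (suc≤^ n 2≤K)) (ℕₚ.*-monoˡ-≤ (K ℕ.^ n) 2≤K))

∑-telescope : ∀ n (f : ℕ → ℚ) → ∑ n (λ i → f (suc i) - f i) ≡ f (suc n) - f 1
∑-telescope zero f = sym (-‿inverseʳ _)
∑-telescope (suc n) f = trans (cong (_+ (f (suc (suc n)) - f (suc n))) (∑-telescope n f))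
    (ring 3 (λ a b c → a :- b :+ (c :- a) := c :- b) _ _ _)

pigeonhole : ∀ n (c : ℚ) (w : ℕ → ℚ) → (∃ λ i → 1 ≤ℕ i × i ≤ℕ n × c * w i ≤ ι 1) ⊎ ι n ≤ c * ∑ n w
pigeonhole zero c w = inj₂ (≡⇒≤ (sym (trans (*-comm _ _) (*-zeroˡ _))))
pigeonhole (suc n) c w with pigeonhole n c w
... | inj₁ (i , p , q , r) = inj₁ (i , p , ℕₚ.m≤n⇒m≤1+n q , r)
... | inj₂ le with ≤-total (c * w (suc n)) (ι 1)
... | inj₁ r = inj₁ (suc n , s≤s z≤n , ℕₚ.≤-refl , r)
... | inj₂ r = inj₂ (lin 5 (λ n sn c s w → 1 · n :≤ c :* s ∷ 1 · con 1 :≤ c :* w ∷ 1 · sn := con 1 :+ n ∷ [] ⊢ 1 · sn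
    :≤ c :* (s :+ w)) _ _ _ _ _ le r (ι-suc n))

square-mono : ∀ {m n} → m ≤ℕ n → m *ℕ m ≤ℕ n *ℕ n
square-mono le = ℕₚ.*-mono-≤ le le

isqrt : ∀ n → ∃ λ s → s *ℕ s ≤ℕ n × n <ℕ suc s *ℕ suc s
isqrt zero = 0 , z≤n , s≤s z≤n
isqrt (suc n) with isqrt n
... | s , l , u with suc s *ℕ suc s ℕ.≤? suc n
... | yes le = suc s , le , ℕₚ.≤-<-trans u (ℕₚ.*-mono-< (ℕₚ.n<1+n (suc s)) (ℕₚ.n<1+n (suc s)))
... | no ≰ = s , ℕₚ.m≤n⇒m≤1+n l , ℕₚ.≰⇒> ≰

-- A completely additive rational logarithm

Harm : ℕ → ℚ
Harm n = ∑ n recip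

Harm-≤ : ∀ k j → 1 ≤ℕ k → Harm (j +ℕ k) - Harm k ≤ ι j * recip k
Harm-≤ k zero _ = lin 2 (λ a r → [] ⊢ 1 · a :- a :≤ con 0 :* r) _ _
Harm-≤ k (suc j) 1≤k = lin 6 (λ a b r s j sj → 1 · a :- b :≤ j :* r ∷ 1 · s :≤ r ∷ 1 −· sj :* r := (con 1 :+ j) :* r ∷
    [] ⊢ 1 · a :+ s :- b :≤ sj :* r) _ _ _ _ _ _
  (Harm-≤ k j 1≤k) (recip-anti 1≤k (ℕₚ.m≤n⇒m≤1+n (ℕₚ.m≤n+m k j))) (cong (_* recip k) (ι-suc j))

≤-Harm : ∀ k j {t} → j +ℕ k ≤ℕ t → ι j * recip t ≤ Harm (j +ℕ k) - Harm k
≤-Harm k zero _ = lin 2 (λ a r → [] ⊢ 1 · con 0 :* r :≤ a :- a) _ _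
≤-Harm k (suc j) {t} le = lin 6 (λ a b r s j sj → 1 · j :* r :≤ a :- b ∷ 1 · r :≤ s ∷ 1 · sj :* r := (con 1 :+ j) :* r
    ∷ [] ⊢ 1 · sj :* r :≤ a :+ s :- b) _ _ _ _ _ _
  (≤-Harm k j (ℕₚ.≤-trans (ℕₚ.n≤1+n _) le)) (recip-anti (s≤s z≤n) le) (cong (_* recip t) (ι-suc j))

recip-cancel : ∀ j k → 1 ≤ℕ j → 1 ≤ℕ k → ι j * recip (k *ℕ j) ≡ recip k
recip-cancel j k 1≤j 1≤k = trans (cong (ι j *_) (recip-* 1≤k 1≤j)) (trans (ring 3 (λ j r s → j :* (r :* s) := j :* s
    :* r) _ _ _) (trans (cong (_* recip k) (recip-inv 1≤j)) (*-identityˡ _)))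

-- log n as the mass of the harmonic series between M and n M.
lg : ℕ → ℕ → ℚ
lg M n = Harm (n *ℕ M) - Harm M

-- Passing from M to M + 1 removes the term 1/(M + 1) at the bottom and adds a terms at the top,
-- whose sum lies between 1/(M + 1) and 1/M.
lg-grow : ∀ {M} a → 1 ≤ℕ M → 1 ≤ℕ a → lg M a ≤ lg (suc M) a × lg (suc M) a - lg M a ≤ recip M - recip (suc M)
lg-grow {M} a 1≤M 1≤a =
    lin 5 (λ s t h h′ r → 1 · r :≤ t :- s ∷ 1 · h′ := h :+ r ∷ [] ⊢ 1 · s :- h :≤ t :- h′) _ _ _ _ _
      (≤-trans (≡⇒≤ (sym (recip-cancel a (suc M) 1≤a (s≤s z≤n)))) (≤-trans (≤-Harm (a *ℕ M) a {suc M *ℕ a}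
          (ℕₚ.≤-reflexive (trans (sym (ℕₚ.*-suc a M)) (ℕₚ.*-comm a (suc M)))))
          (≡⇒≤ (cong (λ n → Harm n - Harm (a *ℕ M)) (sym (ℕₚ.*-suc a M)))))) refl
  , lin 6 (λ s t h h′ r r′ → 1 · t :- s :≤ r ∷ 1 −· h′ := h :+ r′ ∷ [] ⊢ 1 · t :- h′ :- (s :- h) :≤ r :- r′) _ _ _ _ _ _
      (≤-trans (≡⇒≤ (cong (λ n → Harm n - Harm (a *ℕ M)) (ℕₚ.*-suc a M))) (≤-trans (Harm-≤ (a *ℕ M) a (1≤* 1≤a 1≤M))
          (≡⇒≤ (trans (cong (λ n → ι a * recip n) (ℕₚ.*-comm a M)) (recip-cancel a M 1≤a 1≤M))))) refl

lg-mono : ∀ {M N} a → 1 ≤ℕ M → 1 ≤ℕ a → M ≤ℕ N → lg M a ≤ lg N a × lg N a - lg M a ≤ recip M - recip N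
lg-mono {M} {N} a 1≤M 1≤a M≤N with ℕₚ.m≤n⇒m<n∨m≡n M≤N
... | inj₂ refl = ≤-refl , ≡⇒≤ (trans (-‿inverseʳ _) (sym (-‿inverseʳ _)))
lg-mono {M} {suc N} a 1≤M 1≤a M≤N | inj₁ (s≤s M≤N′) with lg-mono a 1≤M 1≤a M≤N′ | lg-grow a (ℕₚ.≤-trans 1≤M M≤N′) 1≤a
... | l , u | l′ , u′ = ≤-trans l l′ , lin 6 (λ a b c p q r → 1 · b :- a :≤ p :- q ∷ 1 · c :- b :≤ q :- r ∷ [] ⊢ 1 · c
    :- a :≤ p :- r) _ _ _ _ _ _ u u′

-- The range (M, a b M] is cut at b M. Its upper piece is the logarithm of a taken at b M instead of
-- M, which is larger by at most 1/M.
lg-* : ∀ {M} a b → 1 ≤ℕ M → 1 ≤ℕ a → 1 ≤ℕ b → lg M a + lg M b ≤ lg M (a *ℕ b) × lg M (a *ℕ b) - (lg M a + lg M b) ≤ recip M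
lg-* {M} a b 1≤M 1≤a 1≤b =
    lin 4 (λ s t u ab → 1 −· ab := s :+ u ∷ 1 · t :≤ s ∷ [] ⊢ 1 · t :+ u :≤ ab) _ _ _ _ split (proj₁ growth)
  , lin 6 (λ s t u ab r r′ → 1 · ab := s :+ u ∷ 1 · s :- t :≤ r :- r′ ∷ 1 · con 0 :≤ r′ ∷ [] ⊢ 1 · ab :- (t :+ u) :≤
      r) _ _ _ _ _ _ split (proj₂ growth) (0≤recip (b *ℕ M))
  where
  growth = lg-mono {M} {b *ℕ M} a 1≤M 1≤a (ℕₚ.m≤n*m M b {{ℕ.>-nonZero 1≤b}})
  split : lg M (a *ℕ b) ≡ lg (b *ℕ M) a + lg M b
  split = trans (cong (λ n → Harm n - Harm M) (ℕₚ.*-assoc a b M)) (ring 3 (λ a b c → a :- c := a :- b :+ (b :- c)) _ _ _)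

0≤lg : ∀ {M} a → 1 ≤ℕ a → ι 0 ≤ lg M a
0≤lg {M} a 1≤a = ≤⇒0≤ (∑-mono-range recip (ℕₚ.m≤n*m M a {{ℕ.>-nonZero 1≤a}}) λ k _ _ → 0≤recip k)

recip-diff : ∀ {k} → 1 ≤ℕ k → recip k - recip (suc k) ≡ recip k * recip (suc k)
recip-diff {k} 1≤k = trans (cong₂ _-_ (trans (sym (*-identityˡ _)) (cong (_* recip k)
    (sym (recip-inv {suc k} (s≤s z≤n))))) (trans (sym (*-identityˡ _)) (cong (_* recip (suc k)) (sym (recip-inv 1≤k)))))
  (trans (cong (λ z → z * recip (suc k) * recip k - ι k * recip k * recip (suc k)) (ι-suc k))
      (ring 3 (λ k r s → (con 1 :+ k) :* s :* r :- k :* r :* s := r :* s) _ _ _))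

recip-double : ∀ {n} → 1 ≤ℕ n → ι 2 * recip (2 *ℕ n) ≡ recip n
recip-double {n} 1≤n = trans (cong (λ k → ι 2 * recip k) (ℕₚ.*-comm 2 n)) (recip-cancel 2 n (s≤s z≤n) 1≤n)

recip-small : ∀ n {M a b} → 1 ≤ℕ M → 1 ≤ℕ a → 1 ≤ℕ b → n *ℕ (a *ℕ b) ≤ℕ M → ι n * recip M ≤ recip a * recip b
recip-small n {M} {a} {b} 1≤M 1≤a 1≤b le = ≤-trans (≡⇒≤ (trans (sym (*-identityˡ _)) (trans (cong (_* (ι n * recip M))
    (sym (trans (cong₂ _*_ (recip-inv 1≤a) (recip-inv 1≤b)) (*-identityˡ _))))
    (ring 6 (λ a b n r s t → a :* r :* (b :* s) :* (n :* t) := n :* (a :* b) :* (r :* s :* t)) _ _ _ _ _ _))))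
  (≤-trans (*-mono-0≤ (*-nonneg (0≤ι n) (*-nonneg (0≤ι a) (0≤ι b)))
      (≤-trans (≡⇒≤ (trans (cong (ι n *_) (sym (ι-* a b))) (sym (ι-* n (a *ℕ b))))) (ι-mono le))
      (*-nonneg (*-nonneg (0≤recip a) (0≤recip b)) (0≤recip M)) ≤-refl)
    (≡⇒≤ (trans (ring 4 (λ m r s t → m :* (r :* s :* t) := m :* t :* (r :* s)) _ _ _ _)
        (trans (cong (_* (recip a * recip b)) (recip-inv 1≤M)) (*-identityˡ _)))))

module Logarithm (X : ℕ) (1≤X : 1 ≤ℕ X) where
  private
    m M : ℕ
    -- For n < X this exceeds n (2n)(2n + 1), so an error n/M is at most 1/(2n) - 1/(2n + 1). The
    -- factor 2 in M is there to halve blocks.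
    m = X *ℕ (2 *ℕ X *ℕ (2 *ℕ X))
    M = 2 *ℕ m
    1≤2X : 1 ≤ℕ 2 *ℕ X
    1≤2X = 1≤* {2} (s≤s z≤n) 1≤X
    1≤m : 1 ≤ℕ m
    1≤m = 1≤* 1≤X (1≤* 1≤2X 1≤2X)
    1≤M : 1 ≤ℕ M
    1≤M = 1≤* {2} (s≤s z≤n) 1≤m

    logs : List ℕ → ℚ
    logs [] = ι 0
    logs (p ∷ ps) = lg M p + logs ps

    logs-↭ : ∀ {ps qs} → ps ↭ qs → logs ps ≡ logs qs
    logs-↭ Perm.refl = refl
    logs-↭ (Perm.prep x p) = cong (lg M x +_) (logs-↭ p)
    logs-↭ (Perm.swap x y p) = trans (ring 3 (λ a b c → a :+ (b :+ c) := b :+ (a :+ c)) _ _ _)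
        (cong (λ s → lg M y + (lg M x + s)) (logs-↭ p))
    logs-↭ (Perm.trans p q) = trans (logs-↭ p) (logs-↭ q)

    logs-++ : ∀ ps qs → logs (ps ++ qs) ≡ logs ps + logs qs
    logs-++ [] qs = sym (+-identityˡ _)
    logs-++ (p ∷ ps) qs = trans (cong (lg M p +_) (logs-++ ps qs)) (sym (+-assoc _ _ _))

  -- `lg M` is only almost additive. Its values at primes, extended along factorisations, give exact
  -- additivity at the price of a small error at each n.
  ℓ : ℕ → ℚ
  ℓ n = logs (fac n)

  ℓ-* : ∀ a b → 1 ≤ℕ a → 1 ≤ℕ b → ℓ (a *ℕ b) ≡ ℓ a + ℓ b
  ℓ-* a b 1≤a 1≤b = trans (logs-↭ (fac-* 1≤a 1≤b)) (logs-++ (fac a) (fac b))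

  0≤ℓ : ∀ n → 1 ≤ℕ n → ι 0 ≤ ℓ n
  0≤ℓ n _ = go (fac n) (fac-prime n)
    where
    go : ∀ ps → All Prime ps → ι 0 ≤ logs ps
    go [] [] = ≤-refl
    go (p ∷ ps) (pr ∷ prs) = ≤-trans (≡⇒≤ (sym (+-identityˡ _))) (+-mono-≤ (0≤lg p (prime≥1 pr)) (go ps prs))

  private
    -- The allowance n/M survives multiplication by a prime: one more factor costs at most 1/M, and
    -- n + 1 ≤ p n.
    Close : ℕ → Set
    Close n = ℓ n ≤ lg M n × lg M n - ℓ n ≤ ι n * recip M

    close : ∀ n → 1 ≤ℕ n → Close n
    close = prime-induction Close base step
      where
      lg1 : lg M 1 ≡ ι 0
      lg1 = trans (cong (λ n → Harm n - Harm M) (ℕₚ.+-identityʳ M)) (-‿inverseʳ _)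
      base : Close 1
      base = ≡⇒≤ (sym lg1) , ≤-trans (≡⇒≤ (trans (cong (_- ι 0) lg1) (-‿inverseʳ _))) (*-nonneg (0≤ι 1) (0≤recip M))
      step : ∀ p n → Prime p → 1 ≤ℕ n → Close n → Close (p *ℕ n)
      step p n pr 1≤n (l , u) with lg-* {M} p n 1≤M (prime≥1 pr) 1≤n
      ... | l′ , u′ =
          lin 5 (λ lp a b c d → 1 · lp := a :+ b ∷ 1 · b :≤ c ∷ 1 · a :+ c :≤ d ∷ [] ⊢ 1 · lp :≤ d) _ _ _ _ _ ℓ-pn l l′
        , lin 8 (λ lp a b c d r n pn → 1 −· lp := a :+ b ∷ 1 · c :- b :≤ n :* r ∷ 1 · d :- (a :+ c) :≤ r ∷ 1 ·
            (con 1 :+ n) :* r :≤ pn :* r ∷ [] ⊢ 1 · d :- lp :≤ pn :* r) _ _ _ _ _ _ _ _ ℓ-pn u u′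
            (*-mono-0≤ (≤-trans (0≤ι (suc n)) (≡⇒≤ (ι-suc n))) (≤-trans (≡⇒≤ (sym (ι-suc n)))
                (ι-mono (ℕₚ.≤-trans (ℕₚ.≤-reflexive (ℕₚ.+-comm 1 n))
                (ℕₚ.≤-trans (ℕₚ.+-monoʳ-≤ n (ℕₚ.≤-trans 1≤n (ℕₚ.m≤m+n n 0))) (ℕₚ.*-monoˡ-≤ n (prime≥2 pr))))))
                (0≤recip M) ≤-refl)
        where
        ℓ-pn : ℓ (p *ℕ n) ≡ lg M p + ℓ n
        ℓ-pn = logs-↭ (fac-prime-* pr 1≤n)

    -- Halving the block (n M, (n+1) M] leaves a slack of order 1/n² that absorbs the error of ℓ.
    lg-step : ∀ n → 1 ≤ℕ n → lg M (suc n) - lg M n ≤ recip (2 *ℕ n) + recip (suc (2 *ℕ n)) ×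
      recip (suc (2 *ℕ n)) + recip (2 *ℕ suc n) ≤ lg M (suc n) - lg M n
    lg-step n 1≤n =
        lin 6 (λ a b c h r s → 1 · b :- a :≤ r ∷ 1 · c :- b :≤ s ∷ [] ⊢ 1 · c :- h :- (a :- h) :≤ r :+ s) _ _ _ _ _ _
          (≤-trans (Harm-≤ (n *ℕ M) m (1≤* 1≤n 1≤M)) (≡⇒≤ (trans (cong (λ k → ι m * recip k) k≡) (recip-cancel m
              (2 *ℕ n) 1≤m 1≤2n))))
          (≤-trans (≡⇒≤ (cong (λ k → Harm k - Harm (m +ℕ n *ℕ M)) top))
            (≤-trans (Harm-≤ (m +ℕ n *ℕ M) m (ℕₚ.≤-trans 1≤m (ℕₚ.m≤m+n m _)))
                (≡⇒≤ (trans (cong (λ k → ι m * recip (m +ℕ k)) k≡) (recip-cancel m (suc (2 *ℕ n)) 1≤m (s≤s z≤n))))))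
      , lin 6 (λ a b c h r s → 1 · r :≤ b :- a ∷ 1 · s :≤ c :- b ∷ [] ⊢ 1 · r :+ s :≤ c :- h :- (a :- h)) _ _ _ _ _ _
          (≤-trans (≡⇒≤ (sym (trans (cong (λ k → ι m * recip (m +ℕ k)) k≡) (recip-cancel m (suc (2 *ℕ n)) 1≤m
              (s≤s z≤n))))) (≤-Harm (n *ℕ M) m ℕₚ.≤-refl))
          (≤-trans (≡⇒≤ (sym (trans (cong (λ k → ι m * recip k) (trans top k≡′)) (recip-cancel m (2 *ℕ suc n) 1≤m
              (s≤s z≤n)))))
            (≤-trans (≤-Harm (m +ℕ n *ℕ M) m {suc n *ℕ M} (ℕₚ.≤-reflexive (sym top)))
                (≡⇒≤ (cong (λ k → Harm k - Harm (m +ℕ n *ℕ M)) (sym top)))))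
      where
      1≤2n : 1 ≤ℕ 2 *ℕ n
      1≤2n = 1≤* {2} (s≤s z≤n) 1≤n
      k≡ : n *ℕ M ≡ 2 *ℕ n *ℕ m
      k≡ = trans (sym (ℕₚ.*-assoc n 2 m)) (cong (_*ℕ m) (ℕₚ.*-comm n 2))
      top : suc n *ℕ M ≡ m +ℕ (m +ℕ n *ℕ M)
      top = trans (cong (λ k → m +ℕ k +ℕ n *ℕ M) (ℕₚ.+-identityʳ m)) (ℕₚ.+-assoc m m _)
      k≡′ : m +ℕ (m +ℕ n *ℕ M) ≡ 2 *ℕ suc n *ℕ m
      k≡′ = trans (sym top) (trans (sym (ℕₚ.*-assoc (suc n) 2 m)) (cong (_*ℕ m) (ℕₚ.*-comm (suc n) 2)))

  -- The halved block gives 1/(2n) + 1/(2n + 1), and the error of ℓ at n is at most 1/(2n) - 1/(2n +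
  -- 1); together they make exactly 1/n.
  ℓ-upper : ∀ n → 1 ≤ℕ n → n <ℕ X → ℓ (suc n) - ℓ n ≤ recip n
  ℓ-upper n 1≤n n<X = lin 8 (λ ls l gs g r r1 r2 e → 1 · ls :≤ gs ∷ 1 · g :- l :≤ e ∷ 1 · gs :- g :≤ r1 :+ r2 ∷ 1 · e
      :≤ r1 :* r2 ∷ 1 −· r1 :- r2 := r1 :* r2 ∷ 1 · con 2 :* r1 := r ∷ [] ⊢ 1 · ls :- l :≤ r) _ _ _ _ _ _ _ _
    (proj₁ (close (suc n) (s≤s z≤n))) (proj₂ (close n 1≤n)) (proj₁ (lg-step n 1≤n))
    (recip-small n 1≤M 1≤2n (s≤s z≤n) (ℕₚ.≤-trans (ℕₚ.*-mono-≤ (ℕₚ.<⇒≤ n<X) (ℕₚ.*-mono-≤ 2n≤ s2n≤)) (ℕₚ.m≤m+n m _)))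
    (recip-diff 1≤2n) (recip-double 1≤n)
    where
    1≤2n : 1 ≤ℕ 2 *ℕ n
    1≤2n = 1≤* {2} (s≤s z≤n) 1≤n
    2n≤ : 2 *ℕ n ≤ℕ 2 *ℕ X
    2n≤ = ℕₚ.*-monoʳ-≤ 2 (ℕₚ.<⇒≤ n<X)
    s2n≤ : suc (2 *ℕ n) ≤ℕ 2 *ℕ X
    s2n≤ = ℕₚ.≤-trans (ℕₚ.≤-trans (ℕₚ.n≤1+n _) (ℕₚ.≤-reflexive (sym (ℕₚ.*-suc 2 n)))) (ℕₚ.*-monoʳ-≤ 2 n<X)

  ℓ-lower : ∀ n → 1 ≤ℕ n → n <ℕ X → recip (suc n) ≤ ℓ (suc n) - ℓ n
  ℓ-lower n 1≤n n<X = lin 8 (λ ls l gs g r r1 r2 e → 1 · gs :- ls :≤ e ∷ 1 · l :≤ g ∷ 1 · r1 :+ r2 :≤ gs :- g ∷ 1 · e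
      :≤ r1 :* r2 ∷ 1 −· r1 :- r2 := r1 :* r2 ∷ 1 −· con 2 :* r2 := r ∷ [] ⊢ 1 · r :≤ ls :- l) _ _ _ _ _ _ _ _
    (proj₂ (close (suc n) (s≤s z≤n))) (proj₁ (close n 1≤n)) (proj₂ (lg-step n 1≤n))
    (recip-small (suc n) 1≤M (s≤s z≤n) (s≤s z≤n) (ℕₚ.≤-trans (ℕₚ.*-mono-≤ n<X (ℕₚ.*-mono-≤ s2n≤ (ℕₚ.*-monoʳ-≤ 2 n<X)))
        (ℕₚ.m≤m+n m _)))
    (trans (cong (λ k → recip (suc (2 *ℕ n)) - recip k) 2sn) (trans (recip-diff {suc (2 *ℕ n)} (s≤s z≤n))
        (cong (λ k → recip (suc (2 *ℕ n)) * recip k) (sym 2sn)))) (recip-double {suc n} (s≤s z≤n))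
    where
    2sn : 2 *ℕ suc n ≡ suc (suc (2 *ℕ n))
    2sn = ℕₚ.*-suc 2 n
    s2n≤ : suc (2 *ℕ n) ≤ℕ 2 *ℕ X
    s2n≤ = ℕₚ.≤-trans (ℕₚ.≤-trans (ℕₚ.n≤1+n _) (ℕₚ.≤-reflexive (sym 2sn))) (ℕₚ.*-monoʳ-≤ 2 n<X)

-- The von Mangoldt function

module Mangoldt (ℓ : ℕ → ℚ) (ℓ-* : ∀ a b → 1 ≤ℕ a → 1 ≤ℕ b → ℓ (a *ℕ b) ≡ ℓ a + ℓ b) (0≤ℓ : ∀ n → 1 ≤ℕ n → ι 0 ≤ ℓ n) where

  ℓ1 : ℓ 1 ≡ ι 0
  ℓ1 = trans (ring 1 (λ a → a := a :+ a :- a) _) (trans (cong (_- ℓ 1) (sym (ℓ-* 1 1 (s≤s z≤n) (s≤s z≤n)))) (-‿inverseʳ _))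

  -- This Möbius form does not mention prime powers. Pairing of divisors yields both its support and
  -- the identity `dsum-Λ`.
  Λ : ℕ → ℚ
  Λ n = ι 0 - dsum n (λ d → μ d * ℓ d)

  Λ-prime-* : ∀ {p n} → Prime p → 1 ≤ℕ n → Λ (p *ℕ n) ≡ ℓ p * pow p n
  Λ-prime-* {p} {n} pr 1≤n = trans (cong (ι 0 -_) (trans (dsum-μ-prime-* ℓ pr 1≤n)
      (trans (dsum-cong n λ d 1≤d _ → trans (cong (λ l → (ι 1 - ind (p ∣? d)) * (μ d * (ℓ d - l)))
          (ℓ-* p d (prime≥1 pr) 1≤d))
        (ring 4 (λ i m l x → (con 1 :- i) :* (m :* (x :- (l :+ x))) := (con 0 :- l) :* (m :* (con 1 :- i))) _ _ _ _))
      (dsum-* n _ _))))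
    (ring 2 (λ l s → con 0 :- (con 0 :- l) :* s := l :* s) _ _)

  Λ1 : Λ 1 ≡ ι 0
  Λ1 = trans (cong (ι 0 -_) (trans (dsum-1 (λ d → μ d * ℓ d)) (trans (cong (μ 1 *_) ℓ1) (trans (*-comm _ _)
      (*-zeroˡ _))))) (-‿inverseʳ _)

  Support : ℕ → Set
  Support n = Λ n ≡ ι 0 ⊎ (∃ λ p → ∃ λ k → Prime p × n ≡ p ℕ.^ suc k × Λ n ≡ ℓ p)

  Λ-cases : ∀ {n} → 1 ≤ℕ n → Support n
  Λ-cases {n} = prime-induction Support (inj₁ Λ1) step n
    where
    step : ∀ p n → Prime p → 1 ≤ℕ n → Support n → Support (p *ℕ n)
    step p n pr 1≤n _ with pow-cases pr 1≤n
    ... | inj₁ z = inj₁ (trans (Λ-prime-* pr 1≤n) (trans (cong (ℓ p *_) z) (trans (*-comm _ _) (*-zeroˡ _))))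
    ... | inj₂ (o , k , e) = inj₂ (p , k , pr , cong (p *ℕ_) e , trans (Λ-prime-* pr 1≤n) (trans (cong (ℓ p *_) o)
        (trans (*-comm _ _) (*-identityˡ _))))

  0≤Λ : ∀ {n} → 1 ≤ℕ n → ι 0 ≤ Λ n
  0≤Λ 1≤n with Λ-cases 1≤n
  ... | inj₁ z = ≡⇒≤ (sym z)
  ... | inj₂ (p , _ , pr , _ , e) = ≤-trans (0≤ℓ p (prime≥1 pr)) (≡⇒≤ (sym e))

  -- When n is replaced by p n, the divisors d with p ∣ d reappear as p d with the same value, those
  -- prime to p are kept, and the only new contribution is Λ p = ℓ p from d = 1.
  dsum-Λ : ∀ {n} → 1 ≤ℕ n → dsum n Λ ≡ ℓ n
  dsum-Λ {n} = prime-induction _ (trans (dsum-1 Λ) (trans Λ1 (sym ℓ1))) step n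
    where
    step : ∀ p n → Prime p → 1 ≤ℕ n → dsum n Λ ≡ ℓ n → dsum (p *ℕ n) Λ ≡ ℓ (p *ℕ n)
    step p n pr 1≤n ih = trans (dsum-prime-* Λ pr 1≤n) (trans (dsum-cong n λ d 1≤d _ → pointwise d 1≤d)
        (trans (dsum-+ n _ _) (trans (cong₂ _+_ ih (trans (dsum-* n (ℓ p) (λ d → ind (d ℕₚ.≟ 1)))
          (trans (cong (ℓ p *_) unit) (trans (*-comm _ _) (*-identityˡ _))))) (trans (+-comm _ _)
              (sym (ℓ-* p n (prime≥1 pr) 1≤n))))))
      where
      unit : dsum n (λ d → ind (d ℕₚ.≟ 1)) ≡ ι 1
      unit = trans (∑-remove-first n _ 1≤n λ k 2≤k _ → trans (cong (ind (k ∣? n) *_) (ind-no (k ℕₚ.≟ 1) λ e → ℕₚ.<⇒≢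
          2≤k (sym e))) (trans (*-comm _ _) (*-zeroˡ _)))
        (trans (*-comm _ _) (trans (*-identityˡ _) (ind-yes (1 ∣? n) (∣ₚ.1∣ n))))
      pointwise : ∀ d → 1 ≤ℕ d → (ι 1 - ind (p ∣? d)) * Λ d + Λ (p *ℕ d) ≡ Λ d + ℓ p * ind (d ℕₚ.≟ 1)
      pointwise d 1≤d = trans (cong ((ι 1 - ind (p ∣? d)) * Λ d +_) (Λ-prime-* pr 1≤d)) (by-cases (p ∣? d))
        where
        by-cases : ∀ (i : Dec (p ∣ d)) → (ι 1 - ind i) * Λ d + ℓ p * pow p d ≡ Λ d + ℓ p * ind (d ℕₚ.≟ 1)
        by-cases (no p∤d) = trans (cong (λ x → (ι 1 - ι 0) * Λ d + ℓ p * x) (pow-coprime pr 1≤d p∤d))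
          (ring 2 (λ a b → (con 1 :- con 0) :* a :+ b := a :+ b) _ _)
        by-cases (yes (divides e d≡e*p)) = trans (ring 2 (λ a b → (con 1 :- con 1) :* a :+ b := b) _ _)
            (trans (trans (cong (λ x → ℓ p * pow p x) d≡) (trans (cong (ℓ p *_) (pow-self pr 1≤e))
                (trans (sym (Λ-prime-* pr 1≤e)) (cong Λ (sym d≡)))))
            (trans (sym (+-identityʳ _)) (cong (Λ d +_) (sym (trans (cong (ℓ p *_) (ind-no (d ℕₚ.≟ 1) d≢1))
                (trans (*-comm _ _) (*-zeroˡ _)))))))
          where
          d≡ : d ≡ p *ℕ e
          d≡ = trans d≡e*p (ℕₚ.*-comm e p)
          1≤e : 1 ≤ℕ e
          1≤e = 1≤*ʳ p (subst (1 ≤ℕ_) d≡ 1≤d)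
          d≢1 : d ≢ 1
          d≢1 d≡1 = Pr.¬prime[1] (subst Prime (∣ₚ.∣1⇒≡1 (divides e (trans (sym d≡1) d≡e*p))) pr)

  Λ≤ℓ : ∀ {n} → 1 ≤ℕ n → Λ n ≤ ℓ n
  Λ≤ℓ {suc n} 1≤n = ≤-trans (≤-trans (≡⇒≤ (sym (trans (cong (_* Λ (suc n)) (ind-yes (suc n ∣? suc n) ∣ₚ.∣-refl))
      (*-identityˡ _))))
      (lin 2 (λ a b → 1 · con 0 :≤ a ∷ [] ⊢ 1 · b :≤ a :+ b) _ _ (∑-nonneg n λ k 1≤k _ → *-nonneg (0≤ind (k ∣? suc n))
          (0≤Λ 1≤k))))
    (≡⇒≤ (dsum-Λ 1≤n))

  ψ : ℕ → ℚ
  ψ n = ∑ n Λ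

  ψ-mono : ∀ {m n} → m ≤ℕ n → ψ m ≤ ψ n
  ψ-mono m≤n = ∑-mono-range Λ m≤n λ k m<k _ → 0≤Λ (ℕₚ.≤-trans (s≤s z≤n) m<k)

  0≤ψ : ∀ n → ι 0 ≤ ψ n
  0≤ψ n = ∑-nonneg n λ k 1≤k _ → 0≤Λ 1≤k

  logFactorial : ℕ → ℚ
  logFactorial x = ∑ x ℓ

  logFactorial-Λ : ∀ x → logFactorial x ≡ ∑ x (λ d → Λ d * ι (x ÷ d))
  logFactorial-Λ x = trans (∑-cong x λ n 1≤n _ → sym (dsum-Λ 1≤n)) (trans (∑-dsum x (λ k _ → Λ k))
    (∑-cong x λ k _ _ → trans (∑-const (x ÷ k) (Λ k)) (*-comm _ _)))

  ∑-ψ : ∀ y → ∑ y (λ m → ψ (y ÷ m)) ≡ logFactorial y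
  ∑-ψ y = trans (∑-hyperbola y (λ _ j → Λ j)) (trans (∑-cong y λ j _ _ → trans (∑-const (y ÷ j) (Λ j)) (*-comm _ _))
    (sym (logFactorial-Λ y)))

  -- Tatuzawa and Iseki's inversion formula.
  weighted-inversion : ∀ x (F : ℕ → ℚ) → 1 ≤ℕ x →
    ∑ x (λ k → μ k * (ℓ x - ℓ k) * ∑ (x ÷ k) (λ m → F (k *ℕ m))) ≡ ℓ x * F 1 + ∑ x (λ j → Λ j * F j)
  weighted-inversion x F 1≤x =
    trans (∑-cong x λ k _ _ → sym (∑-* (x ÷ k) _ _)) (trans (sym (∑-dsum x (λ k j → μ k * (ℓ x - ℓ k) * F j)))
    (trans (∑-cong x λ j 1≤j _ → inner j 1≤j) (trans (∑-+ x _ _) (cong (_+ ∑ x (λ j → Λ j * F j))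
      (trans (∑-remove-first x _ 1≤x λ k 2≤k _ → trans (cong (λ i → ℓ x * i * F k) (ind-no (k ℕₚ.≟ 1) λ e → ℕₚ.<⇒≢ 2≤k
          (sym e)))
          (ring 2 (λ a b → a :* con 0 :* b := con 0) _ _))
        (ring 2 (λ a b → a :* con 1 :* b := a :* b) _ _))))))
    where
    inner : ∀ j → 1 ≤ℕ j → dsum j (λ k → μ k * (ℓ x - ℓ k) * F j) ≡ ℓ x * ind (j ℕₚ.≟ 1) * F j + Λ j * F j
    inner j 1≤j = trans (dsum-cong j λ k _ _ → ring 4 (λ m a b f → m :* (a :- b) :* f := f :* (a :* m :- m :* b)) _ _ _ _)
      (trans (dsum-* j _ _) (trans (cong (F j *_) (trans (dsum-- j _ _) (cong (_- dsum j (λ k → μ k * ℓ k))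
          (trans (dsum-* j _ _) (cong (ℓ x *_) (dsum-μ 1≤j))))))
      (ring 4 (λ f a i s → f :* (a :* i :- s) := a :* i :* f :+ (con 0 :- s) :* f) _ _ _ _)))

-- Estimates of Chebyshev, Mertens and Selberg

module Estimates (X : ℕ) (ℓ : ℕ → ℚ) (ℓ-* : ∀ a b → 1 ≤ℕ a → 1 ≤ℕ b → ℓ (a *ℕ b) ≡ ℓ a + ℓ b) (0≤ℓ : ∀ n → 1 ≤ℕ n → ι
    0 ≤ ℓ n)
  (ℓ-lower : ∀ n → 1 ≤ℕ n → n <ℕ X → recip (suc n) ≤ ℓ (suc n) - ℓ n) (ℓ-upper : ∀ n → 1 ≤ℕ n → n <ℕ X → ℓ (suc n) - ℓ
      n ≤ recip n) where

  open Mangoldt ℓ ℓ-* 0≤ℓ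

  private
    δ : ℕ → ℚ
    δ n = ℓ (suc n) - ℓ n

  ℓ-diff : ∀ {m n} → 1 ≤ℕ m → m ≤ℕ n → n ≤ℕ X → ℓ n - ℓ m ≤ (ι n - ι m) * recip m
  ℓ-diff {m} {n} 1≤m m≤n n≤X with ℕₚ.m≤n⇒m<n∨m≡n m≤n
  ... | inj₂ refl = ≡⇒≤ (ring 3 (λ a b r → a :- a := (b :- b) :* r) _ _ _)
  ℓ-diff {m} {suc n} 1≤m m≤n n<X | inj₁ (s≤s m≤n′) =
    lin 7 (λ a b c n′ n m r → 1 · b :- a :≤ (n :- m) :* r ∷ 1 · c :- b :≤ r ∷ 1 −· n′ :* r := (con 1 :+ n) :* r ∷ [] ⊢
        1 · c :- a :≤ (n′ :- m) :* r)
      _ _ _ _ _ _ _ (ℓ-diff 1≤m m≤n′ (ℕₚ.<⇒≤ n<X))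
      (≤-trans (ℓ-upper n (ℕₚ.≤-trans 1≤m m≤n′) n<X) (recip-anti 1≤m m≤n′)) (cong (_* recip m) (ι-suc n))

  ℓ-mono : ∀ {m n} → 1 ≤ℕ m → m ≤ℕ n → n ≤ℕ X → ℓ m ≤ ℓ n
  ℓ-mono {m} {n} 1≤m m≤n n≤X with ℕₚ.m≤n⇒m<n∨m≡n m≤n
  ... | inj₂ refl = ≤-refl
  ℓ-mono {m} {suc n} 1≤m m≤n n<X | inj₁ (s≤s m≤n′) =
    lin 4 (λ a b c r → 1 · a :≤ b ∷ 1 · r :≤ c :- b ∷ 1 · con 0 :≤ r ∷ [] ⊢ 1 · a :≤ c) _ _ _ _
      (ℓ-mono 1≤m m≤n′ (ℕₚ.<⇒≤ n<X)) (ℓ-lower n (ℕₚ.≤-trans 1≤m m≤n′) n<X) (0≤recip (suc n))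

  recip1 : recip 1 ≡ ι 1
  recip1 = trans (sym (*-identityˡ _)) (recip-inverse 0)

  ℓ≤pred : ∀ {n} → 1 ≤ℕ n → n ≤ℕ X → ℓ n ≤ ι n - ι 1
  ℓ≤pred {n} 1≤n n≤X = lin 4 (λ l l1 n r → 1 · l :- l1 :≤ (n :- con 1) :* r ∷ 1 · l1 := con 0 ∷ 1 · (n :- con 1) :* r
      := (n :- con 1) :* con 1 ∷ [] ⊢ 1 · l :≤ n :- con 1)
    _ _ _ _ (ℓ-diff (s≤s z≤n) 1≤n n≤X) ℓ1 (cong ((ι n - ι 1) *_) recip1)

  ℓ≤ : ∀ {n} → 1 ≤ℕ n → n ≤ℕ X → ℓ n ≤ ι n
  ℓ≤ 1≤n n≤X = lin 2 (λ l n → 1 · l :≤ n :- con 1 ∷ [] ⊢ 1 · l :≤ n) _ _ (ℓ≤pred 1≤n n≤X)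

  ℓ2≤1 : 2 ≤ℕ X → ℓ 2 ≤ ι 1
  ℓ2≤1 2≤X = ≤-trans (ℓ≤pred (s≤s z≤n) 2≤X) (lin 0 ([] ⊢ 1 · con 2 :- con 1 :≤ con 1))

  1≤2ℓ2 : 2 ≤ℕ X → ι 1 ≤ ι 2 * ℓ 2
  1≤2ℓ2 2≤X = lin 3 (λ r l l1 → 2 · r :≤ l :- l1 ∷ 1 · con 1 := con 2 :* r ∷ 2 · con 0 := l1 ∷ [] ⊢ 1 · con 1 :≤ con 2 :* l)
    _ _ _ (ℓ-lower 1 (s≤s z≤n) 2≤X) (sym (recip-inverse 1)) (sym ℓ1)

  H : ℕ → ℚ
  H n = ∑ n recip

  -- Moments of log (x/k). The first is the defect x ℓ x - log x!, so bounding it is Stirling's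
  -- formula; the second controls the error in Selberg's formula. Recurrences in x take the place of
  -- the integrals of log and log².
  A₁ A₂ : ℕ → ℚ
  A₁ x = ∑ x λ k → ℓ x - ℓ k
  A₂ x = ∑ x λ k → (ℓ x - ℓ k) * (ℓ x - ℓ k)

  A₁-suc : ∀ x → A₁ (suc x) ≡ A₁ x + ι x * δ x
  A₁-suc x = trans (cong₂ _+_ (trans (∑-cong x λ k _ _ → ring 3 (λ a b c → a :- b := (c :- b) :+ (a :- c)) _ _ (ℓ x))
      (trans (∑-+ x _ _) (cong (A₁ x +_) (∑-const x (δ x))))) (-‿inverseʳ _)) (+-identityʳ _)

  A₂-suc : ∀ x → A₂ (suc x) ≡ A₂ x + ι 2 * δ x * A₁ x + ι x * (δ x * δ x)
  A₂-suc x = trans (cong₂ _+_ (trans (∑-cong x λ k _ _ → ring 3 (λ a b c → (a :- b) :* (a :- b) := (c :- b) :*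
      (c :- b) :+ con 2 :* (a :- c) :* (c :- b) :+ (a :- c) :* (a :- c)) _ _ (ℓ x))
      (trans (∑-+ x _ _) (cong₂ _+_ (trans (∑-+ x _ _) (cong (A₂ x +_) (∑-* x _ _))) (∑-const x _))))
          (ring 1 (λ a → (a :- a) :* (a :- a) := con 0) _)) (+-identityʳ _)

  0≤A₁ : ∀ {x} → x ≤ℕ X → ι 0 ≤ A₁ x
  0≤A₁ {x} x≤X = ∑-nonneg x λ k 1≤k k≤x → ≤⇒0≤ (ℓ-mono 1≤k k≤x x≤X)

  A₁≤ : ∀ {x} → 1 ≤ℕ x → x ≤ℕ X → A₁ x ≤ ι x
  A₁≤ {suc zero} _ _ = lin 1 (λ a → [] ⊢ 1 · con 0 :+ (a :- a) :≤ con 1) _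
  A₁≤ {suc x@(suc _)} _ x<X = ≤-trans (≡⇒≤ (A₁-suc x))
    (lin 5 (λ a x d r s → 1 · a :≤ x ∷ 1 · x :* d :≤ x :* r ∷ 1 · x :* r := con 1 ∷ 1 · con 1 :+ x := s ∷ [] ⊢ 1 · a
        :+ x :* d :≤ s) _ _ _ _ _
      (A₁≤ (s≤s z≤n) (ℕₚ.<⇒≤ x<X)) (*-monoʳ-0≤ (0≤ι x) (ℓ-upper x (s≤s z≤n) x<X)) (recip-inv {x} (s≤s z≤n)) (sym (ι-suc x)))

  ≤A₁ : ∀ {x} → 1 ≤ℕ x → x ≤ℕ X → ι x - H x ≤ A₁ x
  ≤A₁ {suc zero} _ _ = lin 2 (λ a r → 1 · con 1 := r ∷ [] ⊢ 1 · con 1 :- (con 0 :+ r) :≤ con 0 :+ (a :- a)) _ _ (sym recip1)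
  ≤A₁ {suc x@(suc _)} _ x<X = ≤-trans
    (lin 6 (λ a x d r s h → 1 · x :- h :≤ a ∷ 1 · x :* r :≤ x :* d ∷ 1 · con 1 := s :* r ∷ 1 · s := con 1 :+ x ∷ 1 · s
        :* r := (con 1 :+ x) :* r ∷ [] ⊢ 1 · s :- (h :+ r) :≤ a :+ x :* d) _ _ _ _ _ _
      (≤A₁ (s≤s z≤n) (ℕₚ.<⇒≤ x<X)) (*-monoʳ-0≤ (0≤ι x) (ℓ-lower x (s≤s z≤n) x<X)) (sym (recip-inverse x)) (ι-suc x)
          (cong (_* recip (suc x)) (ι-suc x)))
    (≡⇒≤ (sym (A₁-suc x)))

  -- Since δ ≤ 1/x and A₁ ≤ x, the increment 2 δ A₁ + x δ² is at most 2 + 1/x ≤ 3.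
  A₂≤ : ∀ {x} → 1 ≤ℕ x → x ≤ℕ X → A₂ x ≤ ι 3 * ι x
  A₂≤ {suc zero} _ _ = lin 1 (λ a → [] ⊢ 1 · con 0 :+ (a :- a) :* (a :- a) :≤ con 3 :* con 1) _
  A₂≤ {suc x@(suc x-1)} _ x<X = ≤-trans (≡⇒≤ (A₂-suc x))
    (lin 6 (λ a₂ a₁ d x r s → 1 · a₂ :≤ con 3 :* x ∷ 2 · d :* a₁ :≤ r :* x ∷ 1 · x :* (d :* d) :≤ x :* (r :* r) ∷ 2 ·
        x :* r := con 1 ∷ 1 · x :* (r :* r) :≤ con 1 ∷ 3 · con 1 :+ x := s ∷ [] ⊢ 1 · a₂ :+ con 2 :* d :* a₁ :+ x :*
        (d :* d) :≤ con 3 :* s) _ _ _ _ _ _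
      (A₂≤ (s≤s z≤n) (ℕₚ.<⇒≤ x<X)) (*-mono-0≤ 0≤δ δ≤ (0≤A₁ (ℕₚ.<⇒≤ x<X)) (A₁≤ (s≤s z≤n) (ℕₚ.<⇒≤ x<X)))
      (*-monoʳ-0≤ (0≤ι x) (*-mono-0≤ 0≤δ δ≤ 0≤δ δ≤)) (recip-inverse x-1)
      (≤-trans (≡⇒≤ (trans (sym (*-assoc _ _ _)) (trans (cong (_* recip x) (recip-inverse x-1)) (*-identityˡ _))))
          (≤-trans (recip-anti (s≤s z≤n) (s≤s z≤n)) (≡⇒≤ recip1)))
      (sym (ι-suc x)))
    where
    0≤δ : ι 0 ≤ δ x
    0≤δ = ≤-trans (0≤recip (suc x)) (ℓ-lower x (s≤s z≤n) x<X)
    δ≤ : δ x ≤ recip x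
    δ≤ = ℓ-upper x (s≤s z≤n) x<X

  logFactorial-A₁ : ∀ x → logFactorial x ≡ ι x * ℓ x - A₁ x
  logFactorial-A₁ x = trans (ring 2 (λ t c → t := c :- (c :- t)) _ (ι x * ℓ x)) (cong (ι x * ℓ x -_)
      (sym (trans (∑-- x _ _) (cong (_- logFactorial x) (∑-const x (ℓ x))))))

  logFactorial≤ : ∀ {x} → 1 ≤ℕ x → x ≤ℕ X → logFactorial x ≤ ι x * ℓ x - ι x + H x
  logFactorial≤ {x} 1≤x x≤X = ≤-trans (≡⇒≤ (logFactorial-A₁ x)) (lin 4 (λ m a x h → 1 · x :- h :≤ a ∷ [] ⊢ 1 · m :- a
      :≤ m :- x :+ h) _ _ _ _ (≤A₁ 1≤x x≤X))

  ≤logFactorial : ∀ {x} → 1 ≤ℕ x → x ≤ℕ X → ι x * ℓ x - ι x ≤ logFactorial x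
  ≤logFactorial {x} 1≤x x≤X = ≤-trans (lin 3 (λ m a x → 1 · a :≤ x ∷ [] ⊢ 1 · m :- x :≤ m :- a) _ _ _ (A₁≤ 1≤x x≤X))
      (≡⇒≤ (sym (logFactorial-A₁ x)))

  -- H n - ℓ n decreases and H n - ℓ n - 1/n increases, so γ below is squeezed without any series.
  H-ℓ-anti : ∀ {m n} → 1 ≤ℕ m → m ≤ℕ n → n ≤ℕ X → H n - ℓ n ≤ H m - ℓ m
  H-ℓ-anti {m} {n} 1≤m m≤n n≤X with ℕₚ.m≤n⇒m<n∨m≡n m≤n
  ... | inj₂ refl = ≤-refl
  H-ℓ-anti {m} {suc n} 1≤m m≤n n<X | inj₁ (s≤s m≤n′) =
    lin 6 (λ h l h′ l′ r l″ → 1 · h′ :- l′ :≤ h :- l ∷ 1 · r :≤ l″ :- l′ ∷ [] ⊢ 1 · h′ :+ r :- l″ :≤ h :- l) _ _ _ _ _ _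
      (H-ℓ-anti 1≤m m≤n′ (ℕₚ.<⇒≤ n<X)) (ℓ-lower n (ℕₚ.≤-trans 1≤m m≤n′) n<X)

  H-ℓ-recip-mono : ∀ {m n} → 1 ≤ℕ m → m ≤ℕ n → n ≤ℕ X → H m - ℓ m - recip m ≤ H n - ℓ n - recip n
  H-ℓ-recip-mono {m} {n} 1≤m m≤n n≤X with ℕₚ.m≤n⇒m<n∨m≡n m≤n
  ... | inj₂ refl = ≤-refl
  H-ℓ-recip-mono {m} {suc n} 1≤m m≤n n<X | inj₁ (s≤s m≤n′) =
    lin 6 (λ c h′ l′ r′ r l″ → 1 · c :≤ h′ :- l′ :- r′ ∷ 1 · l″ :- l′ :≤ r′ ∷ [] ⊢ 1 · c :≤ h′ :+ r :- l″ :- r) _ _ _ _ _ _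
      (H-ℓ-recip-mono 1≤m m≤n′ (ℕₚ.<⇒≤ n<X)) (ℓ-upper n (ℕₚ.≤-trans 1≤m m≤n′) n<X)

  γ : ℚ
  γ = H X - ℓ X

  γ≤ : ∀ {n} → 1 ≤ℕ n → n ≤ℕ X → γ ≤ H n - ℓ n
  γ≤ 1≤n n≤X = H-ℓ-anti 1≤n n≤X ℕₚ.≤-refl

  ≤γ : ∀ {n} → 1 ≤ℕ n → n ≤ℕ X → H n - ℓ n - recip n ≤ γ
  ≤γ {n} 1≤n n≤X = lin 3 (λ c g r → 1 · c :≤ g :- r ∷ 1 · con 0 :≤ r ∷ [] ⊢ 1 · c :≤ g) _ _ _ (H-ℓ-recip-mono 1≤n n≤X
      ℕₚ.≤-refl) (0≤recip X)

  H1-ℓ1 : H 1 - ℓ 1 ≡ ι 1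
  H1-ℓ1 = trans (cong₂ (λ r l → ι 0 + r - l) recip1 ℓ1) (ring 0 (con 0 :+ con 1 :- con 0 := con 1))

  0≤γ : 1 ≤ℕ X → ι 0 ≤ γ
  0≤γ 1≤X = ≤-trans (lin 3 (λ h l r → 1 · con 1 := h :- l ∷ 1 · r := con 1 ∷ [] ⊢ 1 · con 0 :≤ h :- l :- r) _ _ _
      (sym H1-ℓ1) recip1) (≤γ (s≤s z≤n) 1≤X)

  γ≤1 : 1 ≤ℕ X → γ ≤ ι 1
  γ≤1 1≤X = ≤-trans (γ≤ (s≤s z≤n) 1≤X) (≡⇒≤ H1-ℓ1)

  H≤ℓ+1 : ∀ {n} → 1 ≤ℕ n → n ≤ℕ X → H n ≤ ℓ n + ι 1
  H≤ℓ+1 1≤n n≤X = lin 4 (λ h l h1 l1 → 1 · h :- l :≤ h1 :- l1 ∷ 1 · h1 :- l1 := con 1 ∷ [] ⊢ 1 · h :≤ l :+ con 1) _ _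
      _ _ (H-ℓ-anti (s≤s z≤n) 1≤n n≤X) H1-ℓ1

  -- Chebyshev's argument with the central binomial coefficient: the weights ⌊2y/d⌋ - 2⌊y/d⌋ are
  -- nonnegative and at least 1 on (y, 2y], and their sum against Λ is log (2y)! - 2 log y!.
  ψ-double : ∀ {y} → 1 ≤ℕ y → 2 *ℕ y ≤ℕ X → ψ (2 *ℕ y) - ψ y ≤ ι 4 * ι y
  ψ-double {y} 1≤y 2y≤X = ≤-trans range (≤-trans (≡⇒≤ total) bound)
    where
    y≤2y : y ≤ℕ 2 *ℕ y
    y≤2y = ℕₚ.m≤m+n y (y +ℕ 0)
    1≤2y : 1 ≤ℕ 2 *ℕ y
    1≤2y = ℕₚ.≤-trans 1≤y y≤2y
    y≤X : y ≤ℕ X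
    y≤X = ℕₚ.≤-trans y≤2y 2y≤X
    c f : ℕ → ℚ
    c d = ι (2 *ℕ y ÷ d) - ι 2 * ι (y ÷ d)
    f d = Λ d * c d
    0≤c : ∀ d → 1 ≤ℕ d → ι 0 ≤ c d
    0≤c d 1≤d = ≤⇒0≤ (≤-trans (≡⇒≤ (sym (ι-* 2 (y ÷ d)))) (ι-mono (*≤⇒≤÷ 1≤d
      (subst (_≤ℕ 2 *ℕ y) (sym (ℕₚ.*-assoc 2 (y ÷ d) d)) (ℕₚ.*-monoʳ-≤ 2 (÷*≤ y d))))))
    Λ≤f : ∀ d → y <ℕ d → d ≤ℕ 2 *ℕ y → Λ d ≤ f d
    Λ≤f d y<d d≤2y = ≤-trans (≡⇒≤ (trans (sym (*-identityˡ _)) (*-comm _ _))) (*-monoʳ-0≤ (0≤Λ 1≤d)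
      (lin 2 (λ a b → 1 · con 1 :≤ a ∷ 2 · b := con 0 ∷ [] ⊢ 1 · con 1 :≤ a :- con 2 :* b) _ _ (ι-mono (1≤÷ 1≤d d≤2y))
          (cong ι (÷>⇒0 y<d))))
      where
      1≤d : 1 ≤ℕ d
      1≤d = ℕₚ.≤-trans (s≤s z≤n) y<d
    range : ψ (2 *ℕ y) - ψ y ≤ ∑ (2 *ℕ y) f
    range = lin 3 (λ d a b → 1 · d :≤ a :- b ∷ 1 · con 0 :≤ b ∷ [] ⊢ 1 · d :≤ a) _ _ _ (∑-range-≤ Λ f y≤2y Λ≤f)
      (∑-nonneg y λ d 1≤d _ → *-nonneg (0≤Λ 1≤d) (0≤c d 1≤d))
    total : ∑ (2 *ℕ y) f ≡ logFactorial (2 *ℕ y) - ι 2 * logFactorial y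
    total = trans (∑-cong (2 *ℕ y) λ d _ _ → ring 3 (λ l a b → l :* (a :- con 2 :* b) := l :* a :- con 2 :* (l :* b)) _ _ _)
      (trans (∑-- (2 *ℕ y) _ _) (cong₂ _-_ (sym (logFactorial-Λ (2 *ℕ y))) (trans (∑-* (2 *ℕ y) (ι 2) _) (cong (ι 2 *_)
        (trans (∑-extend _ y≤2y λ d y<d _ → trans (cong (λ q → Λ d * ι q) (÷>⇒0 y<d)) (trans (*-comm _ _)
            (*-zeroˡ _))) (sym (logFactorial-Λ y)))))))
    bound : logFactorial (2 *ℕ y) - ι 2 * logFactorial y ≤ ι 4 * ι y
    bound = lin 8 (λ T t Y y L l l2 h → 1 · T :≤ Y :* L :- Y :+ h ∷ 2 · y :* l :- y :≤ t ∷ 1 · h :≤ L :+ con 1 ∷ 1 · L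
        :≤ Y :- con 1 ∷ 1 · Y :* L := con 2 :* y :* (l2 :+ l) ∷ 2 · y :* l2 :≤ y :* con 1 ∷ [] ⊢ 1 · T :- con 2 :* t
        :≤ con 4 :* y) _ _ _ _ _ _ _ _
      (logFactorial≤ 1≤2y 2y≤X) (≤logFactorial 1≤y y≤X) (H≤ℓ+1 1≤2y 2y≤X) (ℓ≤pred 1≤2y 2y≤X)
      (cong₂ _*_ (ι-* 2 y) (ℓ-* 2 y (s≤s z≤n) 1≤y)) (*-monoʳ-0≤ (0≤ι y) (ℓ2≤1 (ℕₚ.≤-trans (ℕₚ.*-monoʳ-≤ 2 1≤y) 2y≤X)))

  halve : ∀ x → ∃ λ y → x ≡ 2 *ℕ y ⊎ x ≡ suc (2 *ℕ y)
  halve zero = 0 , inj₁ refl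
  halve (suc x) with halve x
  ... | y , inj₁ e = y , inj₂ (cong suc e)
  ... | y , inj₂ e = suc y , inj₁ (cong suc (trans e (sym (ℕₚ.+-suc y (y +ℕ 0)))))

  -- Halving gives ψ (2y) ≤ 6y + 4y; the remaining 2y leaves room for the last term Λ (2y + 1) when
  -- x is odd.
  ψ≤ : ∀ x → x ≤ℕ X → ψ x ≤ ι 6 * ι x
  ψ≤ = <-rec _ go
    where
    even : ∀ y → 2 *ℕ y ≤ℕ X → ψ y ≤ ι 6 * ι y → ψ (2 *ℕ y) ≤ ι 10 * ι y
    even zero _ _ = lin 0 ([] ⊢ 1 · con 0 :≤ con 10 :* con 0)
    even y@(suc _) le ih = lin 3 (λ a b y → 1 · b :≤ con 6 :* y ∷ 1 · a :- b :≤ con 4 :* y ∷ [] ⊢ 1 · a :≤ con 10 :*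
        y) _ _ _ ih (ψ-double (s≤s z≤n) le)
    go : ∀ x → (∀ {y} → y <ℕ x → y ≤ℕ X → ψ y ≤ ι 6 * ι y) → x ≤ℕ X → ψ x ≤ ι 6 * ι x
    go zero ih _ = lin 0 ([] ⊢ 1 · con 0 :≤ con 6 :* con 0)
    go (suc x) ih x<X with halve (suc x)
    ... | zero , inj₁ ()
    ... | zero , inj₂ refl = lin 2 (λ a l → 1 · a :≤ l ∷ 1 · l := con 0 ∷ [] ⊢ 1 · con 0 :+ a :≤ con 6 :* con 1) _ _
        (Λ≤ℓ (s≤s z≤n)) ℓ1
    ... | y@(suc _) , inj₁ refl = lin 3 (λ a y z → 1 · a :≤ con 10 :* y ∷ 6 −· z := con 2 :* y ∷ 2 · con 0 :≤ y ∷ [] ⊢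
        1 · a :≤ con 6 :* z) _ _ _
        (even y x<X (ih (ℕₚ.m<m+n y (s≤s z≤n)) (ℕₚ.≤-trans (ℕₚ.m≤m+n y _) x<X))) (ι-* 2 y) (0≤ι y)
    ... | y@(suc _) , inj₂ refl = lin 6 (λ a l L s y z → 1 · a :≤ con 10 :* y ∷ 1 · l :≤ L ∷ 1 · L :≤ s :- con 1 ∷ 5
        −· s := con 1 :+ z ∷ 5 −· z := con 2 :* y ∷ [] ⊢ 1 · a :+ l :≤ con 6 :* s) _ _ _ _ _ _
        (even y (ℕₚ.<⇒≤ x<X) (ih (s≤s (ℕₚ.m≤m+n y _)) (ℕₚ.≤-trans (ℕₚ.m≤m+n y _) (ℕₚ.<⇒≤ x<X)))) (Λ≤ℓ (s≤s z≤n))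
            (ℓ≤pred (s≤s z≤n) x<X) (ι-suc (2 *ℕ y)) (ι-* 2 y)

  M : ℕ → ℚ
  M x = ∑ x λ m → Λ m * recip m

  M-mono : ∀ {m n} → m ≤ℕ n → M m ≤ M n
  M-mono m≤n = ∑-mono-range _ m≤n λ k m<k _ → *-nonneg (0≤Λ (ℕₚ.≤-trans (s≤s z≤n) m<k)) (0≤recip k)

  private
    scaled : ∀ x → ι x * M x ≡ ∑ x (λ m → Λ m * (ι x * recip m))
    scaled x = trans (sym (∑-* x _ _)) (∑-cong x λ m _ _ → ring 3 (λ x l r → x :* (l :* r) := l :* (x :* r)) _ _ _)

  -- Replacing each ⌊x/m⌋ in log x! = Σ Λ(m) ⌊x/m⌋ by x/m costs at most ψ x in total, and Chebyshev
  -- bounds this by 6 x.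
  x*M≤ : ∀ {x} → 1 ≤ℕ x → x ≤ℕ X → ι x * M x ≤ ι x * ℓ x + ι 6 * ι x
  x*M≤ {x} 1≤x x≤X = lin 6 (λ m t p s a n → 1 · m :≤ t :+ p ∷ 1 · p :≤ con 6 :* n ∷ 1 · t := s :- a ∷ 1 · con 0 :≤ a ∷
      [] ⊢ 1 · m :≤ s :+ con 6 :* n) _ _ _ _ _ _
    (≤-trans (≡⇒≤ (scaled x)) (≤-trans (∑-mono x λ m 1≤m _ → ≤-trans (*-monoʳ-0≤ (0≤Λ 1≤m) (≤ι÷+1 x 1≤m))
        (≡⇒≤ (ring 2 (λ l a → l :* (a :+ con 1) := l :* a :+ l) _ _)))
      (≡⇒≤ (trans (∑-+ x _ _) (cong (_+ ψ x) (sym (logFactorial-Λ x)))))))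
    (ψ≤ x x≤X) (logFactorial-A₁ x) (0≤A₁ x≤X)

  ≤x*M : ∀ {x} → 1 ≤ℕ x → x ≤ℕ X → ι x * ℓ x - ι x ≤ ι x * M x
  ≤x*M {x} 1≤x x≤X = ≤-trans (≤logFactorial 1≤x x≤X) (≤-trans (≡⇒≤ (logFactorial-Λ x))
    (≤-trans (∑-mono x λ m 1≤m _ → *-monoʳ-0≤ (0≤Λ 1≤m) (ι÷≤ x 1≤m)) (≡⇒≤ (sym (scaled x)))))

  M≤ : ∀ {x} → 1 ≤ℕ x → x ≤ℕ X → M x ≤ ℓ x + ι 6
  M≤ {x} 1≤x x≤X = *-cancel-≤ (ι-mono 1≤x) (≤-trans (x*M≤ 1≤x x≤X) (≡⇒≤ (ring 2 (λ x l → x :* l :+ con 6 :* x := x :*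
      (l :+ con 6)) _ _)))

  ≤M : ∀ {x} → 1 ≤ℕ x → x ≤ℕ X → ℓ x - ι 1 ≤ M x
  ≤M {x} 1≤x x≤X = *-cancel-≤ (ι-mono 1≤x) (≤-trans (≡⇒≤ (ring 2 (λ x l → x :* (l :- con 1) := x :* l :- x) _ _))
      (≤x*M 1≤x x≤X))

  μ-bound : ∀ n {G B} → ι 0 - B ≤ G → G ≤ B → ι 0 - B ≤ μ n * G × μ n * G ≤ B
  μ-bound n {G} {B} l u with sgn-bounded (fac n)
  ... | -1≤μ , μ≤1 =
      lin 3 (λ m g b → 1 · con 0 :≤ (con 1 :- m) :* (b :- g) ∷ 1 · con 0 :≤ (m :- (con 0 :- con 1)) :*
          (g :- (con 0 :- b)) ∷ [] ⊢ 2 · con 0 :- b :≤ m :* g) _ _ _ (*-nonneg (≤⇒0≤ μ≤1) (≤⇒0≤ u))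
          (*-nonneg (≤⇒0≤ -1≤μ) (≤⇒0≤ l))
    , lin 3 (λ m g b → 1 · con 0 :≤ (con 1 :- m) :* (g :- (con 0 :- b)) ∷ 1 · con 0 :≤ (m :- (con 0 :- con 1)) :*
        (b :- g) ∷ [] ⊢ 2 · m :* g :≤ b) _ _ _ (*-nonneg (≤⇒0≤ μ≤1) (≤⇒0≤ l)) (*-nonneg (≤⇒0≤ -1≤μ) (≤⇒0≤ u))

  module _ {x : ℕ} (1≤x : 1 ≤ℕ x) (x≤X : x ≤ℕ X) where
    private
      -- The constant 1 + γ makes the sums of F over multiples of k logarithmically small.
      F : ℕ → ℚ
      F j = ψ (x ÷ j) - ι x * recip j + (ι 1 + γ)

      1≤X : 1 ≤ℕ X
      1≤X = ℕₚ.≤-trans 1≤x x≤X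

      -- With y = ⌊x/k⌋ the sum is log y! - (x/k) H(y) + y (1 + γ). Stirling's formula and H(y) ≈
      -- ℓ(y) + γ cancel the terms of order y; Stirling's error and the rounding of x/k, weighted by
      -- H(y), leave only a logarithm.
      G-bound : ∀ k → 1 ≤ℕ k → k ≤ℕ x → let G = ∑ (x ÷ k) (λ m → F (k *ℕ m)) in
        ι 0 - (ℓ x - ℓ k + ι 2) ≤ G × G ≤ ℓ x - ℓ k + ι 2
      G-bound k 1≤k k≤x = lower , upper
        where
        y = x ÷ k
        1≤y : 1 ≤ℕ y
        1≤y = 1≤÷ 1≤k k≤x
        y≤X : y ≤ℕ X
        y≤X = ℕₚ.≤-trans (÷≤ x k) x≤X
        G≡ : ∑ y (λ m → F (k *ℕ m)) ≡ logFactorial y - (ι x * recip k) * H y + ι y * (ι 1 + γ)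
        G≡ = trans (∑-+ y _ _) (cong₂ _+_ (trans (∑-- y _ _) (cong₂ _-_
            (trans (∑-cong y λ m 1≤m _ → cong ψ (sym (÷-÷ x 1≤k 1≤m))) (∑-ψ y))
            (trans (∑-cong y λ m 1≤m _ → trans (cong (ι x *_) (recip-* 1≤k 1≤m)) (sym (*-assoc _ _ _))) (∑-* y _ _))))
          (∑-const y _))
        0≤H : ι 0 ≤ H y
        0≤H = ∑-nonneg y λ m _ _ → 0≤recip m
        ℓy≤ : ℓ y ≤ ℓ x - ℓ k
        ℓy≤ = lin 4 (λ x k y yk → 1 −· yk := y :+ k ∷ 1 · yk :≤ x ∷ [] ⊢ 1 · y :≤ x :- k) _ _ _ _ (ℓ-* y k 1≤y 1≤k)
            (ℓ-mono (1≤* 1≤y 1≤k) (÷*≤ x k) x≤X)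
        upper : ∑ y (λ m → F (k *ℕ m)) ≤ ℓ x - ℓ k + ι 2
        upper = ≤-trans (≡⇒≤ G≡) (lin 7 (λ T t H y g l u → 1 · T :≤ y :* l :- y :+ H ∷ 1 · y :* H :≤ t :* H ∷ 1 · y :*
            g :≤ y :* (H :- l) ∷ 1 · H :≤ l :+ con 1 ∷ 1 · l :≤ u ∷ [] ⊢ 1 · T :- t :* H :+ y :* (con 1 :+ g) :≤ u :+
            con 2) _ _ _ _ _ _ _
          (logFactorial≤ 1≤y y≤X) (*-mono-0≤ (0≤ι y) (ι÷≤ x 1≤k) 0≤H ≤-refl) (*-monoʳ-0≤ (0≤ι y) (γ≤ 1≤y y≤X))
              (H≤ℓ+1 1≤y y≤X) ℓy≤)
        lower : ι 0 - (ℓ x - ℓ k + ι 2) ≤ ∑ y (λ m → F (k *ℕ m))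
        lower = ≤-trans (lin 8 (λ T t H y g l u r → 1 · y :* l :- y :≤ T ∷ 1 · t :* H :≤ (y :+ con 1) :* H ∷ 1 · y :*
            (H :- l :- r) :≤ y :* g ∷ 1 · y :* r := con 1 ∷ 1 · H :≤ l :+ con 1 ∷ 1 · l :≤ u ∷ [] ⊢ 1 · con 0 :-
            (u :+ con 2) :≤ T :- t :* H :+ y :* (con 1 :+ g)) _ _ _ _ _ _ _ _
          (≤logFactorial 1≤y y≤X) (*-mono-0≤ (*-nonneg (0≤ι x) (0≤recip k)) (≤ι÷+1 x 1≤k) 0≤H ≤-refl)
              (*-monoʳ-0≤ (0≤ι y) (≤γ 1≤y y≤X)) (recip-inv 1≤y) (H≤ℓ+1 1≤y y≤X) ℓy≤) (≡⇒≤ (sym G≡))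

      W : ℚ
      W = ℓ x * F 1 + ∑ x (λ j → Λ j * F j)

      B : ℕ → ℚ
      B k = (ℓ x - ℓ k) * (ℓ x - ℓ k) + ι 2 * (ℓ x - ℓ k)

      term-bound : ∀ k → 1 ≤ℕ k → k ≤ℕ x → let t = μ k * (ℓ x - ℓ k) * ∑ (x ÷ k) (λ m → F (k *ℕ m)) in ι 0 - B k ≤ t × t ≤ B k
      term-bound k 1≤k k≤x =
          ≤-trans (lin 3 (λ u m g → 1 · con 0 :≤ u :* (m :* g :- (con 0 :- (u :+ con 2))) ∷ [] ⊢ 1 · con 0 :-
              (u :* u :+ con 2 :* u) :≤ u :* (m :* g)) _ _ _ (*-nonneg (≤⇒0≤ mono) (≤⇒0≤ l′)))
              (≡⇒≤ (ring 3 (λ u m g → u :* (m :* g) := m :* u :* g) _ _ _))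
        , ≤-trans (≡⇒≤ (ring 3 (λ u m g → m :* u :* g := u :* (m :* g)) _ _ _)) (lin 3 (λ u m g → 1 · con 0 :≤ u :*
            (u :+ con 2 :- m :* g) ∷ [] ⊢ 1 · u :* (m :* g) :≤ u :* u :+ con 2 :* u) _ _ _ (*-nonneg (≤⇒0≤ mono) (≤⇒0≤ u′)))
        where
        mono : ℓ k ≤ ℓ x
        mono = ℓ-mono 1≤k k≤x x≤X
        bounds = μ-bound k (proj₁ (G-bound k 1≤k k≤x)) (proj₂ (G-bound k 1≤k k≤x))
        l′ = proj₁ bounds
        u′ = proj₂ bounds

      ∑B≤ : ∑ x B ≤ ι 5 * ι x
      ∑B≤ = ≤-trans (≡⇒≤ (trans (∑-+ x _ _) (cong (A₂ x +_) (∑-* x _ _)))) (lin 3 (λ a b x → 1 · a :≤ con 3 :* x ∷ 2 ·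
          b :≤ x ∷ [] ⊢ 1 · a :+ con 2 :* b :≤ con 5 :* x) _ _ _ (A₂≤ 1≤x x≤X) (A₁≤ 1≤x x≤X))

      W≤ : W ≤ ι 5 * ι x
      W≤ = ≤-trans (≡⇒≤ (sym (weighted-inversion x F 1≤x))) (≤-trans (∑-mono x λ k p q → proj₂ (term-bound k p q)) ∑B≤)

      ≤W : ι 0 - ι 5 * ι x ≤ W
      ≤W = ≤-trans (lin 2 (λ b x → 1 · b :≤ x ∷ [] ⊢ 1 · con 0 :- x :≤ con 0 :- b) _ _ ∑B≤)
        (≤-trans (≡⇒≤ (trans (cong (_- ∑ x B) (sym (∑-zero x {λ _ → ι 0} λ _ _ _ → refl))) (sym (∑-- x _ _))))
        (≤-trans (∑-mono x λ k p q → proj₁ (term-bound k p q)) (≡⇒≤ (weighted-inversion x F 1≤x))))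

    S : ℚ
    S = ψ x * ℓ x + ∑ x (λ j → Λ j * ψ (x ÷ j))

    private
      W≡S : W ≡ S - ι x * ℓ x + (ι 1 + γ) * ℓ x - ι x * M x + ψ x * (ι 1 + γ)
      W≡S = trans (cong₂ (λ f s → ℓ x * f + s) (cong₂ (λ p r → p - ι x * r + (ι 1 + γ)) (cong ψ (÷1 x)) recip1)
          (trans (∑-cong x λ j _ _ → ring 5 (λ l p x r c → l :* (p :- x :* r :+ c) := l :* p :- x :* (l :* r) :+ l :*
              c) _ _ _ _ _)
            (trans (∑-+ x _ _) (cong₂ _+_ (trans (∑-- x _ _) (cong (∑ x (λ j → Λ j * ψ (x ÷ j)) -_) (∑-* x _ _)))
                (∑-*ʳ x _ _)))))
        (ring 6 (λ l p x c s m → l :* (p :- x :* con 1 :+ c) :+ (s :- x :* m :+ p :* c) := p :* l :+ s :- x :* l :+ c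
            :* l :- x :* m :+ p :* c) _ _ _ _ _ _)

    selberg-≤ : S ≤ ι 2 * (ι x * ℓ x) + ι 20 * ι x
    selberg-≤ = lin 7 (λ w s x l g p xm → 1 −· w := s :- x :* l :+ (con 1 :+ g) :* l :- xm :+ p :* (con 1 :+ g) ∷ 1 ·
        w :≤ con 5 :* x ∷ 1 · xm :≤ x :* l :+ con 6 :* x ∷ 1 · con 0 :≤ g :* l ∷ 1 · con 0 :≤ l ∷ 1 · con 0 :≤ p ∷ 1 ·
        con 0 :≤ p :* g ∷ 9 · con 0 :≤ x ∷ [] ⊢ 1 · s :≤ con 2 :* (x :* l) :+ con 20 :* x) _ _ _ _ _ _ _
      W≡S W≤ (x*M≤ 1≤x x≤X) (*-nonneg (0≤γ 1≤X) (0≤ℓ x 1≤x)) (0≤ℓ x 1≤x) (0≤ψ x) (*-nonneg (0≤ψ x) (0≤γ 1≤X)) (0≤ι x)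

    -- The constant is 5 + 1 + 2 + 12: the error in W, Mertens' lower bound, (1 + γ) ℓ x ≤ 2 x, and
    -- (1 + γ) ψ x ≤ 12 x.
    selberg-≥ : ι 2 * (ι x * ℓ x) - ι 20 * ι x ≤ S
    selberg-≥ = lin 7 (λ w s x l g p xm → 1 · w := s :- x :* l :+ (con 1 :+ g) :* l :- xm :+ p :* (con 1 :+ g) ∷ 1 ·
        con 0 :- con 5 :* x :≤ w ∷ 1 · x :* l :- x :≤ xm ∷ 1 · con 0 :≤ (con 1 :- g) :* l ∷ 2 · l :≤ x ∷ 2 · p :≤ con
        6 :* x ∷ 1 · con 0 :≤ p :* (con 1 :- g) ∷ [] ⊢ 1 · con 2 :* (x :* l) :- con 20 :* x :≤ s) _ _ _ _ _ _ _
      W≡S ≤W (≤x*M 1≤x x≤X) (*-nonneg (≤⇒0≤ (γ≤1 1≤X)) (0≤ℓ x 1≤x)) (ℓ≤ 1≤x x≤X) (ψ≤ x x≤X) (*-nonneg (0≤ψ x)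
          (≤⇒0≤ (γ≤1 1≤X)))

  module _ {x y : ℕ} (1≤x : 1 ≤ℕ x) (x≤y : x ≤ℕ y) (y≤2x : y ≤ℕ 2 *ℕ x) (y≤X : y ≤ℕ X) where
    private
      1≤y : 1 ≤ℕ y
      1≤y = ℕₚ.≤-trans 1≤x x≤y
      x≤X : x ≤ℕ X
      x≤X = ℕₚ.≤-trans x≤y y≤X

    gap : ℕ → ℚ
    gap j = ψ (y ÷ j) - ψ (x ÷ j)

    V : ℚ
    V = (ψ y - ψ x) * ℓ x + ∑ y (λ j → Λ j * gap j)

    private
      -- The last term appears because V weighs both ψ y and ψ x by ℓ x, which makes the first
      -- summand a multiple of the gap.
      V≡ : V ≡ S 1≤y y≤X - S 1≤x x≤X - ψ y * (ℓ y - ℓ x)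
      V≡ = trans (cong ((ψ y - ψ x) * ℓ x +_) (trans (∑-cong y λ j _ _ → ring 3 (λ l a b → l :* (a :- b) := l :* a :-
          l :* b) _ _ _)
          (trans (∑-- y _ _) (cong (∑ y (λ j → Λ j * ψ (y ÷ j)) -_) (∑-extend _ x≤y λ k x<k _ → trans
              (cong (λ q → Λ k * ψ q) (÷>⇒0 x<k)) (trans (*-comm _ _) (*-zeroˡ _)))))))
        (ring 6 (λ p q l m s t → (p :- q) :* l :+ (s :- t) := p :* m :+ s :- (q :* l :+ t) :- p :* (m :- l)) _ _ _ _ _ _)

      ιy≤ : ι y ≤ ι 2 * ι x
      ιy≤ = ≤-trans (ι-mono y≤2x) (≡⇒≤ (ι-* 2 x))

      ℓy-ℓx≤1 : ℓ y - ℓ x ≤ ι 1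
      ℓy-ℓx≤1 = ≤-trans (ℓ-diff 1≤x x≤y y≤X) (≤-trans
        (lin 3 (λ x y r → 1 · y :* r :≤ con 2 :* x :* r ∷ [] ⊢ 1 · (y :- x) :* r :≤ x :* r) _ _ _ (*-mono-0≤ (0≤ι y)
            ιy≤ (0≤recip x) ≤-refl)) (≡⇒≤ (recip-inv 1≤x)))

      0≤ℓy-ℓx : ι 0 ≤ ℓ y - ℓ x
      0≤ℓy-ℓx = ≤⇒0≤ (ℓ-mono 1≤x x≤y y≤X)

    selberg-gap-≤ : V ≤ ι 2 * ((ι y - ι x) * ℓ x) + ι 72 * ι x
    selberg-gap-≤ = lin 8 (λ v s t p l m x y → 1 · v := s :- t :- p :* (m :- l) ∷ 1 · con 0 :≤ p :* (m :- l) ∷ 1 · s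
        :≤ con 2 :* (y :* m) :+ con 20 :* y ∷ 1 · con 2 :* (x :* l) :- con 20 :* x :≤ t ∷ 2 · y :* (m :- l) :≤ y :*
        con 1 ∷ 22 · y :≤ con 2 :* x ∷ 8 · con 0 :≤ x ∷ [] ⊢ 1 · v :≤ con 2 :* ((y :- x) :* l) :+ con 72 :* x) _ _ _ _
        _ _ _ _
      V≡ (*-nonneg (0≤ψ y) 0≤ℓy-ℓx) (selberg-≤ 1≤y y≤X) (selberg-≥ 1≤x x≤X) (*-monoʳ-0≤ (0≤ι y) ℓy-ℓx≤1) ιy≤ (0≤ι x)

    -- The constant is 20 + 2 · 26: Selberg's error at x, and at y ≤ 2 x Selberg's error together
    -- with ψ y (ℓ y - ℓ x) ≤ 6 y.
    selberg-gap-≥ : ι 2 * ((ι y - ι x) * ℓ x) - ι 72 * ι x ≤ V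
    selberg-gap-≥ = lin 8 (λ v s t p l m x y → 1 −· v := s :- t :- p :* (m :- l) ∷ 1 · p :* (m :- l) :≤ p :* con 1 ∷ 1
        · p :≤ con 6 :* y ∷ 1 · t :≤ con 2 :* (x :* l) :+ con 20 :* x ∷ 1 · con 2 :* (y :* m) :- con 20 :* y :≤ s ∷ 2
        · con 0 :≤ y :* (m :- l) ∷ 26 · y :≤ con 2 :* x ∷ [] ⊢ 1 · con 2 :* ((y :- x) :* l) :- con 72 :* x :≤ v) _ _ _
        _ _ _ _ _
      V≡ (*-monoʳ-0≤ (0≤ψ y) ℓy-ℓx≤1) (ψ≤ y y≤X) (selberg-≤ 1≤x x≤X) (selberg-≥ 1≤y y≤X) (*-nonneg (0≤ι y) 0≤ℓy-ℓx) ιy≤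

    -- The factor 2 here against the average density 1 is what the whole argument exploits.
    ψ-gap-≤ : (ψ y - ψ x) * ℓ x ≤ ι 2 * ((ι y - ι x) * ℓ x) + ι 72 * ι x
    ψ-gap-≤ = ≤-trans (lin 2 (λ a b → 1 · con 0 :≤ b ∷ [] ⊢ 1 · a :≤ a :+ b) _ _ (∑-nonneg y λ j 1≤j _ → *-nonneg
        (0≤Λ 1≤j) (≤⇒0≤ (ψ-mono (÷-mono j x≤y))))) selberg-gap-≤

-- Primes in short intervals

module Deductions (X : ℕ) (ℓ : ℕ → ℚ) (ℓ-* : ∀ a b → 1 ≤ℕ a → 1 ≤ℕ b → ℓ (a *ℕ b) ≡ ℓ a + ℓ b) (0≤ℓ : ∀ n → 1 ≤ℕ n → ι
    0 ≤ ℓ n)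
  (ℓ-lower : ∀ n → 1 ≤ℕ n → n <ℕ X → recip (suc n) ≤ ℓ (suc n) - ℓ n) (ℓ-upper : ∀ n → 1 ≤ℕ n → n <ℕ X → ℓ (suc n) - ℓ
      n ≤ recip n) where

  open Mangoldt ℓ ℓ-* 0≤ℓ
  open Estimates X ℓ ℓ-* 0≤ℓ ℓ-lower ℓ-upper

  -- Division of Selberg's bound by ℓ p leaves the error 72 p / ℓ p, which is at most p / e.
  -- Everything is kept multiplied by e to avoid fractions.
  ψ-gap-small : ∀ e {p q} → 1 ≤ℕ p → p ≤ℕ q → q ≤ℕ 2 *ℕ p → q ≤ℕ X → ι 1 ≤ ℓ p → ι 72 * e ≤ ℓ p → ι 0 ≤ e →
    e * (ψ q - ψ p) ≤ ι 2 * e * (ι q - ι p) + ι p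
  ψ-gap-small e {p} {q} 1≤p p≤q q≤2p q≤X 1≤ℓ 72e≤ℓ 0≤e = *-cancel-≤ 1≤ℓ
    (lin 5 (λ e d l p q → 1 · e :* (d :* l) :≤ e :* (con 2 :* ((q :- p) :* l) :+ con 72 :* p) ∷ 1 · p :* (con 72 :* e)
        :≤ p :* l ∷ [] ⊢ 1 · l :* (e :* d) :≤ l :* (con 2 :* e :* (q :- p) :+ p)) _ _ _ _ _
      (*-monoʳ-0≤ 0≤e (ψ-gap-≤ 1≤p p≤q q≤2p q≤X)) (*-monoʳ-0≤ (0≤ι p) 72e≤ℓ))

  -- The ratio y/x ≥ 1 + 3/g leaves room for two successive stretches by 1 + 1/g. U is the size
  -- beyond which Selberg's bound holds up to a relative error 1/E.
  module Deduction {g x y E U : ℕ} (8≤g : 8 ≤ℕ g) (1≤x : 1 ≤ℕ x) (gx≤gy : (g +ℕ 3) *ℕ x ≤ℕ g *ℕ y) (2y≤3x : 2 *ℕ y ≤ℕ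
      3 *ℕ x) (y≤X : y ≤ℕ X)
    (80g≤U : 80 *ℕ g ≤ℕ U) (40g≤E : 40 *ℕ g ≤ℕ E) (E≤U : E ≤ℕ U) (U-large : ∀ p → U ≤ℕ p → p ≤ℕ X → ι 72 * ι E ≤ ℓ p) where

    private
      a : ℚ
      a = ι g
      8≤a : ι 8 ≤ a
      8≤a = ι-mono 8≤g
      0≤a : ι 0 ≤ a
      0≤a = 0≤ι g
      1≤g : 1 ≤ℕ g
      1≤g = ℕₚ.≤-trans (s≤s z≤n) 8≤g
      instance
        g-nonZero : NonZero g
        g-nonZero = ℕ.>-nonZero 1≤g
      1≤U : 1 ≤ℕ U
      1≤U = ℕₚ.≤-trans (1≤* {80} (s≤s z≤n) 1≤g) 80g≤U
      x≤y : x ≤ℕ y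
      x≤y = ℕₚ.*-cancelˡ-≤ g (ℕₚ.≤-trans (ℕₚ.*-monoˡ-≤ x (ℕₚ.m≤m+n g 3)) gx≤gy)
      y≤2x : y ≤ℕ 2 *ℕ x
      y≤2x = ι-cancel (lin 4 (λ x y x2 y2 → 1 · y2 :≤ con 3 :* x ∷ 1 −· y2 := con 2 :* y ∷ 2 −· x2 := con 2 :* x ∷ 1 ·
          con 0 :≤ x ∷ [] ⊢ 2 · y :≤ x2) _ _ _ _
        (≤-trans (ι-mono 2y≤3x) (≡⇒≤ (ι-* 3 x))) (ι-* 2 y) (ι-* 2 x) (0≤ι x))
      x≤X : x ≤ℕ X
      x≤X = ℕₚ.≤-trans x≤y y≤X
      ιy≤ : ι 2 * ι y ≤ ι 3 * ι x
      ιy≤ = ≤-trans (ι-*-mono {2} {y} 2y≤3x) (≡⇒≤ (ι-* 3 x))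
      gy : (a + ι 3) * ι x ≤ a * ι y
      gy = ≤-trans (≤-trans (≡⇒≤ (trans (cong (_* ι x) (sym (ι-+ g 3))) (sym (ι-* (g +ℕ 3) x)))) (ι-mono gx≤gy))
          (≡⇒≤ (ι-* g y))

      72e≤ : ∀ {p} → U ≤ℕ p → p ≤ℕ X → ι 72 * (ι 40 * a) ≤ ℓ p
      72e≤ {p} U≤p p≤X = ≤-trans (*-monoʳ-0≤ (0≤ι 72) (ι-*-mono {40} {g} 40g≤E)) (U-large p U≤p p≤X)

      1≤ℓ : ∀ {p} → U ≤ℕ p → p ≤ℕ X → ι 1 ≤ ℓ p
      1≤ℓ U≤p p≤X = ≤-trans (lin 1 (λ a → 2880 · con 8 :≤ a ∷ [] ⊢ 1 · con 1 :≤ con 72 :* (con 40 :* a)) _ 8≤a)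
          (72e≤ U≤p p≤X)

      small₄₀ : ∀ {p q} → U ≤ℕ p → p ≤ℕ q → q ≤ℕ 2 *ℕ p → q ≤ℕ X →
        (ι 40 * a) * (ψ q - ψ p) ≤ ι 2 * (ι 40 * a) * (ι q - ι p) + ι p
      small₄₀ U≤p p≤q q≤2p q≤X = ψ-gap-small (ι 40 * a) (ℕₚ.≤-trans 1≤U U≤p) p≤q q≤2p q≤X (1≤ℓ U≤p p≤X) (72e≤ U≤p p≤X)
          (*-nonneg (0≤ι 40) 0≤a)
        where p≤X = ℕₚ.≤-trans p≤q q≤X

      smallE : ∀ {p q} → U ≤ℕ p → p ≤ℕ q → q ≤ℕ 2 *ℕ p → q ≤ℕ X →
        ι E * (ψ q - ψ p) ≤ ι 2 * ι E * (ι q - ι p) + ι p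
      smallE {p} U≤p p≤q q≤2p q≤X = ψ-gap-small (ι E) (ℕₚ.≤-trans 1≤U U≤p) p≤q q≤2p q≤X (1≤ℓ U≤p p≤X)
          (U-large p U≤p p≤X) (0≤ι E)
        where p≤X = ℕₚ.≤-trans p≤q q≤X

    D : ℕ → ℚ
    D m = ψ (y ÷ m) - ψ (x ÷ m)

    -- (x/m, y/m] carries almost twice its expected mass.
    Full : ℕ → Set
    Full m = ι 80 * a * (ι y - ι x) ≤ ι 40 * a * (ι m * D m) + ι x

    full? : ∀ m → Dec (Full m)
    full? m = _ ≤? _

    private
      -- With u = ⌊x/m⌋ one has y/m ≤ (3/2)(u + 1), which is at most 2u as soon as u ≥ 3; the gap
      -- between 3/2 and 2 absorbs the rounding.
      y÷≤ : ∀ {m} → 1 ≤ℕ m → U ≤ℕ x ÷ m → y ÷ m ≤ℕ 2 *ℕ (x ÷ m)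
      y÷≤ {m} 1≤m U≤u = ι-cancel (*-cancel-≤ (ι-mono 1≤m)
        (lin 6 (λ m v u u2 x y → 2 · v :* m :≤ y ∷ 1 · con 2 :* y :≤ con 3 :* x ∷ 3 · x :≤ u :* m :+ m ∷ 1 · m :* con
            3 :≤ m :* u ∷ 2 −· m :* u2 := m :* (con 2 :* u) ∷ [] ⊢ 2 · m :* v :≤ m :* u2) _ _ _ _ _ _
          (÷-upper y m) ιy≤ (÷-lower x 1≤m) (*-monoʳ-0≤ (0≤ι m) (ι-mono (ℕₚ.≤-trans 3≤U U≤u)))
              (cong (ι m *_) (ι-* 2 (x ÷ m)))))
        where
        3≤U : 3 ≤ℕ U
        3≤U = ℕₚ.≤-trans (ℕₚ.≤-trans (ℕₚ.m≤m+n 3 77) (ℕₚ.m≤m*n 80 g)) 80g≤U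

      x≥80gm : ∀ {m} → U ≤ℕ x ÷ m → ι 80 * a * ι m ≤ ι x
      x≥80gm {m} U≤u = ≤-trans (*-mono-0≤ (*-nonneg (0≤ι 80) 0≤a) (ι-*-mono {80} {g} (ℕₚ.≤-trans 80g≤U U≤u)) (0≤ι m)
          ≤-refl) (÷-upper x m)

    -- No part of an interval has density much above 2. If the whole has density almost 2, the two
    -- outer pieces cannot make up for a deficit in the middle.
    full-subinterval : ∀ {m p q} → 1 ≤ℕ m → U ≤ℕ x ÷ m → Full m → x ÷ m ≤ℕ p → p ≤ℕ q → q ≤ℕ y ÷ m →
      ι 80 * a * ι m * (ι q - ι p) - ι 5 * ι x ≤ ι 40 * a * ι m * (ψ q - ψ p)
    full-subinterval {m} {p} {q} 1≤m U≤u full u≤p p≤q q≤v =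
      lin 12 (λ a m u v p q x y ψu ψv ψp ψq → 2 · con 80 :* a :* (y :- x) :≤ con 40 :* a :* (m :* (ψv :- ψu)) :+ x ∷ 2
          · m :* (con 40 :* a :* (ψp :- ψu)) :≤ m :* (con 2 :* (con 40 :* a) :* (p :- u) :+ u) ∷ 2 · m :*
          (con 40 :* a :* (ψv :- ψq)) :≤ m :* (con 2 :* (con 40 :* a) :* (v :- q) :+ q) ∷ 2 · u :* m :≤ x ∷ 2 · q :* m
          :≤ v :* m ∷ 2 · v :* m :≤ y ∷ 1 · con 2 :* y :≤ con 3 :* x ∷ 160 · a :* (v :* m) :≤ a :* y ∷ 160 · a :* x :≤
          a :* (u :* m :+ m) ∷ 2 · con 80 :* a :* m :≤ x ∷ 1 · con 0 :≤ x ∷ [] ⊢ 2 · con 80 :* a :* m :* (q :- p) :-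
          con 5 :* x :≤ con 40 :* a :* m :* (ψq :- ψp)) _ _ _ _ _ _ _ _ _ _ _ _
        full
        (*-monoʳ-0≤ (0≤ι m) (small₄₀ U≤u u≤p (ℕₚ.≤-trans (ℕₚ.≤-trans p≤q q≤v) v≤2u) (ℕₚ.≤-trans p≤q q≤X)))
        (*-monoʳ-0≤ (0≤ι m) (small₄₀ (ℕₚ.≤-trans U≤u u≤q) q≤v (ℕₚ.≤-trans v≤2u (ℕₚ.*-monoʳ-≤ 2 u≤q)) v≤X))
        (÷-upper x m) (*-mono-0≤ (0≤ι q) (ι-mono q≤v) (0≤ι m) ≤-refl) (÷-upper y m) ιy≤ (*-monoʳ-0≤ 0≤a (÷-upper y m))
            (*-monoʳ-0≤ 0≤a (÷-lower x 1≤m)) (x≥80gm U≤u) (0≤ι x)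
      where
      v≤2u = y÷≤ 1≤m U≤u
      u≤q = ℕₚ.≤-trans u≤p p≤q
      v≤X = ℕₚ.≤-trans (÷≤ y m) y≤X
      q≤X = ℕₚ.≤-trans q≤v v≤X

    bad : ℕ → ℚ
    bad m = ι 1 - ind (full? m)

    0≤bad : ∀ m → ι 0 ≤ bad m
    0≤bad m = ≤⇒0≤ (ind≤1 (full? m))

    -- The weight Λ(m)/m is the one in `M`, so an interval without full m has equal increments of
    -- `Bad` and `M`.
    Bad : ℕ → ℚ
    Bad t = ∑ t λ m → bad m * (Λ m * recip m)

    Bad-mono : ∀ {s t} → s ≤ℕ t → Bad s ≤ Bad t
    Bad-mono s≤t = ∑-mono-range _ s≤t λ k s<k _ → *-nonneg (0≤bad k) (*-nonneg (0≤Λ (ℕₚ.≤-trans (s≤s z≤n) s<k)) (0≤recip k))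

    FullIn : ℕ → ℕ → Set
    FullIn p q = ∃ λ m → p <ℕ m × m ≤ℕ q × Full m

    search : ∀ {p q} → p ≤ℕ q → FullIn p q ⊎ M q - M p ≡ Bad q - Bad p
    search {p} {q} p≤q with ℕₚ.m≤n⇒m<n∨m≡n p≤q
    ... | inj₂ refl = inj₂ (trans (-‿inverseʳ _) (sym (-‿inverseʳ _)))
    search {p} {suc q} p≤q | inj₁ (s≤s p≤q′) with search p≤q′
    ... | inj₁ (m , p<m , m≤q , f) = inj₁ (m , p<m , ℕₚ.m≤n⇒m≤1+n m≤q , f)
    ... | inj₂ e = go (full? (suc q)) refl
      where
      go : (d : Dec (Full (suc q))) → full? (suc q) ≡ d → FullIn p (suc q) ⊎ M (suc q) - M p ≡ Bad (suc q) - Bad p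
      go (yes f) _ = inj₁ (suc q , s≤s p≤q′ , ℕₚ.≤-refl , f)
      go (no _) eq = inj₂ (trans (ring 3 (λ s t p → s :+ t :- p := s :- p :+ t) _ _ _)
          (trans (cong₂ _+_ e (sym (trans (cong (λ d → (ι 1 - ind d) * (Λ (suc q) * recip (suc q))) eq)
        (ring 1 (λ t → (con 1 :- con 0) :* t := t) _)))) (ring 3 (λ s t p → s :- p :+ t := s :+ t :- p) _ _ _)))

    ψ-gap-M-≤ : ∀ {p q} → p ≤ℕ q → ψ q - ψ p ≤ ι q * (M q - M p)
    ψ-gap-M-≤ {p} {q} p≤q = ≤-trans (∑-range-≤ Λ (λ k → ι q * (Λ k * recip k)) p≤q λ k p<k k≤q → let 1≤k = ℕₚ.≤-trans (s≤s z≤n) p<k in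
        ≤-trans (≡⇒≤ (trans (trans (sym (*-identityˡ _)) (cong (_* Λ k) (sym (recip-inv 1≤k))))
            (ring 3 (λ k r l → k :* r :* l := k :* (l :* r)) _ _ _)))
          (*-mono-0≤ (0≤ι k) (ι-mono k≤q) (*-nonneg (0≤Λ 1≤k) (0≤recip k)) ≤-refl))
      (≡⇒≤ (trans (cong₂ _-_ (∑-* q _ _) (∑-* p _ _)) (ring 3 (λ a b c → a :* b :- a :* c := a :* (b :- c)) _ _ _)))

    ≤-ψ-gap-M : ∀ {p q} → p ≤ℕ q → (ψ q - ψ p) * recip q ≤ M q - M p
    ≤-ψ-gap-M {p} {q} p≤q = ≤-trans (≡⇒≤ (trans (ring 3 (λ a b c → (a :- b) :* c := a :* c :- b :* c) _ _ _)
        (sym (cong₂ _-_ (∑-*ʳ q _ _) (∑-*ʳ p _ _)))))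
      (∑-range-≤ (λ k → Λ k * recip q) (λ k → Λ k * recip k) p≤q λ k p<k k≤q → let 1≤k = ℕₚ.≤-trans (s≤s z≤n) p<k in *-monoʳ-0≤ (0≤Λ 1≤k) (recip-anti 1≤k k≤q))

    module Cell {lo hi : ℕ} (few : ι 8 * a * (Bad hi - Bad lo) ≤ ι 1) where

      -- Without a full m the mass 1/(4g) would be bad throughout, but the cell holds at most 1/(8g)
      -- of bad mass.
      find : ∀ {p q} → lo ≤ℕ p → p ≤ℕ q → q ≤ℕ hi → ι 1 ≤ ι 4 * a * (M q - M p) → FullIn p q
      find {p} {q} lo≤p p≤q q≤hi mass with search p≤q
      ... | inj₁ f = f
      ... | inj₂ e = ⊥-elim (ℕₚ.1+n≰n (ι-cancel {2} {1} (lin 6 (λ a bh bl bq bp m → 2 · con 1 :≤ con 4 :* a :* m ∷ 8 ·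
          a :* m := a :* (bq :- bp) ∷ 1 · con 8 :* a :* (bh :- bl) :≤ con 1 ∷ 8 · a :* (bq :- bp) :≤ a :* (bh :- bl) ∷
          [] ⊢ 1 · con 2 :≤ con 1) _ _ _ _ _ _
          mass (cong (a *_) e) few (*-monoʳ-0≤ 0≤a (lin 4 (λ bh bl bq bp → 1 · bq :≤ bh ∷ 1 · bl :≤ bp ∷ [] ⊢ 1 · bq
              :- bp :≤ bh :- bl) _ _ _ _ (Bad-mono q≤hi) (Bad-mono lo≤p))))))

      find-ψ : ∀ {p q} → lo ≤ℕ p → p ≤ℕ q → q ≤ℕ hi → 1 ≤ℕ q → ι q ≤ ι 4 * a * (ψ q - ψ p) → FullIn p q
      find-ψ {p} {q} lo≤p p≤q q≤hi 1≤q mass = find lo≤p p≤q q≤hi (*-cancel-≤ (ι-mono 1≤q)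
          (≤-trans (≡⇒≤ (trans (*-comm _ _) (*-identityˡ _)))
        (≤-trans mass (lin 4 (λ a d q m → 4 · a :* d :≤ a :* (q :* m) ∷ [] ⊢ 1 · con 4 :* a :* d :≤ q :*
            (con 4 :* a :* m)) _ _ _ _ (*-monoʳ-0≤ 0≤a (ψ-gap-M-≤ p≤q))))))

    module Windows {lo hi lo′ hi′ : ℕ} (few : ι 8 * a * (Bad hi - Bad lo) ≤ ι 1) (few′ : ι 8 * a * (Bad hi′ - Bad lo′)
        ≤ ι 1) where

      -- Both neighbourhoods used in one step, the one right of m and the one right of x/m, must lie
      -- in their sparse windows, and m and x/m must be large enough for Selberg's bound.
      record Admissible (m : ℕ) : Set where
        field
          2U≤m : 2 *ℕ U ≤ℕ m
          U≤x÷m : U ≤ℕ x ÷ m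
          lo≤m : lo ≤ℕ m
          ≤hi : m +ℕ m ÷ g ≤ℕ hi
          lo′≤ : lo′ ≤ℕ x ÷ m
          ≤hi′ : x ÷ m +ℕ x ÷ m ÷ g ≤ℕ hi′

      -- The ratio 3/2 is a convenient value strictly above the slope 1 that Mertens' estimate
      -- permits; it adds up along a chain of steps.
      Progress : ℕ → ℕ → Set
      Progress m m′ = m′ ≤ℕ y × Full m′ × ι 3 * (ℓ m′ - ℓ m) ≤ ι 2 * (M m′ - M m)

      -- Density transfers from m to x/m and back to the right of m, where it is then about twice the average.
      step : ∀ {m} → Admissible m → Full m → ∃ λ m′ → m <ℕ m′ × Progress m m′
      step {m} adm full = m′ , m<m′ , ℕₚ.≤-trans m′≤e (ℕₚ.≤-trans e≤y÷n (÷≤ y n)) , full′ , gain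
        where
        open Admissible adm
        u t w : ℕ
        u = x ÷ m
        t = u ÷ g
        w = u +ℕ t
        1≤m : 1 ≤ℕ m
        1≤m = ℕₚ.≤-trans (1≤* {2} (s≤s z≤n) 1≤U) 2U≤m
        1≤u : 1 ≤ℕ u
        1≤u = ℕₚ.≤-trans 1≤U U≤x÷m
        0≤m : ι 0 ≤ ι m
        0≤m = 0≤ι m
        at≤u : ι t * a ≤ ι u
        at≤u = ÷-upper u g
        80a≤u : ι 80 * a ≤ ι u
        80a≤u = ι-*-mono {80} {g} (ℕₚ.≤-trans 80g≤U U≤x÷m)
        80a≤U : ι 80 * a ≤ ι U
        80a≤U = ι-*-mono {80} {g} 80g≤U
        2U≤ : ι 2 * ι U ≤ ι m
        2U≤ = ι-*-mono {2} {U} 2U≤m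
        8t≤u : ι 8 * ι t ≤ ι u
        8t≤u = lin 3 (λ a t u → 1 · t :* a :≤ u ∷ 1 · con 0 :≤ t :* (a :- con 8) ∷ [] ⊢ 1 · con 8 :* t :≤ u) _ _ _
            at≤u (*-nonneg (0≤ι t) (≤⇒0≤ 8≤a))
        w≤v : w ≤ℕ y ÷ m
        w≤v = *≤⇒≤÷ 1≤m (ι-cancel (≤-trans (≡⇒≤ (ι-* w m)) (*-cancel-≤ {a} (ι-mono 1≤g)
          (lin 7 (λ a m u t w x y → 1 · a :* m :* w := a :* m :* (u :+ t) ∷ 1 · a :* (u :* m) :≤ a :* x ∷ 1 · m :*
              (t :* a) :≤ m :* u ∷ 1 · u :* m :≤ x ∷ 1 · (a :+ con 3) :* x :≤ a :* y ∷ 2 · con 0 :≤ x ∷ [] ⊢ 1 · a :*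
              (w :* m) :≤ a :* y) _ _ _ _ _ _ _
            (cong (a * ι m *_) (ι-+ u t)) (*-monoʳ-0≤ 0≤a (÷-upper x m)) (*-monoʳ-0≤ 0≤m at≤u) (÷-upper x m) gy (0≤ι x)))))
        mass-w : ι w ≤ ι 4 * a * (ψ w - ψ u)
        mass-w = *-cancel-≤ (ι-mono 1≤m) (lin 7 (λ a m u t w x d → 4 · con 80 :* a :* m :* (w :- u) :- con 5 :* x :≤
            con 40 :* a :* m :* d ∷ 40 · m :* w := m :* (u :+ t) ∷ 320 −· a :* m :* w := a :* m :* (u :+ t) ∷ 20 · x
            :≤ u :* m :+ m ∷ 320 · m :* u :≤ m :* (t :* a :+ a) ∷ 5 · m :* (con 8 :* t) :≤ m :* u ∷ 255 · m :*
            (con 80 :* a) :≤ m :* u ∷ 20080 · m :* con 8 :≤ m :* a ∷ 160620 · con 0 :≤ m ∷ [] ⊢ 40 · m :* w :≤ m :*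
            (con 4 :* a :* d)) _ _ _ _ _ _ _
          (full-subinterval 1≤m U≤x÷m full ℕₚ.≤-refl (ℕₚ.m≤m+n u t) w≤v) (cong (ι m *_) (ι-+ u t)) (cong (a * ι m *_)
              (ι-+ u t)) (÷-lower x 1≤m)
          (*-monoʳ-0≤ 0≤m (÷-lower u 1≤g)) (*-monoʳ-0≤ 0≤m 8t≤u) (*-monoʳ-0≤ 0≤m 80a≤u) (*-monoʳ-0≤ 0≤m 8≤a) 0≤m)
        found : FullIn u w
        found = Cell.find-ψ {lo′} {hi′} few′ lo′≤ (ℕₚ.m≤m+n u t) ≤hi′ (ℕₚ.≤-trans 1≤u (ℕₚ.m≤m+n u t)) mass-w
        n = proj₁ found
        u<n = proj₁ (proj₂ found)
        n≤w = proj₁ (proj₂ (proj₂ found))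
        full-n = proj₂ (proj₂ (proj₂ found))
        1≤n : 1 ≤ℕ n
        1≤n = ℕₚ.≤-trans (s≤s z≤n) u<n
        0≤n : ι 0 ≤ ι n
        0≤n = 0≤ι n
        n≤ : ι n ≤ ι u + ι t
        n≤ = ≤-trans (ι-mono n≤w) (≡⇒≤ (ι-+ u t))
        U≤x÷n : U ≤ℕ x ÷ n
        U≤x÷n = *≤⇒≤÷ 1≤n (ι-cancel (≤-trans (≡⇒≤ (ι-* U n)) (lin 6 (λ U n u t m x → 1 · U :* n :≤ U :* (u :+ t) ∷ 1 ·
            U :* (con 8 :* t) :≤ U :* u ∷ 1 · u :* (con 2 :* U) :≤ u :* m ∷ 1 · u :* m :≤ x ∷ 7 · con 0 :≤ U :* t ∷ []
            ⊢ 1 · U :* n :≤ x) _ _ _ _ _ _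
          (*-monoʳ-0≤ (0≤ι U) n≤) (*-monoʳ-0≤ (0≤ι U) 8t≤u) (*-monoʳ-0≤ (0≤ι u) 2U≤) (÷-upper x m) (*-nonneg (0≤ι U)
              (0≤ι t)))))
        -- Because n exceeds ⌊x/m⌋, x < n m, so the interval (x/n, y/n] starts no later than m.
        s≤m : x ÷ n ≤ℕ m
        s≤m = ℕₚ.<⇒≤ (ℕₚ.*-cancelʳ-< n (x ÷ n) m (ℕₚ.≤-<-trans (÷*≤ x n) (ℕₚ.<-≤-trans (<÷* x 1≤m)
            (ℕₚ.≤-trans (ℕₚ.*-monoˡ-≤ m u<n) (ℕₚ.≤-reflexive (ℕₚ.*-comm n m))))))
        x≤nm : ι x ≤ ι n * ι m
        x≤nm = ≤-trans (ι-mono (ℕₚ.<⇒≤ (ℕₚ.<-≤-trans (<÷* x 1≤m) (ℕₚ.*-monoˡ-≤ m u<n)))) (≡⇒≤ (ι-* n m))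

        τ σ e mid : ℕ
        τ = m ÷ g
        σ = m ÷ (2 *ℕ g)
        e = m +ℕ τ
        -- The next point is sought beyond this midpoint, so that m′ - m is at least m/(2g) and the
        -- additive error 5 x stays small against it.
        mid = m +ℕ σ
        1≤2g : 1 ≤ℕ 2 *ℕ g
        1≤2g = 1≤* {2} (s≤s z≤n) 1≤g
        aτ≤m : ι τ * a ≤ ι m
        aτ≤m = ÷-upper m g
        8τ≤m : ι 8 * ι τ ≤ ι m
        8τ≤m = lin 3 (λ a t u → 1 · t :* a :≤ u ∷ 1 · con 0 :≤ t :* (a :- con 8) ∷ [] ⊢ 1 · con 8 :* t :≤ u) _ _ _
            aτ≤m (*-nonneg (0≤ι τ) (≤⇒0≤ 8≤a))
        2aσ≤m : ι σ * (ι 2 * a) ≤ ι m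
        2aσ≤m = ≤-trans (≡⇒≤ (cong (ι σ *_) (sym (ι-* 2 g)))) (÷-upper m (2 *ℕ g))
        m≤2aσ : ι m ≤ ι σ * (ι 2 * a) + ι 2 * a
        m≤2aσ = ≤-trans (÷-lower m 1≤2g) (≡⇒≤ (cong (λ k → ι σ * k + k) (ι-* 2 g)))
        σ≤τ : σ ≤ℕ τ
        σ≤τ = ÷-anti m 1≤g (ℕₚ.m≤m+n g _)
        mid≤e : mid ≤ℕ e
        mid≤e = ℕₚ.+-monoʳ-≤ m σ≤τ
        1≤e : 1 ≤ℕ e
        1≤e = ℕₚ.≤-trans 1≤m (ℕₚ.m≤m+n m τ)
        -- Here n ≤ (1 + 1/g) x/m and e ≤ (1 + 1/g) m, and (1 + 1/g)² ≤ 1 + 3/g.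
        e≤y÷n : e ≤ℕ y ÷ n
        e≤y÷n = *≤⇒≤÷ 1≤n (ι-cancel (≤-trans (≡⇒≤ (ι-* e n)) (*-cancel-≤ {a} (ι-mono 1≤g) (*-cancel-≤ {a} (ι-mono 1≤g)
          (lin 7 (λ a m u n e x y → 1 · a :* e :* (a :* n) :≤ (a :* m :+ m) :* (a :* u :+ u) ∷ 1 · (a :+ con 1) :*
              (a :+ con 1) :* (u :* m) :≤ (a :+ con 1) :* (a :+ con 1) :* x ∷ 1 · a :* ((a :+ con 3) :* x) :≤ a :*
              (a :* y) ∷ 1 · con 8 :* x :≤ a :* x ∷ 7 · con 0 :≤ x ∷ [] ⊢ 1 · a :* (a :* (e :* n)) :≤ a :* (a :* y)) _
              _ _ _ _ _ _
            (*-mono-0≤ (*-nonneg 0≤a (0≤ι e))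
              (lin 4 (λ a m t e → 1 · a :* e := a :* (m :+ t) ∷ 1 · t :* a :≤ m ∷ [] ⊢ 1 · a :* e :≤ a :* m :+ m) _ _
                  _ _ (cong (a *_) (ι-+ m τ)) aτ≤m)
              (*-nonneg 0≤a 0≤n)
              (lin 4 (λ a u t n → 1 · a :* n :≤ a :* (u :+ t) ∷ 1 · t :* a :≤ u ∷ [] ⊢ 1 · a :* n :≤ a :* u :+ u) _ _
                  _ _ (*-monoʳ-0≤ 0≤a n≤) at≤u))
            (*-monoʳ-0≤ (*-nonneg 0≤a+1 0≤a+1) (÷-upper x m)) (*-monoʳ-0≤ 0≤a gy) (*-mono-0≤ (0≤ι 8) 8≤a (0≤ι x)
                ≤-refl) (0≤ι x))))))
          where
          0≤a+1 : ι 0 ≤ a + ι 1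
          0≤a+1 = ≤-trans 0≤a (lin 1 (λ a → [] ⊢ 1 · a :≤ a :+ con 1) _)
        160a≤m : ι 160 * a ≤ ι m
        160a≤m = lin 3 (λ a U m → 2 · con 80 :* a :≤ U ∷ 1 · con 2 :* U :≤ m ∷ [] ⊢ 1 · con 160 :* a :≤ m) _ _ _ 80a≤U 2U≤
        mass-e : ι e ≤ ι 4 * a * (ψ e - ψ mid)
        mass-e = *-cancel-≤ (ι-mono 1≤n) (lin 9 (λ a n m τ σ e mid x d → 4 · con 80 :* a :* n :* (e :- mid) :- con 5
            :* x :≤ con 40 :* a :* n :* d ∷ 40 · n :* e := n :* (m :+ τ) ∷ 320 −· a :* n :* e := a :* n :* (m :+ τ) ∷
            320 · a :* n :* mid := a :* n :* (m :+ σ) ∷ 20 · x :≤ n :* m ∷ 320 · n :* m :≤ n :* (τ :* a :+ a) ∷ 160 ·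
            n :* (σ :* (con 2 :* a)) :≤ n :* m ∷ 5 · n :* (con 8 :* τ) :≤ n :* m ∷ 95 · n :* (con 160 :* a) :≤ n :* m
            ∷ 14880 · con 0 :≤ n :* a ∷ [] ⊢ 40 · n :* e :≤ n :* (con 4 :* a :* d)) _ _ _ _ _ _ _ _ _
          (full-subinterval 1≤n U≤x÷n full-n (ℕₚ.≤-trans s≤m (ℕₚ.m≤m+n m σ)) mid≤e e≤y÷n) (cong (ι n *_) (ι-+ m τ))
              (cong (a * ι n *_) (ι-+ m τ)) (cong (a * ι n *_) (ι-+ m σ))
          x≤nm (*-monoʳ-0≤ 0≤n (÷-lower m 1≤g)) (*-monoʳ-0≤ 0≤n 2aσ≤m) (*-monoʳ-0≤ 0≤n 8τ≤m) (*-monoʳ-0≤ 0≤n 160a≤m)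
              (*-nonneg 0≤n 0≤a))
        found′ : FullIn mid e
        found′ = Cell.find-ψ {lo} {hi} few (ℕₚ.≤-trans lo≤m (ℕₚ.m≤m+n m σ)) mid≤e ≤hi 1≤e mass-e
        m′ = proj₁ found′
        mid<m′ = proj₁ (proj₂ found′)
        m′≤e = proj₁ (proj₂ (proj₂ found′))
        full′ = proj₂ (proj₂ (proj₂ found′))
        m<m′ : m <ℕ m′
        m<m′ = ℕₚ.≤-<-trans (ℕₚ.m≤m+n m σ) mid<m′
        1≤m′ : 1 ≤ℕ m′
        1≤m′ = ℕₚ.≤-trans (s≤s z≤n) m<m′
        0≤Δ : ι 0 ≤ ι m′ - ι m
        0≤Δ = ≤⇒0≤ (ι-mono (ℕₚ.<⇒≤ m<m′))
        m≤2aΔ : ι m ≤ ι 2 * a * (ι m′ - ι m)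
        m≤2aΔ = lin 4 (λ a m s m′ → 1 · m :≤ s :* (con 2 :* a) :+ con 2 :* a ∷ 2 · a :* (con 1 :+ (m :+ s)) :≤ a :* m′
            ∷ [] ⊢ 1 · m :≤ con 2 :* a :* (m′ :- m)) _ _ _ _
          m≤2aσ (*-monoʳ-0≤ 0≤a (≤-trans (≡⇒≤ (trans (cong (ι 1 +_) (sym (ι-+ m σ))) (sym (ι-suc mid)))) (ι-mono mid<m′)))
        -- The error 5 x ≤ 5 n m ≤ 10 g n (m′ - m) is one eighth of the main term, which lowers the
        -- density from 2 to 7/4.
        density : ι 7 * (ι m′ - ι m) ≤ ι 4 * (ψ m′ - ψ m)
        density = *-cancel-≤ {a} (ι-mono 1≤g) (*-cancel-≤ {ι n} (ι-mono 1≤n) (lin 6 (λ a n m m′ x d → 1 · con 80 :* a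
            :* n :* (m′ :- m) :- con 5 :* x :≤ con 40 :* a :* n :* d ∷ 5 · x :≤ n :* m ∷ 5 · n :* m :≤ n :*
            (con 2 :* a :* (m′ :- m)) ∷ [] ⊢ 10 · n :* (a :* (con 7 :* (m′ :- m))) :≤ n :* (a :* (con 4 :* d))) _ _ _ _ _ _
          (full-subinterval 1≤n U≤x÷n full-n s≤m (ℕₚ.<⇒≤ m<m′) (ℕₚ.≤-trans m′≤e e≤y÷n)) x≤nm (*-monoʳ-0≤ 0≤n m≤2aΔ)))
        r r′ : ℚ
        r = recip m
        r′ = recip m′
        8r≤9r′ : ι 8 * r ≤ ι 9 * r′
        8r≤9r′ = lin 4 (λ m m′ r r′ → 1 · r :* r′ :* (con 8 :* m′) :≤ r :* r′ :* (con 9 :* m) ∷ 8 −· r :* (m′ :* r′)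
            := r :* con 1 ∷ 9 · r′ :* (m :* r) := r′ :* con 1 ∷ [] ⊢ 1 · con 8 :* r :≤ con 9 :* r′) _ _ _ _
          (*-monoʳ-0≤ (*-nonneg (0≤recip m) (0≤recip m′)) (lin 4 (λ m m′ τ e → 8 · m′ :≤ e ∷ 8 · e := m :+ τ ∷ 1 · con
              8 :* τ :≤ m ∷ [] ⊢ 1 · con 8 :* m′ :≤ con 9 :* m) _ _ _ _ (ι-mono m′≤e) (ι-+ m τ) 8τ≤m))
          (cong (r *_) (recip-inv 1≤m′)) (cong (r′ *_) (recip-inv 1≤m))
        -- Weights 1/k vary by at most 9/8 over the step, because g ≥ 8, and (7/4)(8/9) = 14/9 is
        -- still above 3/2.
        gain : ι 3 * (ℓ m′ - ℓ m) ≤ ι 2 * (M m′ - M m)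
        gain = lin 8 (λ l l′ μ μ′ d δ r r′ → 24 · l′ :- l :≤ δ :* r ∷ 3 · δ :* (con 8 :* r) :≤ δ :* (con 9 :* r′) ∷ 4
            · r′ :* (con 7 :* δ) :≤ r′ :* (con 4 :* d) ∷ 16 · d :* r′ :≤ μ′ :- μ ∷ 1 · con 0 :≤ δ :* r′ ∷ [] ⊢ 8 · con
            3 :* (l′ :- l) :≤ con 2 :* (μ′ :- μ)) _ _ _ _ _ _ _ _
          (ℓ-diff 1≤m (ℕₚ.<⇒≤ m<m′) (ℕₚ.≤-trans m′≤e (ℕₚ.≤-trans e≤y÷n (ℕₚ.≤-trans (÷≤ y n) y≤X)))) (*-monoʳ-0≤ 0≤Δ
              8r≤9r′) (*-monoʳ-0≤ (0≤recip m′) density) (≤-ψ-gap-M (ℕₚ.<⇒≤ m<m′)) (*-nonneg 0≤Δ (0≤recip m′))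

      -- Each step increases m by at least one, so d serves as fuel.
      climb : ∀ d {m target} → (∀ k → lo ≤ℕ k → k <ℕ target → Admissible k) → lo ≤ℕ m → m ≤ℕ y → Full m → target ≤ℕ m +ℕ d →
        ∃ λ m′ → target ≤ℕ m′ × Progress m m′
      climb d {m} {target} ok lo≤m m≤y full le with target ℕ.≤? m
      ... | yes target≤m = m , target≤m , m≤y , full , lin 2 (λ a b → [] ⊢ 1 · con 3 :* (a :- a) :≤ con 2 :* (b :- b)) _ _
      climb zero {m} {target} ok lo≤m m≤y full le | no ≰m = ⊥-elim (≰m (ℕₚ.≤-trans le (ℕₚ.≤-reflexive (ℕₚ.+-identityʳ m))))
      climb (suc d) {m} {target} ok lo≤m m≤y full le | no ≰m =
        let m₁ , m<m₁ , m₁≤y , full₁ , gain₁ = step (ok m lo≤m (ℕₚ.≰⇒> ≰m)) full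
            m₂ , target≤m₂ , m₂≤y , full₂ , gain₂ = climb d ok (ℕₚ.≤-trans lo≤m (ℕₚ.<⇒≤ m<m₁)) m₁≤y full₁
              (ℕₚ.≤-trans le (ℕₚ.≤-trans (ℕₚ.≤-reflexive (ℕₚ.+-suc m d)) (ℕₚ.+-monoˡ-≤ d m<m₁)))
        in m₂ , target≤m₂ , m₂≤y , full₂ , lin 6 (λ a b c p q r → 1 · con 3 :* (b :- a) :≤ con 2 :* (q :- p) ∷ 1 · con
            3 :* (c :- b) :≤ con 2 :* (r :- q) ∷ [] ⊢ 1 · con 3 :* (c :- a) :≤ con 2 :* (r :- p)) _ _ _ _ _ _ gain₁ gain₂

    module _ {K₁ K₂ : ℕ} (1≤K₁ : 1 ≤ℕ K₁) (1≤K₂ : 1 ≤ℕ K₂) (8≤ℓK₁ : ι 8 ≤ ℓ K₁) (15≤ℓK₂ : ι 15 ≤ ℓ K₂) where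
      private
        K : ℕ
        K = 2 *ℕ (K₂ *ℕ K₁)
        1≤K₂K₁ : 1 ≤ℕ K₂ *ℕ K₁
        1≤K₂K₁ = 1≤* 1≤K₂ 1≤K₁
        2≤K : 2 ≤ℕ K
        2≤K = ℕₚ.*-monoʳ-≤ 2 1≤K₂K₁

      -- Let Δ be the growth of ℓ along the climb. Since M - ℓ lies between -1 and 6, the gain gives
      -- 3 Δ ≤ 2 (Δ + 7), so Δ ≤ 14, whereas a climb by the factor K₂ has Δ ≥ 15.
      sparse-window-absurd : ∀ {t} → U ≤ℕ t → U ≤ℕ x ÷ (K *ℕ (K *ℕ t)) →
        ι 8 * a * (Bad (K *ℕ (K *ℕ t)) - Bad (K *ℕ t)) ≤ ι 1 → ι 8 * a * (Bad (x ÷ t) - Bad (x ÷ (K *ℕ (K *ℕ t)))) ≤ ι 1 → ⊥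
      sparse-window-absurd {t} U≤t U≤x÷hi few few′ = ℕₚ.1+n≰n (ι-cancel {15} {14}
          (lin 6 (λ l₀ l′ lt k μ₀ μ′ → 1 · con 3 :* (l′ :- l₀) :≤ con 2 :* (μ′ :- μ₀) ∷ 2 · μ′ :≤ l′ :+ con 6 ∷ 2 · l₀
              :- con 1 :≤ μ₀ ∷ 1 · lt :≤ l′ ∷ 1 −· lt := k :+ l₀ ∷ 1 · con 15 :≤ k ∷ [] ⊢ 1 · con 15 :≤ con 14) _ _ _ _ _ _
            gain (M≤ 1≤m′ m′≤X) (≤M 1≤m₀ m₀≤X) (ℓ-mono (1≤* 1≤K₂ 1≤m₀) target≤m′ m′≤X) (ℓ-* K₂ m₀ 1≤K₂ 1≤m₀) 15≤ℓK₂))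
        where
        lo hi : ℕ
        lo = K *ℕ t
        hi = K *ℕ lo
        open Windows {lo} {hi} {x ÷ hi} {x ÷ t} few few′
        1≤t : 1 ≤ℕ t
        1≤t = ℕₚ.≤-trans 1≤U U≤t
        1≤lo : 1 ≤ℕ lo
        1≤lo = 1≤* (ℕₚ.≤-trans (s≤s z≤n) 2≤K) 1≤t
        hi≤x : hi ≤ℕ x
        hi≤x = ℕₚ.≤-trans (ℕₚ.≤-reflexive (sym (ℕₚ.*-identityˡ hi))) (≤÷⇒*≤ {x} {hi} (ℕₚ.≤-trans 1≤U U≤x÷hi))
        K₁lo≤hi : K₁ *ℕ lo ≤ℕ hi
        K₁lo≤hi = ℕₚ.*-monoˡ-≤ lo (ℕₚ.≤-trans (ℕₚ.m≤n*m K₁ K₂ {{ℕ.>-nonZero 1≤K₂}}) (ℕₚ.m≤m+n _ _))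
        lo≤K₁lo : lo ≤ℕ K₁ *ℕ lo
        lo≤K₁lo = ℕₚ.m≤n*m lo K₁ {{ℕ.>-nonZero 1≤K₁}}
        K₁lo≤X : K₁ *ℕ lo ≤ℕ X
        K₁lo≤X = ℕₚ.≤-trans K₁lo≤hi (ℕₚ.≤-trans hi≤x x≤X)
        -- By Mertens this range has mass at least ℓ K₁ - 7 ≥ 1, far more than the bad mass of the
        -- cell.
        initial : FullIn lo (K₁ *ℕ lo)
        initial = Cell.find {lo} {hi} few ℕₚ.≤-refl lo≤K₁lo K₁lo≤hi (lin 6 (λ a k l lk μ μ′ → 4 · a :* (lk :- con 1)
            :≤ a :* μ′ ∷ 4 · a :* μ :≤ a :* (l :+ con 6) ∷ 4 −· a :* lk := a :* (k :+ l) ∷ 4 · a :* con 8 :≤ a :* k ∷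
            4 · con 8 :≤ a ∷ [] ⊢ 1 · con 1 :≤ con 4 :* a :* (μ′ :- μ)) _ _ _ _ _ _
          (*-monoʳ-0≤ 0≤a (≤M (ℕₚ.≤-trans 1≤lo lo≤K₁lo) K₁lo≤X)) (*-monoʳ-0≤ 0≤a (M≤ 1≤lo (ℕₚ.≤-trans lo≤K₁lo K₁lo≤X)))
          (cong (a *_) (ℓ-* K₁ lo 1≤K₁ 1≤lo)) (*-monoʳ-0≤ 0≤a 8≤ℓK₁) 8≤a)
        m₀ = proj₁ initial
        lo≤m₀ = ℕₚ.<⇒≤ (proj₁ (proj₂ initial))
        m₀≤K₁lo = proj₁ (proj₂ (proj₂ initial))
        1≤m₀ : 1 ≤ℕ m₀
        1≤m₀ = ℕₚ.≤-trans 1≤lo lo≤m₀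
        m₀≤x : m₀ ≤ℕ x
        m₀≤x = ℕₚ.≤-trans m₀≤K₁lo (ℕₚ.≤-trans K₁lo≤hi hi≤x)
        m₀≤X : m₀ ≤ℕ X
        m₀≤X = ℕₚ.≤-trans m₀≤x x≤X
        double : ∀ k → k +ℕ k ÷ g ≤ℕ 2 *ℕ k
        double k = ℕₚ.+-monoʳ-≤ k (ℕₚ.≤-trans (÷≤ k g) (ℕₚ.m≤m+n k 0))
        -- The factor 2 in K leaves room for k + k/g ≤ 2 k below hi. The dual window extends to x/t
        -- rather than x/lo for the same reason at x/k.
        admissible : ∀ k → lo ≤ℕ k → k <ℕ K₂ *ℕ m₀ → Admissible k
        admissible k lo≤k k<target = record
          { 2U≤m = ℕₚ.≤-trans (ℕₚ.*-mono-≤ 2≤K U≤t) lo≤k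
          ; U≤x÷m = ℕₚ.≤-trans U≤x÷hi lo′≤
          ; lo≤m = lo≤k
          ; ≤hi = ℕₚ.≤-trans (double k) 2k≤hi
          ; lo′≤ = lo′≤
          ; ≤hi′ = ℕₚ.≤-trans (double (x ÷ k)) (*≤⇒≤÷ 1≤t (ℕₚ.≤-trans (ℕₚ.≤-reflexive
              (trans (cong (_*ℕ t) (ℕₚ.*-comm 2 (x ÷ k))) (ℕₚ.*-assoc (x ÷ k) 2 t)))
              (ℕₚ.≤-trans (ℕₚ.*-monoʳ-≤ (x ÷ k) (ℕₚ.≤-trans (ℕₚ.*-monoˡ-≤ t 2≤K) lo≤k)) (÷*≤ x k))))
          }
          where
          2k≤hi : 2 *ℕ k ≤ℕ hi
          2k≤hi = ℕₚ.≤-trans (ℕₚ.*-monoʳ-≤ 2 (ℕₚ.≤-trans (ℕₚ.<⇒≤ k<target) (ℕₚ.*-monoʳ-≤ K₂ m₀≤K₁lo)))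
            (ℕₚ.≤-reflexive (trans (cong (2 *ℕ_) (sym (ℕₚ.*-assoc K₂ K₁ lo))) (sym (ℕₚ.*-assoc 2 (K₂ *ℕ K₁) lo))))
          lo′≤ : x ÷ hi ≤ℕ x ÷ k
          lo′≤ = ÷-anti x (ℕₚ.≤-trans 1≤lo lo≤k) (ℕₚ.≤-trans (ℕₚ.m≤m+n k _) 2k≤hi)
        final : ∃ λ m′ → K₂ *ℕ m₀ ≤ℕ m′ × Progress m₀ m′
        final = climb (K₂ *ℕ m₀) admissible lo≤m₀ (ℕₚ.≤-trans m₀≤x x≤y) (proj₂ (proj₂ (proj₂ initial))) (ℕₚ.m≤n+m _ m₀)
        m′ = proj₁ final
        target≤m′ = proj₁ (proj₂ final)
        m′≤X = ℕₚ.≤-trans (proj₁ (proj₂ (proj₂ final))) y≤X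
        gain = proj₂ (proj₂ (proj₂ (proj₂ final)))
        1≤m′ : 1 ≤ℕ m′
        1≤m′ = ℕₚ.≤-trans (1≤* 1≤K₂ 1≤m₀) target≤m′

    module _ (4x≤X : 4 *ℕ x ≤ℕ X) (U≤x : U ≤ℕ x) (no-mass : ι E * (ψ y - ψ x) ≤ ι x) where
      private
        N : ℕ
        N = x ÷ U
        1≤N : 1 ≤ℕ N
        1≤N = 1≤÷ 1≤U U≤x
        N≤x : N ≤ℕ x
        N≤x = ÷≤ x U
        N≤y : N ≤ℕ y
        N≤y = ℕₚ.≤-trans N≤x x≤y
        e : ℚ
        e = ι E
        0≤e : ι 0 ≤ e
        0≤e = 0≤ι E
        -- The deficit of D m below 2 (y - x) / m, multiplied by E m and shifted by 3 x to become nonnegative.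
        excess : ℕ → ℚ
        excess m = ι 2 * e * (ι y - ι x) + ι 3 * ι x - e * (ι m * D m)

        -- Of the shift 3 x, one x covers the error term of Selberg's bound. The other two cover the
        -- rounding of y/m and x/m, which costs at most 2 E m ≤ 2 U m ≤ 2 x.
        0≤excess : ∀ m → 1 ≤ℕ m → m ≤ℕ N → ι 0 ≤ excess m
        0≤excess m 1≤m m≤N = lin 8 (λ e m u v x y d U → 1 · m :* (e :* d) :≤ m :* (con 2 :* e :* (v :- u) :+ u) ∷ 2 ·
            e :* (v :* m) :≤ e :* y ∷ 2 · e :* x :≤ e :* (u :* m :+ m) ∷ 2 · m :* e :≤ m :* U ∷ 2 · m :* U :≤ x ∷ 1 ·
            u :* m :≤ x ∷ [] ⊢ 1 · con 0 :≤ con 2 :* e :* (y :- x) :+ con 3 :* x :- e :* (m :* d)) _ _ _ _ _ _ _ _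
          (*-monoʳ-0≤ (0≤ι m) (smallE U≤u (÷-mono m x≤y) (y÷≤ 1≤m U≤u) (ℕₚ.≤-trans (÷≤ y m) y≤X))) (*-monoʳ-0≤ 0≤e
              (÷-upper y m)) (*-monoʳ-0≤ 0≤e (÷-lower x 1≤m))
          (*-monoʳ-0≤ (0≤ι m) (ι-mono E≤U)) (ι-*-mono {m} {U} mU≤x) (÷-upper x m)
          where
          mU≤x : m *ℕ U ≤ℕ x
          mU≤x = ≤÷⇒*≤ {x} {U} m≤N
          U≤u : U ≤ℕ x ÷ m
          U≤u = *≤⇒≤÷ 1≤m (ℕₚ.≤-trans (ℕₚ.≤-reflexive (ℕₚ.*-comm U m)) mU≤x)

        -- Markov's inequality in pointwise form: an m that is not full misses at least x/(40 g).
        bad≤excess : ∀ m → 1 ≤ℕ m → m ≤ℕ N → e * ι x * bad m ≤ ι 40 * a * excess m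
        bad≤excess m 1≤m m≤N with full? m
        ... | yes _ = lin 3 (λ e x q → 1 · con 0 :≤ q ∷ [] ⊢ 1 · e :* x :* (con 1 :- con 1) :≤ q) _ _ _
            (*-nonneg (*-nonneg (0≤ι 40) 0≤a) (0≤excess m 1≤m m≤N))
        ... | no ¬full with ≤-total (ι 80 * a * (ι y - ι x)) (ι 40 * a * (ι m * D m) + ι x)
        ... | inj₁ full = ⊥-elim (¬full full)
        ... | inj₂ le = lin 5 (λ a e x y p → 1 · e :* (con 40 :* a :* p :+ x) :≤ e :* (con 80 :* a :* (y :- x)) ∷ 120
            · con 0 :≤ a :* x ∷ [] ⊢ 1 · e :* x :* (con 1 :- con 0) :≤ con 40 :* a :* (con 2 :* e :* (y :- x) :+ con 3
            :* x :- e :* p)) _ _ _ _ _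
          (*-monoʳ-0≤ 0≤e le) (*-nonneg 0≤a (0≤ι x))

        ΛD : ℕ → ℚ
        ΛD m = Λ m * D m

        ∑excess : ∑ N (λ m → Λ m * recip m * excess m) ≡ (ι 2 * e * (ι y - ι x) + ι 3 * ι x) * M N - e * ∑ N ΛD
        ∑excess = trans (∑-cong N λ m 1≤m _ → trans (ring 6 (λ l r c e m d → l :* r :* (c :- e :* (m :* d)) := c :*
            (l :* r) :- e :* (l :* d) :* (m :* r)) _ _ _ _ _ _)
            (trans (cong ((ι 2 * e * (ι y - ι x) + ι 3 * ι x) * (Λ m * recip m) -_) (trans (cong (e * (Λ m * D m) *_)
                (recip-inv 1≤m)) (trans (*-comm _ _) (*-identityˡ _)))) refl))
          (trans (∑-- N _ _) (cong₂ _-_ (∑-* N _ _) (∑-* N _ _)))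

        tail : ∑ y ΛD - ∑ N ΛD ≤ ι 12 * ι x * (ι 4 * ι U + ι 7)
        tail = lin 6 (λ s x y U my mN → 1 · s :≤ con 6 :* y :* (my :- mN) ∷ 6 · y :* (my :- mN) :≤ y :*
            (con 4 :* U :+ con 7) ∷ 6 · (con 4 :* U :+ con 7) :* y :≤ (con 4 :* U :+ con 7) :* (con 2 :* x) ∷ [] ⊢ 1 ·
            s :≤ con 12 :* x :* (con 4 :* U :+ con 7)) _ _ _ _ _ _
            (≤-trans (∑-range-≤ ΛD (λ m → ι 6 * ι y * (Λ m * recip m)) N≤y λ m N<m _ → term m (ℕₚ.≤-trans (s≤s z≤n) N<m))
              (≡⇒≤ (trans (cong₂ _-_ (∑-* y _ _) (∑-* N _ _)) (ring 3 (λ c p q → c :* p :- c :* q := c :* (p :- q)) _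
                  _ _))))
            (*-monoʳ-0≤ (0≤ι y) mass) (*-monoʳ-0≤ (≤-trans (0≤ι 7) (lin 1 (λ U → 4 · con 0 :≤ U ∷ [] ⊢ 1 · con 7 :≤
                con 4 :* U :+ con 7) _ (0≤ι U))) (≤-trans (ι-mono y≤2x) (≡⇒≤ (ι-* 2 x))))
          where
          term : ∀ m → 1 ≤ℕ m → ΛD m ≤ ι 6 * ι y * (Λ m * recip m)
          term m 1≤m = ≤-trans (*-monoʳ-0≤ (0≤Λ 1≤m) (lin 4 (λ v u q b → 1 · con 0 :≤ u ∷ 1 · v :≤ con 6 :* q ∷ 6 · q
              :≤ b ∷ [] ⊢ 1 · v :- u :≤ con 6 :* b) _ _ _ _ (0≤ψ (x ÷ m)) (ψ≤ (y ÷ m) (ℕₚ.≤-trans (÷≤ y m) y≤X))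
              (ι÷≤ y 1≤m)))
            (≡⇒≤ (ring 3 (λ l y r → l :* (con 6 :* (y :* r)) := con 6 :* y :* (l :* r)) _ _ _))
          4U : ℕ
          4U = 4 *ℕ U
          1≤4U : 1 ≤ℕ 4U
          1≤4U = 1≤* {4} (s≤s z≤n) 1≤U
          4UN≤X : 4U *ℕ N ≤ℕ X
          4UN≤X = ℕₚ.≤-trans (ℕₚ.≤-reflexive (trans (ℕₚ.*-assoc 4 U N) (cong (4 *ℕ_) (ℕₚ.*-comm U N))))
              (ℕₚ.≤-trans (ℕₚ.*-monoʳ-≤ 4 (÷*≤ x U)) 4x≤X)
          y≤4UN : y ≤ℕ 4U *ℕ N
          y≤4UN = ι-cancel (lin 6 (λ y x U N uu p → 1 · con 2 :* y :≤ con 3 :* x ∷ 3 · x :≤ N :* U :+ U ∷ 2 −· p := uu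
              :* N ∷ 2 −· uu :* N := con 4 :* U :* N ∷ 3 · U :* con 1 :≤ U :* N ∷ 2 · con 0 :≤ U :* N ∷ [] ⊢ 2 · y :≤
              p) _ _ _ _ _ _
            ιy≤ (÷-lower x 1≤U) (ι-* 4U N) (cong (_* ι N) (ι-* 4 U)) (*-monoʳ-0≤ (0≤ι U) (ι-mono 1≤N))
                (*-nonneg (0≤ι U) (0≤ι N)))
          mass : M y - M N ≤ ι 4 * ι U + ι 7
          mass = lin 8 (λ my mN ly lN lu luN U uu → 1 · my :≤ ly :+ con 6 ∷ 1 · lN :- con 1 :≤ mN ∷ 1 · ly :≤ luN ∷ 1
              · luN := lu :+ lN ∷ 1 · lu :≤ uu ∷ 1 · uu := con 4 :* U ∷ [] ⊢ 1 · my :- mN :≤ con 4 :* U :+ con 7) _ _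
              _ _ _ _ _ _
            (M≤ (ℕₚ.≤-trans 1≤x x≤y) y≤X) (≤M 1≤N (ℕₚ.≤-trans N≤x x≤X)) (ℓ-mono (ℕₚ.≤-trans 1≤x x≤y) y≤4UN 4UN≤X)
                (ℓ-* 4U N 1≤4U 1≤N) (ℓ≤ 1≤4U (ℕₚ.≤-trans (ℕₚ.*-monoʳ-≤ 4 U≤x) 4x≤X)) (ι-* 4 U)

      -- Selberg's lower bound for Σ Λ(m) D(m) nearly exhausts the maximum 2 (y - x) M(N). Of the
      -- coefficient 4 of ℓ x, three come from the shift in `excess` and one from the mass that (x,
      -- y] may still have.
      Bad-total : e * Bad N ≤ ι 40 * a * (ι 168 * e + ι 18 + ι 48 * e * ι U + ι 4 * ℓ x)
      Bad-total = *-cancel-≤ (ι-mono 1≤x) (≤-trans (≡⇒≤ (trans (ring 3 (λ x e b → x :* (e :* b) := e :* x :* b) _ _ _)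
          (sym (∑-* N _ _))))
        (≤-trans (∑-mono N λ m 1≤m m≤N → ≤-trans (≡⇒≤ (ring 3 (λ c b l → c :* (b :* l) := l :* (c :* b)) _ _ _))
            (≤-trans (*-monoʳ-0≤ (*-nonneg (0≤Λ 1≤m) (0≤recip m)) (bad≤excess m 1≤m m≤N))
            (≡⇒≤ (ring 3 (λ l a q → l :* (a :* q) := a :* (l :* q)) _ _ _))))
        (≤-trans (≡⇒≤ (trans (∑-* N _ _) (cong (ι 40 * a *_) ∑excess)))
        (≤-trans (*-monoʳ-0≤ (*-nonneg (0≤ι 40) 0≤a) total) (≡⇒≤ (ring 3 (λ a x c → con 40 :* a :* (x :* c) := x :*
            (con 40 :* a :* c)) _ _ _))))))
        where
        MN≤ : M N ≤ ℓ x + ι 6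
        MN≤ = ≤-trans (M-mono N≤x) (M≤ 1≤x x≤X)
        total : (ι 2 * e * (ι y - ι x) + ι 3 * ι x) * M N - e * ∑ N ΛD ≤ ι x * (ι 168 * e + ι 18 + ι 48 * e * ι U + ι
            4 * ℓ x)
        total = lin 9 (λ e x y U l m s S r → 2 · e :* (y :- x) :* m :≤ e :* (y :- x) :* (l :+ con 6) ∷ 3 · x :* m :≤ x
            :* (l :+ con 6) ∷ 1 · e :* (con 2 :* ((y :- x) :* l) :- con 72 :* x) :≤ e :* (r :* l :+ S) ∷ 1 · e :*
            (S :- s) :≤ e :* (con 12 :* x :* (con 4 :* U :+ con 7)) ∷ 1 · l :* (e :* r) :≤ l :* x ∷ 12 · e :* y :≤ e
            :* (con 2 :* x) ∷ [] ⊢ 1 · (con 2 :* e :* (y :- x) :+ con 3 :* x) :* m :- e :* s :≤ x :* (con 168 :* e :+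
            con 18 :+ con 48 :* e :* U :+ con 4 :* l)) _ _ _ _ _ _ _ _ _
          (*-monoʳ-0≤ (*-nonneg 0≤e (≤⇒0≤ (ι-mono x≤y))) MN≤) (*-monoʳ-0≤ (0≤ι x) MN≤) (*-monoʳ-0≤ 0≤e
              (selberg-gap-≥ 1≤x x≤y y≤2x y≤X)) (*-monoʳ-0≤ 0≤e tail)
          (*-monoʳ-0≤ (0≤ℓ x 1≤x) no-mass) (*-monoʳ-0≤ 0≤e (≤-trans (ι-mono y≤2x) (≡⇒≤ (ι-* 2 x))))

  ℓ-^ : ∀ {K} n → 1 ≤ℕ K → ℓ (K ℕ.^ n) ≡ ι n * ℓ K
  ℓ-^ zero _ = trans ℓ1 (sym (*-zeroˡ _))
  ℓ-^ {K} (suc n) 1≤K = trans (ℓ-* K (K ℕ.^ n) 1≤K (1≤^ n 1≤K)) (trans (cong (ℓ K +_) (ℓ-^ n 1≤K))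
    (trans (ring 2 (λ n l → l :+ n :* l := (con 1 :+ n) :* l) _ _) (cong (_* ℓ K) (sym (ι-suc n)))))

  module _ {g x y K₁ K₂ E c L : ℕ} (8≤g : 8 ≤ℕ g) (gx≤gy : (g +ℕ 3) *ℕ x ≤ℕ g *ℕ y) (2y≤3x : 2 *ℕ y ≤ℕ 3 *ℕ x)
      (y≤X : y ≤ℕ X)
    (1≤K₁ : 1 ≤ℕ K₁) (1≤K₂ : 1 ≤ℕ K₂) (8≤ℓK₁ : ι 8 ≤ ℓ K₁) (15≤ℓK₂ : ι 15 ≤ ℓ K₂) where
    private
      K U n : ℕ
      K = 2 *ℕ (K₂ *ℕ K₁)
      U = K ℕ.^ c
      -- As x is about Kⁿ, dropping c powers of K at either end leaves L windows on which both m and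
      -- x/m are at least U.
      n = c +ℕ (2 +ℕ L +ℕ c)

      1≤g : 1 ≤ℕ g
      1≤g = ℕₚ.≤-trans (s≤s z≤n) 8≤g
      2≤K : 2 ≤ℕ K
      2≤K = ℕₚ.*-monoʳ-≤ 2 (1≤* 1≤K₂ 1≤K₁)
      1≤K : 1 ≤ℕ K
      1≤K = ℕₚ.≤-trans (s≤s z≤n) 2≤K
      instance
        K-nonZero : NonZero K
        K-nonZero = ℕ.>-nonZero 1≤K

    module _ (ι-E : ι E ≡ ι 7680 * (ι g * ι g * ι K)) (80g≤E : 80 *ℕ g ≤ℕ E) (72E≤c : 72 *ℕ E ≤ℕ c) (L-large : ι 168 *
        ι E + ι 18 + ι 48 * ι E * ι U + ι 4 * (ι K * (ι 2 * ι c + ι 3)) + ι 1 ≤ ι L)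
      (Kⁿ≤x : K ℕ.^ n ≤ℕ x) (x≤Kⁿ⁺¹ : x ≤ℕ K ℕ.^ suc n) (4x≤X : 4 *ℕ x ≤ℕ X) (Kx≤X : K *ℕ x ≤ℕ X) (no-mass : ι E *
          (ψ y - ψ x) ≤ ι x) where
      private
        1≤x : 1 ≤ℕ x
        1≤x = ℕₚ.≤-trans (1≤^ n 1≤K) Kⁿ≤x
        x≤X : x ≤ℕ X
        x≤X = ℕₚ.≤-trans (ℕₚ.m≤m+n x _) 4x≤X
        c≤U : c ≤ℕ U
        c≤U = ℕₚ.≤-trans (ℕₚ.n≤1+n c) (suc≤^ c 2≤K)
        E≤U : E ≤ℕ U
        E≤U = ℕₚ.≤-trans (ℕₚ.m≤n*m E 72) (ℕₚ.≤-trans 72E≤c c≤U)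
        40g≤E : 40 *ℕ g ≤ℕ E
        40g≤E = ℕₚ.≤-trans (ℕₚ.*-monoˡ-≤ g (ℕₚ.m≤m+n 40 40)) 80g≤E
        K≤X : K ≤ℕ X
        K≤X = ℕₚ.≤-trans (ℕₚ.m≤m*n K x {{ℕ.>-nonZero 1≤x}}) Kx≤X
        1≤ℓK : ι 1 ≤ ℓ K
        1≤ℓK = ≤-trans (≤-trans (ι-mono (s≤s z≤n)) 8≤ℓK₁) (ℓ-mono 1≤K₁
            (ℕₚ.≤-trans (ℕₚ.m≤n*m K₁ K₂ {{ℕ.>-nonZero 1≤K₂}}) (ℕₚ.m≤m+n _ _)) K≤X)
        U-large : ∀ p → U ≤ℕ p → p ≤ℕ X → ι 72 * ι E ≤ ℓ p
        U-large p U≤p p≤X = ≤-trans (ι-*-mono {72} {E} 72E≤c) (≤-trans (lin 2 (λ c l → 1 · c :* con 1 :≤ c :* l ∷ [] ⊢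
            1 · c :≤ c :* l) _ _ (*-monoʳ-0≤ (0≤ι c) 1≤ℓK))
          (≤-trans (≡⇒≤ (sym (ℓ-^ c 1≤K))) (ℓ-mono (1≤^ c 1≤K) U≤p p≤X)))

        open Deduction {g} {x} {y} {E} {U} 8≤g 1≤x gx≤gy 2y≤3x y≤X (ℕₚ.≤-trans 80g≤E E≤U) 40g≤E E≤U U-large

        -- w i is the bad mass of the i-th window together with that of its reflection. Direct
        -- windows are disjoint; the dual ones span two powers of K and overlap, so each dual point
        -- counts at most twice, which makes the total at most three times `Bad`.
        direct dual w : ℕ → ℚ
        direct i = Bad (K ℕ.^ (i +ℕ c))
        dual i = Bad (x ÷ K ℕ.^ (i +ℕ c))
        w i = (direct (2 +ℕ i) - direct (1 +ℕ i)) + (dual i - dual (2 +ℕ i))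

        0≤Bad : ∀ t → ι 0 ≤ Bad t
        0≤Bad t = ∑-nonneg t λ k 1≤k _ → *-nonneg (0≤bad k) (*-nonneg (0≤Λ 1≤k) (0≤recip k))

        ^-mono : ∀ {i j} → i ≤ℕ j → K ℕ.^ i ≤ℕ K ℕ.^ j
        ^-mono = ℕₚ.^-monoʳ-≤ K

        dual-anti : ∀ {i j} → i ≤ℕ j → dual j ≤ dual i
        dual-anti {i} {j} i≤j = Bad-mono (÷-anti x (1≤^ (i +ℕ c) 1≤K) (^-mono (ℕₚ.+-monoˡ-≤ c i≤j)))

        dual-telescope : ∀ l → ∑ l (λ i → dual i - dual (2 +ℕ i)) ≡ dual 1 + dual 2 - (dual (1 +ℕ l) + dual (2 +ℕ l))
        dual-telescope zero = sym (-‿inverseʳ _)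
        dual-telescope (suc l) = trans (cong (_+ (dual (suc l) - dual (3 +ℕ l))) (dual-telescope l))
            (ring 5 (λ a b c d e → a :+ b :- (c :+ d) :+ (c :- e) := a :+ b :- (d :+ e)) _ _ _ _ _)

        below-top : ∀ {i} → i ≤ℕ L → K ℕ.^ (2 +ℕ i +ℕ c) *ℕ U ≤ℕ x
        below-top {i} i≤L = ℕₚ.≤-trans (ℕₚ.≤-reflexive (trans (ℕₚ.*-comm _ U) (sym (ℕₚ.^-distribˡ-+-* K c (2 +ℕ i +ℕ c)))))
          (ℕₚ.≤-trans (^-mono (ℕₚ.+-monoʳ-≤ c (ℕₚ.+-monoˡ-≤ c (ℕₚ.+-monoʳ-≤ 2 i≤L)))) Kⁿ≤x)

        1≤U : 1 ≤ℕ U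
        1≤U = 1≤^ c 1≤K

        U≤x : U ≤ℕ x
        U≤x = ℕₚ.≤-trans (ℕₚ.m≤n*m U _ {{ℕ.>-nonZero (1≤^ (2 +ℕ L +ℕ c) 1≤K)}}) (below-top {L} ℕₚ.≤-refl)

        ∑w≤ : ∑ L w ≤ ι 3 * Bad (x ÷ U)
        ∑w≤ = ≤-trans (≡⇒≤ (trans (∑-+ L _ _) (cong₂ _+_ (∑-telescope L (direct ∘ suc)) (dual-telescope L))))
          (lin 7 (λ b h h2 f1 f2 f3 f4 → 1 · h :≤ b ∷ 1 · con 0 :≤ h2 ∷ 1 · f1 :≤ b ∷ 1 · f2 :≤ b ∷ 1 · con 0 :≤ f3 ∷
              1 · con 0 :≤ f4 ∷ [] ⊢ 1 · (h :- h2) :+ (f1 :+ f2 :- (f3 :+ f4)) :≤ con 3 :* b) _ _ _ _ _ _ _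
            (Bad-mono {K ℕ.^ (2 +ℕ L +ℕ c)} {x ÷ U} (*≤⇒≤÷ 1≤U (below-top {L} ℕₚ.≤-refl))) (0≤Bad (K ℕ.^ (2 +ℕ c)))
                (dual-anti {0} {1} z≤n) (dual-anti {0} {2} z≤n)
            (0≤Bad (x ÷ K ℕ.^ (1 +ℕ L +ℕ c))) (0≤Bad (x ÷ K ℕ.^ (2 +ℕ L +ℕ c))))

        ℓx≤ : ℓ x ≤ (ι 2 * ι c + ι 3 + ι L) * ι K
        ℓx≤ = ≤-trans (ℓ-mono 1≤x x≤Kⁿ⁺¹ (ℕₚ.≤-trans (ℕₚ.*-monoʳ-≤ K Kⁿ≤x) Kx≤X)) (≤-trans (≡⇒≤ (ℓ-^ (suc n) 1≤K))
          (*-mono-0≤ (0≤ι (suc n)) (≡⇒≤ ι-n) (≤-trans (0≤ι 1) 1≤ℓK) (ℓ≤ 1≤K K≤X)))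
          where
          ι-n : ι (suc n) ≡ ι 2 * ι c + ι 3 + ι L
          ι-n = trans (ι-suc n) (trans (cong (ι 1 +_) (trans (ι-+ c _) (cong (ι c +_) (trans (ι-+ (2 +ℕ L) c)
              (cong (_+ ι c) (ι-+ 2 L)))))) (ring 2 (λ c l → con 1 :+ (c :+ (con 2 :+ l :+ c)) := con 2 :* c :+ con 3
              :+ l) _ _))

      -- If no window were sparse, then L ≤ 24 g Bad ≤ (960 g²/E)(C + 4 ℓ x), with C the constant
      -- part of `Bad-total`. The choice E = 960 g² · 8 K turns this into 8 K L ≤ C + 4 K (2c + 3 +
      -- L), which fails for the large L assumed.
      some-mass : ⊥
      some-mass with pigeonhole L (ι 8 * ι g) w
      ... | inj₁ (i , 1≤i , i≤L , few) = sparse-window-absurd 1≤K₁ 1≤K₂ 8≤ℓK₁ 15≤ℓK₂ {K ℕ.^ (i +ℕ c)}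
          (^-mono (ℕₚ.m≤n+m c i))
          (*≤⇒≤÷ (1≤^ (2 +ℕ i +ℕ c) 1≤K) (ℕₚ.≤-trans (ℕₚ.≤-reflexive (ℕₚ.*-comm U _)) (below-top i≤L)))
          (lin 3 (λ a p q → 1 · con 8 :* a :* (p :+ q) :≤ con 1 ∷ 8 · con 0 :≤ a :* q ∷ [] ⊢ 1 · con 8 :* a :* p :≤
              con 1) _ _ _ few (*-nonneg (0≤ι g) 0≤q))
          (lin 3 (λ a p q → 1 · con 8 :* a :* (p :+ q) :≤ con 1 ∷ 8 · con 0 :≤ a :* p ∷ [] ⊢ 1 · con 8 :* a :* q :≤
              con 1) _ _ _ few (*-nonneg (0≤ι g) 0≤p))
        where
        0≤p : ι 0 ≤ direct (2 +ℕ i) - direct (1 +ℕ i)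
        0≤p = ≤⇒0≤ (Bad-mono (^-mono {1 +ℕ i +ℕ c} {2 +ℕ i +ℕ c} (ℕₚ.n≤1+n _)))
        0≤q : ι 0 ≤ dual i - dual (2 +ℕ i)
        0≤q = ≤⇒0≤ (dual-anti (ℕₚ.m≤n+m i 2))
      ... | inj₂ many = ℕₚ.1+n≰n (ι-cancel {1} {0} (lin 5 (λ K C c L KL → 1 · con 8 :* KL :≤ C :+ con 4 :*
          (K :* (con 2 :* c :+ con 3)) :+ con 4 :* KL ∷ 1 · C :+ con 4 :* (K :* (con 2 :* c :+ con 3)) :+ con 1 :≤ L ∷
          1 · L :≤ KL ∷ 3 · con 0 :≤ KL ∷ [] ⊢ 1 · con 1 :≤ con 0) _ _ _ _ (ι K * ι L)
          reduced L-large (lin 2 (λ K L → 1 · con 0 :≤ (K :- con 1) :* L ∷ [] ⊢ 1 · L :≤ K :* L) _ _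
              (*-nonneg (≤⇒0≤ (ι-mono 1≤K)) (0≤ι L))) (*-nonneg (0≤ι K) (0≤ι L))))
        where
        a² : ℚ
        a² = ι 960 * (ι g * ι g)
        1≤a² : ι 1 ≤ a²
        1≤a² = ≤-trans (ι-mono (1≤* {960} (s≤s z≤n) (1≤* 1≤g 1≤g))) (≡⇒≤ (trans (ι-* 960 _) (cong (ι 960 *_) (ι-* g g))))
        0≤a² : ι 0 ≤ a²
        0≤a² = ≤-trans (0≤ι 1) 1≤a²
        reduced : ι 8 * (ι K * ι L) ≤ ι 168 * ι E + ι 18 + ι 48 * ι E * ι U + ι 4 * (ι K * (ι 2 * ι c + ι 3)) + ι 4 *
            (ι K * ι L)
        reduced = *-cancel-≤ 1≤a² (lin 9 (λ a K L e C c B s l → 1 −· L :* e := L :* (con 7680 :* (a :* a :* K)) ∷ 1 ·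
            e :* L :≤ e :* (con 8 :* a :* s) ∷ 8 · (e :* a) :* s :≤ (e :* a) :* (con 3 :* B) ∷ 24 · a :* (e :* B) :≤ a
            :* (con 40 :* a :* (C :+ con 4 :* l)) ∷ 4 · con 960 :* (a :* a) :* l :≤ con 960 :* (a :* a) :*
            ((con 2 :* c :+ con 3 :+ L) :* K) ∷ [] ⊢ 1 · con 960 :* (a :* a) :* (con 8 :* (K :* L)) :≤ con 960 :*
            (a :* a) :* (C :+ con 4 :* (K :* (con 2 :* c :+ con 3)) :+ con 4 :* (K :* L))) (ι g) _ _ (ι E) _ _ _ _ _
          (cong (ι L *_) ι-E) (*-monoʳ-0≤ (0≤ι E) many) (*-monoʳ-0≤ (*-nonneg (0≤ι E) (0≤ι g)) ∑w≤)
              (*-monoʳ-0≤ (0≤ι g) (Bad-total 4x≤X U≤x no-mass)) (*-monoʳ-0≤ 0≤a² ℓx≤))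

-- Proper prime powers

module PrimePowers (X : ℕ) (ℓ : ℕ → ℚ) (ℓ-* : ∀ a b → 1 ≤ℕ a → 1 ≤ℕ b → ℓ (a *ℕ b) ≡ ℓ a + ℓ b) (0≤ℓ : ∀ n → 1 ≤ℕ n →
    ι 0 ≤ ℓ n)
  (ℓ-lower : ∀ n → 1 ≤ℕ n → n <ℕ X → recip (suc n) ≤ ℓ (suc n) - ℓ n) (ℓ-upper : ∀ n → 1 ≤ℕ n → n <ℕ X → ℓ (suc n) - ℓ
      n ≤ recip n) where

  open Mangoldt ℓ ℓ-* 0≤ℓ
  open Estimates X ℓ ℓ-* 0≤ℓ ℓ-lower ℓ-upper

  firstFactor : ℕ → ℕ
  firstFactor a with fac a
  ... | [] = 1
  ... | p ∷ _ = p

  prime∣prime^ : ∀ {h p} k → Prime h → Prime p → h ∣ p ℕ.^ k → h ≡ p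
  prime∣prime^ zero hr pr d = ⊥-elim (Pr.¬prime[1] (subst Prime (∣ₚ.∣1⇒≡1 d) hr))
  prime∣prime^ {h} {p} (suc k) hr pr d with Pr.euclidsLemma p (p ℕ.^ k) hr d
  ... | inj₂ d′ = prime∣prime^ k hr pr d′
  ... | inj₁ d′ with Pr.prime⇒irreducible pr d′
  ... | inj₁ refl = ⊥-elim (Pr.¬prime[1] hr)
  ... | inj₂ e = e

  firstFactor-^ : ∀ {p} k → Prime p → firstFactor (p ℕ.^ suc k) ≡ p
  firstFactor-^ {p} k pr with fac (p ℕ.^ suc k) | fac-prime (p ℕ.^ suc k) | fac-product {p ℕ.^ suc k} 1≤
    where
    1≤ : 1 ≤ℕ p ℕ.^ suc k
    1≤ = ℕ.>-nonZero⁻¹ _ {{ℕₚ.m^n≢0 p (suc k) {{Pr.prime⇒nonZero pr}}}}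
  ... | [] | _ | e = ⊥-elim (Pr.¬prime[1] (subst Prime (∣ₚ.∣1⇒≡1 (divides (p ℕ.^ k) (trans e (ℕₚ.*-comm p _)))) pr))
  ... | h ∷ hs | hr ∷ _ | e = prime∣prime^ (suc k) hr pr (divides (product hs) (trans (sym e) (ℕₚ.*-comm h _)))

  -- A proper prime power is a² or a² p, where p is determined by a.
  ProperPower : ℕ → Set
  ProperPower n = ∃ λ a → 1 ≤ℕ a × 1 ≤ℕ firstFactor a × (n ≡ a *ℕ a ⊎ n ≡ a *ℕ a *ℕ firstFactor a)

  Λ-support : ∀ {n} → 1 ≤ℕ n → Λ n ≡ ι 0 ⊎ Prime n ⊎ ProperPower n
  Λ-support 1≤n with Λ-cases 1≤n
  ... | inj₁ z = inj₁ z
  ... | inj₂ (p , zero , pr , refl , _) = inj₂ (inj₁ (subst Prime (sym (ℕₚ.*-identityʳ p)) pr))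
  ... | inj₂ (p , suc k , pr , refl , _) = inj₂ (inj₂ (go (halve (suc (suc k)))))
    where
    double : ∀ y → p ℕ.^ (2 *ℕ y) ≡ p ℕ.^ y *ℕ p ℕ.^ y
    double y = trans (cong (λ z → p ℕ.^ (y +ℕ z)) (ℕₚ.+-identityʳ y)) (ℕₚ.^-distribˡ-+-* p y y)
    1≤p^ : ∀ y → 1 ≤ℕ p ℕ.^ y
    1≤p^ y = ℕ.>-nonZero⁻¹ _ {{ℕₚ.m^n≢0 p y {{Pr.prime⇒nonZero pr}}}}
    go : (∃ λ y → suc (suc k) ≡ 2 *ℕ y ⊎ suc (suc k) ≡ suc (2 *ℕ y)) → ProperPower (p ℕ.^ suc (suc k))
    go (zero , inj₁ ())
    go (zero , inj₂ ())
    go (suc y , inj₁ e) = p ℕ.^ suc y , 1≤p^ (suc y) , subst (1 ≤ℕ_) (sym (firstFactor-^ y pr)) (prime≥1 pr) , inj₁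
        (trans (cong (p ℕ.^_) e) (double (suc y)))
    go (suc y , inj₂ e) = p ℕ.^ suc y , 1≤p^ (suc y) , subst (1 ≤ℕ_) (sym (firstFactor-^ y pr)) (prime≥1 pr) ,
      inj₂ (trans (cong (p ℕ.^_) e) (trans (cong (p *ℕ_) (double (suc y))) (trans (ℕₚ.*-comm p _)
          (cong (p ℕ.^ suc y *ℕ p ℕ.^ suc y *ℕ_) (sym (firstFactor-^ y pr))))))

  ∑-ind≤1 : ∀ y c → ∑ y (λ n → ind (n ℕₚ.≟ c)) ≤ ι 1
  ∑-ind≤1 y c = ≤-trans (go y) (ind≤1 (c ℕ.≤? y))
    where
    go : ∀ y → ∑ y (λ n → ind (n ℕₚ.≟ c)) ≤ ind (c ℕ.≤? y)
    go zero = 0≤ind (c ℕ.≤? 0)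
    go (suc y) = by-cases (suc y ℕₚ.≟ c) (c ℕ.≤? y) (go y)
      where
      by-cases : (d : Dec (suc y ≡ c)) (d′ : Dec (c ≤ℕ y)) → ∑ y (λ n → ind (n ℕₚ.≟ c)) ≤ ind d′ → ∑ y
          (λ n → ind (n ℕₚ.≟ c)) + ind d ≤ ind (c ℕ.≤? suc y)
      by-cases (yes refl) (yes le) _ = ⊥-elim (ℕₚ.1+n≰n le)
      by-cases (yes refl) (no _) h = ≤-trans (lin 1 (λ s → 1 · s :≤ con 0 ∷ [] ⊢ 1 · s :+ con 1 :≤ con 1) _ h)
          (≡⇒≤ (sym (ind-yes (suc y ℕ.≤? suc y) ℕₚ.≤-refl)))
      by-cases (no _) (yes le) h = ≤-trans (lin 1 (λ s → 1 · s :≤ con 1 ∷ [] ⊢ 1 · s :+ con 0 :≤ con 1) _ h)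
          (≡⇒≤ (sym (ind-yes (c ℕ.≤? suc y) (ℕₚ.m≤n⇒m≤1+n le))))
      by-cases (no _) (no _) h = ≤-trans (lin 1 (λ s → 1 · s :≤ con 0 ∷ [] ⊢ 1 · s :+ con 0 :≤ con 0) _ h)
          (0≤ind (c ℕ.≤? suc y))

  ∑-single : ∀ n {f : ℕ → ℚ} {a} → (∀ k → ι 0 ≤ f k) → 1 ≤ℕ a → a ≤ℕ n → f a ≤ ∑ n f
  ∑-single n {f} {suc a} 0≤f _ a≤n = ≤-trans (lin 2 (λ s t → 1 · con 0 :≤ s ∷ [] ⊢ 1 · t :≤ s :+ t) _ _
      (∑-nonneg a λ k _ _ → 0≤f k)) (∑-mono-range f a≤n λ k _ _ → 0≤f k)

  module _ {x y : ℕ} (1≤x : 1 ≤ℕ x) (x≤y : x ≤ℕ y) (y≤2x : y ≤ℕ 2 *ℕ x) (8x≤X : 8 *ℕ x ≤ℕ X) (no-prime : ∀ n → x <ℕ n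
      → n ≤ℕ y → ¬ Prime n) where
    private
      s t : ℕ
      s = proj₁ (isqrt y)
      t = proj₁ (isqrt s)

      1≤y : 1 ≤ℕ y
      1≤y = ℕₚ.≤-trans 1≤x x≤y

      s²≤y : s *ℕ s ≤ℕ y
      s²≤y = proj₁ (proj₂ (isqrt y))

      t²≤s : t *ℕ t ≤ℕ s
      t²≤s = proj₁ (proj₂ (isqrt s))

      count : ℕ → ℕ → ℚ
      count n a = ind (n ℕₚ.≟ a *ℕ a) + ind (n ℕₚ.≟ a *ℕ a *ℕ firstFactor a)

      0≤count : ∀ n a → ι 0 ≤ count n a
      0≤count n a = ≤-trans (≡⇒≤ (sym (+-identityˡ _))) (+-mono-≤ (0≤ind (n ℕₚ.≟ a *ℕ a))
          (0≤ind (n ℕₚ.≟ a *ℕ a *ℕ firstFactor a)))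

      y≤X : y ≤ℕ X
      y≤X = ℕₚ.≤-trans y≤2x (ℕₚ.≤-trans (ℕₚ.*-monoˡ-≤ x (ℕₚ.m≤m+n 2 6)) 8x≤X)

      1≤count : ∀ {n} → n ≤ℕ y → ProperPower n → ι 1 ≤ ∑ s (count n)
      1≤count {n} n≤y (a , 1≤a , 1≤q , e) = ≤-trans (unit e) (∑-single s (0≤count n) 1≤a a≤s)
        where
        a²≤n : n ≡ a *ℕ a ⊎ n ≡ a *ℕ a *ℕ firstFactor a → a *ℕ a ≤ℕ n
        a²≤n (inj₁ refl) = ℕₚ.≤-refl
        a²≤n (inj₂ refl) = ℕₚ.m≤m*n (a *ℕ a) (firstFactor a) {{ℕ.>-nonZero 1≤q}}
        a≤s : a ≤ℕ s
        a≤s = ℕ.s≤s⁻¹ (ℕₚ.≰⇒> λ ss≤a → ℕₚ.<⇒≱ (proj₂ (proj₂ (isqrt y))) (ℕₚ.≤-trans (square-mono ss≤a)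
            (ℕₚ.≤-trans (a²≤n e) n≤y)))
        unit : n ≡ a *ℕ a ⊎ n ≡ a *ℕ a *ℕ firstFactor a → ι 1 ≤ count n a
        unit (inj₁ h) = lin 2 (λ u v → 1 −· u := con 1 ∷ 1 · con 0 :≤ v ∷ [] ⊢ 1 · con 1 :≤ u :+ v) _ _
            (ind-yes (n ℕₚ.≟ a *ℕ a) h) (0≤ind (n ℕₚ.≟ a *ℕ a *ℕ firstFactor a))
        unit (inj₂ h) = lin 2 (λ u v → 1 −· v := con 1 ∷ 1 · con 0 :≤ u ∷ [] ⊢ 1 · con 1 :≤ u :+ v) _ _
            (ind-yes (n ℕₚ.≟ a *ℕ a *ℕ firstFactor a) h) (0≤ind (n ℕₚ.≟ a *ℕ a))

      -- Each a ≤ √y accounts for at most two proper prime powers, and each of these has Λ ≤ ℓ y.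
      ψ-gap≤ : ψ y - ψ x ≤ ℓ y * (ι 2 * ι s)
      ψ-gap≤ = ≤-trans (∑-range-≤ Λ (λ n → ℓ y * ∑ s (count n)) x≤y pointwise)
        (≤-trans (lin 2 (λ a b → 1 · con 0 :≤ b ∷ [] ⊢ 1 · a :- b :≤ a) _ _ (∑-nonneg x λ n 1≤n n≤x → *-nonneg
            (0≤ℓ y (ℕₚ.≤-trans 1≤n (ℕₚ.≤-trans n≤x x≤y))) (∑-nonneg s λ a _ _ → 0≤count n a)))
        (≤-trans (≡⇒≤ (trans (∑-* y _ _) (cong (ℓ y *_) (∑-swap y s count)))) total))
        where
        pointwise : ∀ n → x <ℕ n → n ≤ℕ y → Λ n ≤ ℓ y * ∑ s (count n)
        pointwise n x<n n≤y = go (Λ-support 1≤n)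
          where
          1≤n : 1 ≤ℕ n
          1≤n = ℕₚ.≤-trans (s≤s z≤n) x<n
          0≤ℓy : ι 0 ≤ ℓ y
          0≤ℓy = 0≤ℓ y (ℕₚ.≤-trans 1≤n n≤y)
          go : Λ n ≡ ι 0 ⊎ Prime n ⊎ ProperPower n → Λ n ≤ ℓ y * ∑ s (count n)
          go (inj₁ z) = ≤-trans (≡⇒≤ z) (*-nonneg 0≤ℓy (∑-nonneg s λ a _ _ → 0≤count n a))
          go (inj₂ (inj₁ pr)) = ⊥-elim (no-prime n x<n n≤y pr)
          go (inj₂ (inj₂ pp)) = lin 4 (λ v l L c → 1 · v :≤ l ∷ 1 · l :≤ L ∷ 1 · L :* con 1 :≤ L :* c ∷ [] ⊢ 1 · v :≤
              L :* c) _ _ _ _ (Λ≤ℓ 1≤n) (ℓ-mono 1≤n n≤y y≤X) (*-monoʳ-0≤ 0≤ℓy (1≤count n≤y pp))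
        inner : ∑ s (λ a → ∑ y (λ n → count n a)) ≤ ι 2 * ι s
        inner = ≤-trans (∑-mono s λ a _ _ → ≤-trans (≡⇒≤ (∑-+ y _ _)) (+-mono-≤ (∑-ind≤1 y (a *ℕ a))
            (∑-ind≤1 y (a *ℕ a *ℕ firstFactor a))))
          (≡⇒≤ (trans (∑-const s _) (ring 1 (λ s → s :* (con 1 :+ con 1) := con 2 :* s) _)))
        total : ℓ y * ∑ s (λ a → ∑ y (λ n → count n a)) ≤ ℓ y * (ι 2 * ι s)
        total = *-monoʳ-0≤ (0≤ℓ y 1≤y) inner

    -- With t about the fourth root of y, ℓ y ≤ 4 ℓ (t + 1) ≤ 8 t. So the gap is at most 16 s t, and
    -- 32 E ≤ t turns E times this into at most s t²/2 ≤ y/2 ≤ x.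
    no-prime⇒no-mass : ∀ E → 1 ≤ℕ E → (32 *ℕ E) *ℕ (32 *ℕ E) *ℕ ((32 *ℕ E) *ℕ (32 *ℕ E)) ≤ℕ x → ι E * (ψ y - ψ x) ≤ ι x
    no-prime⇒no-mass E 1≤E large = lin 7 (λ e d l t s y x → 2 · e :* d :≤ e :* (l :* (con 2 :* s)) ∷ 2 ·
        (con 2 :* (e :* s)) :* l :≤ (con 2 :* (e :* s)) :* (con 8 :* t) ∷ 1 · (s :* t) :* (con 32 :* e) :≤ (s :* t) :*
        t ∷ 1 · s :* (t :* t) :≤ s :* s ∷ 1 · s :* s :≤ y ∷ 1 · y :≤ con 2 :* x ∷ [] ⊢ 2 · e :* d :≤ x) _ _ _ _ _ _ _
      (*-monoʳ-0≤ (0≤ι E) ψ-gap≤) (*-monoʳ-0≤ (*-nonneg (0≤ι 2) (*-nonneg (0≤ι E) (0≤ι s))) ℓy≤8t)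
          (*-monoʳ-0≤ (*-nonneg (0≤ι s) (0≤ι t)) (≤-trans (≡⇒≤ (sym (ι-* 32 E))) (ι-mono 32E≤t)))
      (*-monoʳ-0≤ (0≤ι s) (≤-trans (≡⇒≤ (sym (ι-* t t))) (ι-mono t²≤s))) (≤-trans (≡⇒≤ (sym (ι-* s s))) (ι-mono s²≤y))
          (≤-trans (ι-mono y≤2x) (≡⇒≤ (ι-* 2 x)))
      where
      B : ℕ
      B = 32 *ℕ E
      32E≤t : B ≤ℕ t
      32E≤t = ℕₚ.≮⇒≥ λ t<B → ℕₚ.<⇒≱ (proj₂ (proj₂ (isqrt y)))
        (ℕₚ.≤-trans (square-mono (ℕₚ.≤-trans (proj₂ (proj₂ (isqrt s))) (square-mono t<B))) (ℕₚ.≤-trans large x≤y))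
      1≤t : 1 ≤ℕ t
      1≤t = ℕₚ.≤-trans (1≤* {32} (s≤s z≤n) 1≤E) 32E≤t
      1≤s : 1 ≤ℕ s
      1≤s = ℕₚ.≤-trans (1≤* 1≤t 1≤t) t²≤s
      ι-square : ∀ k {b} → 1 ≤ℕ k → k *ℕ k ≤ℕ b → ι (suc k *ℕ suc k) ≤ ι 4 * ι b
      ι-square k {b} 1≤k le = ≤-trans (≡⇒≤ (trans (ι-* (suc k) (suc k)) (cong₂ _*_ (ι-suc k) (ι-suc k))))
        (lin 2 (λ k b → 4 · k :* k :≤ b ∷ 3 · k :* con 1 :≤ k :* k ∷ 1 · con 1 :≤ k ∷ [] ⊢ 1 · (con 1 :+ k) :*
            (con 1 :+ k) :≤ con 4 :* b) _ _ (≤-trans (≡⇒≤ (sym (ι-* k k))) (ι-mono le)) (*-monoʳ-0≤ (0≤ι k)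
            (ι-mono 1≤k)) (ι-mono 1≤k))
      4y≤X : ι 4 * ι y ≤ ι X
      4y≤X = lin 3 (λ x y X → 4 · y :≤ con 2 :* x ∷ 1 · con 8 :* x :≤ X ∷ [] ⊢ 1 · con 4 :* y :≤ X) _ _ _
          (≤-trans (ι-mono y≤2x) (≡⇒≤ (ι-* 2 x))) (≤-trans (≡⇒≤ (sym (ι-* 8 x))) (ι-mono 8x≤X))
      s≤y : s ≤ℕ y
      s≤y = ℕₚ.≤-trans (ℕₚ.m≤m*n s s {{ℕ.>-nonZero 1≤s}}) s²≤y
      ss≤X : suc s *ℕ suc s ≤ℕ X
      ss≤X = ι-cancel (≤-trans (ι-square s 1≤s s²≤y) 4y≤X)
      tt≤X : suc t *ℕ suc t ≤ℕ X
      tt≤X = ι-cancel (≤-trans (ι-square t 1≤t t²≤s) (≤-trans (*-monoʳ-0≤ (0≤ι 4) (ι-mono s≤y)) 4y≤X))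
      st≤X : suc t ≤ℕ X
      st≤X = ℕₚ.≤-trans (ℕₚ.m≤m*n (suc t) (suc t)) tt≤X
      ℓy≤8t : ℓ y ≤ ι 8 * ι t
      ℓy≤8t = lin 7 (λ ly lss ls ltt lt st t → 1 · ly :≤ lss ∷ 1 · lss := ls :+ ls ∷ 2 · ls :≤ ltt ∷ 2 · ltt := lt :+
          lt ∷ 4 · lt :≤ st ∷ 4 · st := con 1 :+ t ∷ 4 · con 1 :≤ t ∷ [] ⊢ 1 · ly :≤ con 8 :* t) _ _ _ _ _ _ _
        (ℓ-mono 1≤y (ℕₚ.<⇒≤ (proj₂ (proj₂ (isqrt y)))) ss≤X) (ℓ-* (suc s) (suc s) (s≤s z≤n) (s≤s z≤n))
            (ℓ-mono (s≤s z≤n) (proj₂ (proj₂ (isqrt s))) tt≤X)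
        (ℓ-* (suc t) (suc t) (s≤s z≤n) (s≤s z≤n)) (ℓ≤ (s≤s z≤n) st≤X) (ι-suc t) (ι-mono 1≤t)

-- Choice of constants and existence of primes

search-prime : ∀ x y → (∃ λ p → Prime p × x <ℕ p × p ≤ℕ y) ⊎ (∀ n → x <ℕ n → n ≤ℕ y → ¬ Prime n)
search-prime x zero = inj₂ λ n x<n n≤0 _ → ℕₚ.n≮0 (ℕₚ.<-≤-trans x<n n≤0)
search-prime x (suc y) with search-prime x y
... | inj₁ (p , pr , x<p , p≤y) = inj₁ (p , pr , x<p , ℕₚ.m≤n⇒m≤1+n p≤y)
... | inj₂ none with x ℕ.<? suc y | prime? (suc y)
... | yes x<sy | yes pr = inj₁ (suc y , pr , x<sy , ℕₚ.≤-refl)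
... | no x≮sy | _ = inj₂ λ n x<n n≤sy _ → x≮sy (ℕₚ.<-≤-trans x<n n≤sy)
... | yes _ | no ¬pr = inj₂ λ n x<n n≤sy pr → [ (λ n<sy → none n x<n (ℕ.s≤s⁻¹ n<sy) pr) , (λ { refl → ¬pr pr }) ]′
    (ℕₚ.m≤n⇒m<n∨m≡n n≤sy)

powers-bracket : ∀ {K} → 2 ≤ℕ K → ∀ x → 1 ≤ℕ x → ∃ λ n → K ℕ.^ n ≤ℕ x × x <ℕ K ℕ.^ suc n
powers-bracket {K} 2≤K (suc zero) _ = 0 , s≤s z≤n , ℕₚ.≤-trans 2≤K (ℕₚ.≤-reflexive (sym (ℕₚ.*-identityʳ K)))
powers-bracket {K} 2≤K (suc x@(suc _)) _ with powers-bracket 2≤K x (s≤s z≤n)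
... | n , l , u with K ℕ.^ suc n ℕ.≤? suc x
... | yes le = suc n , le , ℕₚ.≤-<-trans u (ℕₚ.^-monoʳ-< K 2≤K (ℕₚ.n<1+n (suc n)))
... | no ≰ = n , ℕₚ.m≤n⇒m≤1+n l , ℕₚ.≰⇒> ≰

PrimeBetween : ℕ → ℕ → Set
PrimeBetween x y = ∃ λ p → Prime p × x <ℕ p × p ≤ℕ y

PrimeGaps : ℕ → Set
PrimeGaps g = ∃ λ x₀ → ∀ x y → x₀ ≤ℕ x → (g +ℕ 3) *ℕ x ≤ℕ g *ℕ y → 2 *ℕ y ≤ℕ 3 *ℕ x → PrimeBetween x y

-- The constants are passed as variables so that these large numbers are never evaluated.
module GapConstants {g : ℕ} (8≤g : 8 ≤ℕ g) {k₁ k₂ : ℕ} (16≤k₁ : 16 ≤ℕ k₁) (30≤k₂ : 30 ≤ℕ k₂) where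
  private
    K₁ K₂ K : ℕ
    K₁ = 2 ℕ.^ k₁
    K₂ = 2 ℕ.^ k₂
    K = 2 *ℕ (K₂ *ℕ K₁)
    1≤K₁ : 1 ≤ℕ K₁
    1≤K₁ = 1≤^ k₁ (s≤s z≤n)
    1≤K₂ : 1 ≤ℕ K₂
    1≤K₂ = 1≤^ k₂ (s≤s z≤n)
    2≤K : 2 ≤ℕ K
    2≤K = ℕₚ.*-monoʳ-≤ 2 (1≤* 1≤K₂ 1≤K₁)
    1≤K : 1 ≤ℕ K
    1≤K = ℕₚ.≤-trans (s≤s z≤n) 2≤K
    instance
      K-nonZero : NonZero K
      K-nonZero = ℕ.>-nonZero 1≤K

  module _ {E c L₀ : ℕ} (ι-E : ι E ≡ ι 7680 * (ι g * ι g * ι K)) (80g≤E : 80 *ℕ g ≤ℕ E) (72E≤c : 72 *ℕ E ≤ℕ c)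
    (L₀-large : ι 168 * ι E + ι 18 + ι 48 * ι E * ι (K ℕ.^ c) + ι 4 * (ι K * (ι 2 * ι c + ι 3)) + ι 1 ≤ ι L₀) where
    private
      n₀ B : ℕ
      n₀ = c +ℕ (2 +ℕ L₀ +ℕ c)
      B = (32 *ℕ E) *ℕ (32 *ℕ E) *ℕ ((32 *ℕ E) *ℕ (32 *ℕ E))
      1≤E : 1 ≤ℕ E
      1≤E = ℕₚ.≤-trans (1≤* {80} (s≤s z≤n) (ℕₚ.≤-trans (s≤s z≤n) 8≤g)) 80g≤E

      shift : ∀ d → n₀ +ℕ d ≡ c +ℕ (2 +ℕ (L₀ +ℕ d) +ℕ c)
      shift d = lemma c L₀ d
        where
        lemma : ∀ c l d → c +ℕ (2 +ℕ l +ℕ c) +ℕ d ≡ c +ℕ (2 +ℕ (l +ℕ d) +ℕ c)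
        lemma = solveℕ-∀

      module _ {x y : ℕ} (1≤x : 1 ≤ℕ x) (gx≤gy : (g +ℕ 3) *ℕ x ≤ℕ g *ℕ y) (2y≤3x : 2 *ℕ y ≤ℕ 3 *ℕ x) (B≤x : B ≤ℕ x) (d : ℕ)
        (Kⁿ≤x : K ℕ.^ (n₀ +ℕ d) ≤ℕ x) (x≤Kⁿ⁺¹ : x ≤ℕ K ℕ.^ suc (n₀ +ℕ d)) (no-prime : ∀ n → x <ℕ n → n ≤ℕ y → ¬ Prime
            n) where
        -- The logarithm is chosen only now, when x is known. The earlier estimates are uniform in
        -- X, so E, c and L₀ could be fixed beforehand.
        X : ℕ
        X = 8 *ℕ (K *ℕ x)
        x≤Kx : x ≤ℕ K *ℕ x
        x≤Kx = ℕₚ.m≤n*m x K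
        8x≤X : 8 *ℕ x ≤ℕ X
        8x≤X = ℕₚ.*-monoʳ-≤ 8 x≤Kx
        1≤X : 1 ≤ℕ X
        1≤X = 1≤* {8} (s≤s z≤n) (1≤* 1≤K 1≤x)
        y≤2x : y ≤ℕ 2 *ℕ x
        y≤2x = ℕₚ.*-cancelˡ-≤ 2 (ℕₚ.≤-trans 2y≤3x (ℕₚ.≤-trans (ℕₚ.*-monoˡ-≤ x (ℕₚ.m≤m+n 3 1)) (ℕₚ.≤-reflexive
            (ℕₚ.*-assoc 2 2 x))))
        x≤y : x ≤ℕ y
        x≤y = ℕₚ.*-cancelˡ-≤ g {{ℕ.>-nonZero (ℕₚ.≤-trans (s≤s z≤n) 8≤g)}} (ℕₚ.≤-trans (ℕₚ.*-monoˡ-≤ x (ℕₚ.m≤m+n g 3)) gx≤gy)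
        y≤X : y ≤ℕ X
        y≤X = ℕₚ.≤-trans y≤2x (ℕₚ.≤-trans (ℕₚ.*-monoˡ-≤ x (ℕₚ.m≤m+n 2 6)) 8x≤X)

        open Logarithm X 1≤X
        open Estimates X ℓ ℓ-* 0≤ℓ ℓ-lower ℓ-upper
        open Deductions X ℓ ℓ-* 0≤ℓ ℓ-lower ℓ-upper
        open PrimePowers X ℓ ℓ-* 0≤ℓ ℓ-lower ℓ-upper

        ≤ℓ2^ : ∀ k → ι k ≤ ι 2 * ℓ (2 ℕ.^ k)
        ≤ℓ2^ k = lin 3 (λ k l z → 2 −· z := k :* l ∷ 1 · k :* con 1 :≤ k :* (con 2 :* l) ∷ [] ⊢ 1 · k :≤ con 2 :* z) _ _ _
          (ℓ-^ k (s≤s z≤n)) (*-monoʳ-0≤ (0≤ι k) (1≤2ℓ2 (ℕₚ.*-mono-≤ {2} {8} (s≤s (s≤s z≤n)) (1≤* 1≤K 1≤x))))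

        absurd : ⊥
        absurd = some-mass {g} {x} {y} {K₁} {K₂} {E} {c} {L₀ +ℕ d} 8≤g gx≤gy 2y≤3x y≤X 1≤K₁ 1≤K₂
          (lin 2 (λ k l → 1 · k :≤ con 2 :* l ∷ 1 · con 16 :≤ k ∷ [] ⊢ 2 · con 8 :≤ l) _ _ (≤ℓ2^ k₁) (ι-mono 16≤k₁))
          (lin 2 (λ k l → 1 · k :≤ con 2 :* l ∷ 1 · con 30 :≤ k ∷ [] ⊢ 2 · con 15 :≤ l) _ _ (≤ℓ2^ k₂) (ι-mono 30≤k₂))
          ι-E 80g≤E 72E≤c (≤-trans L₀-large (ι-mono (ℕₚ.m≤m+n L₀ d)))
          (subst (λ n → K ℕ.^ n ≤ℕ x) (shift d) Kⁿ≤x) (subst (λ n → x ≤ℕ K ℕ.^ suc n) (shift d) x≤Kⁿ⁺¹)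
          (ℕₚ.≤-trans (ℕₚ.*-monoˡ-≤ x (ℕₚ.m≤m+n 4 4)) 8x≤X) (ℕₚ.m≤n*m (K *ℕ x) 8)
          (no-prime⇒no-mass 1≤x x≤y y≤2x 8x≤X no-prime E 1≤E B≤x)

    gaps : PrimeGaps g
    -- Kⁿ⁰ guarantees enough windows, and B makes proper prime powers negligible. A larger x only
    -- increases the number of windows beyond L₀.
    gaps = K ℕ.^ n₀ +ℕ B , λ x y x₀≤x gx≤gy 2y≤3x → prime x y x₀≤x gx≤gy 2y≤3x (search-prime x y)
      where
      prime : ∀ x y → K ℕ.^ n₀ +ℕ B ≤ℕ x → (g +ℕ 3) *ℕ x ≤ℕ g *ℕ y → 2 *ℕ y ≤ℕ 3 *ℕ x →
        PrimeBetween x y ⊎ (∀ n → x <ℕ n → n ≤ℕ y → ¬ Prime n) → PrimeBetween x y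
      prime x y x₀≤x gx≤gy 2y≤3x (inj₁ found) = found
      prime x y x₀≤x gx≤gy 2y≤3x (inj₂ none) with powers-bracket 2≤K x (ℕₚ.≤-trans (1≤^ n₀ 1≤K)
          (ℕₚ.≤-trans (ℕₚ.m≤m+n _ B) x₀≤x))
      ... | n , l , u = ⊥-elim (absurd (ℕₚ.≤-trans (1≤^ n₀ 1≤K) Kⁿ⁰≤x) gx≤gy 2y≤3x (ℕₚ.≤-trans (ℕₚ.m≤n+m B _) x₀≤x)
          (n ℕ.∸ n₀)
            (subst (λ m → K ℕ.^ m ≤ℕ x) (sym eq) l) (subst (λ m → x ≤ℕ K ℕ.^ suc m) (sym eq) (ℕₚ.<⇒≤ u)) none)
        where
        Kⁿ⁰≤x : K ℕ.^ n₀ ≤ℕ x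
        Kⁿ⁰≤x = ℕₚ.≤-trans (ℕₚ.m≤m+n _ B) x₀≤x
        n₀≤n : n₀ ≤ℕ n
        n₀≤n = ℕₚ.≮⇒≥ λ n<n₀ → ℕₚ.<⇒≱ u (ℕₚ.≤-trans (ℕₚ.^-monoʳ-≤ K n<n₀) Kⁿ⁰≤x)
        eq : n₀ +ℕ (n ℕ.∸ n₀) ≡ n
        eq = ℕₚ.m+[n∸m]≡n n₀≤n

  choose-L₀ : ∀ {E c} → ι E ≡ ι 7680 * (ι g * ι g * ι K) → 80 *ℕ g ≤ℕ E → 72 *ℕ E ≤ℕ c → PrimeGaps g
  choose-L₀ {E} {c} ι-E 80g≤E 72E≤c = gaps {E} {c} {ceiling} ι-E 80g≤E 72E≤c (≡⇒≤ (sym ι-ceiling))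
    where
    U V ceiling : ℕ
    U = K ℕ.^ c
    V = K *ℕ (2 *ℕ c +ℕ 3)
    ceiling = 168 *ℕ E +ℕ 18 +ℕ 48 *ℕ E *ℕ U +ℕ 4 *ℕ V +ℕ 1
    ι-ceiling : ι ceiling ≡ ι 168 * ι E + ι 18 + ι 48 * ι E * ι U + ι 4 * (ι K * (ι 2 * ι c + ι 3)) + ι 1
    ι-ceiling = trans (ι-+ (168 *ℕ E +ℕ 18 +ℕ 48 *ℕ E *ℕ U +ℕ 4 *ℕ V) 1)
        (cong (_+ ι 1) (trans (ι-+ (168 *ℕ E +ℕ 18 +ℕ 48 *ℕ E *ℕ U) (4 *ℕ V)) (cong₂ _+_
      (trans (ι-+ (168 *ℕ E +ℕ 18) (48 *ℕ E *ℕ U)) (cong₂ _+_ (trans (ι-+ (168 *ℕ E) 18) (cong (_+ ι 18) (ι-* 168 E)))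
          (trans (ι-* (48 *ℕ E) U) (cong (_* ι U) (ι-* 48 E)))))
      (trans (ι-* 4 V) (cong (ι 4 *_) (trans (ι-* K (2 *ℕ c +ℕ 3)) (cong (ι K *_) (trans (ι-+ (2 *ℕ c) 3)
          (cong (_+ ι 3) (ι-* 2 c))))))))))

  choose-c : ∀ {E} → ι E ≡ ι 7680 * (ι g * ι g * ι K) → 80 *ℕ g ≤ℕ E → PrimeGaps g
  choose-c {E} ι-E 80g≤E = choose-L₀ {E} {72 *ℕ E} ι-E 80g≤E ℕₚ.≤-refl

  choose-E : ∀ {k} → ι k ≡ ι 7680 → 80 ≤ℕ k → PrimeGaps g
  choose-E {k} ι-k 80≤k = choose-c {k *ℕ (g *ℕ g *ℕ K)}
    (trans (ι-* k _) (cong₂ _*_ ι-k (trans (ι-* (g *ℕ g) K) (cong (_* ι K) (ι-* g g)))))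
    (ℕₚ.*-mono-≤ 80≤k (ℕₚ.≤-trans (ℕₚ.m≤m*n g g {{ℕ.>-nonZero (ℕₚ.≤-trans (s≤s z≤n) 8≤g)}}) (ℕₚ.m≤m*n (g *ℕ g) K)))

prime-gaps : ∀ {g} → 8 ≤ℕ g → PrimeGaps g
prime-gaps 8≤g = GapConstants.choose-E 8≤g {16} {30} ℕₚ.≤-refl ℕₚ.≤-refl {7680} refl (ℕₚ.m≤m+n 80 7600)

-- The upper bound

bit : Bool → ℕ
bit b = if b then 1 else 0

∑ᶠ : ∀ {m} → (Fin m → ℕ) → ℕ
∑ᶠ {zero} f = 0
∑ᶠ {suc m} f = f Fin.zero +ℕ ∑ᶠ (λ i → f (Fin.suc i))

∑ᶠ-cong : ∀ {m} {f g : Fin m → ℕ} → (∀ i → f i ≡ g i) → ∑ᶠ f ≡ ∑ᶠ g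
∑ᶠ-cong {zero} e = refl
∑ᶠ-cong {suc m} e = cong₂ _+ℕ_ (e Fin.zero) (∑ᶠ-cong λ i → e (Fin.suc i))

∑ᶠ-+ : ∀ {m} (f g : Fin m → ℕ) → ∑ᶠ (λ i → f i +ℕ g i) ≡ ∑ᶠ f +ℕ ∑ᶠ g
∑ᶠ-+ {zero} f g = refl
∑ᶠ-+ {suc m} f g = trans (cong (f Fin.zero +ℕ g Fin.zero +ℕ_) (∑ᶠ-+ (f ∘ Fin.suc) (g ∘ Fin.suc))) (lemma (f Fin.zero)
    (g Fin.zero) _ _)
  where
  lemma : ∀ a b c d → a +ℕ b +ℕ (c +ℕ d) ≡ a +ℕ c +ℕ (b +ℕ d)
  lemma = solveℕ-∀

∑ᶠ-* : ∀ {m} c (f : Fin m → ℕ) → ∑ᶠ (λ i → c *ℕ f i) ≡ c *ℕ ∑ᶠ f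
∑ᶠ-* {zero} c f = sym (ℕₚ.*-zeroʳ c)
∑ᶠ-* {suc m} c f = trans (cong (c *ℕ f Fin.zero +ℕ_) (∑ᶠ-* c (f ∘ Fin.suc))) (sym (ℕₚ.*-distribˡ-+ c _ _))

∑ᶠ-zero : ∀ {m} {f : Fin m → ℕ} → (∀ i → f i ≡ 0) → ∑ᶠ f ≡ 0
∑ᶠ-zero {zero} e = refl
∑ᶠ-zero {suc m} e = cong₂ _+ℕ_ (e Fin.zero) (∑ᶠ-zero (λ i → e (Fin.suc i)))

ones≡∑ᶠ : ∀ {m n} (A : Matrix m n) → ones A ≡ ∑ᶠ (λ i → rowOnes (A i))
ones≡∑ᶠ {zero} A = refl
ones≡∑ᶠ {suc m} A = cong (rowOnes (A Fin.zero) +ℕ_) (ones≡∑ᶠ (λ i → A (Fin.suc i)))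

-- The falling factorial d (d - 1) ⋯ (d - r + 1).
falling : ℕ → ℕ → ℕ
falling d zero = 1
falling zero (suc r) = 0
falling (suc d) (suc r) = suc r *ℕ falling d r +ℕ falling d (suc r)

common : ∀ {n} → (Fin n → Bool) → (Fin n → Bool) → ℕ
common f g = rowOnes (λ j → f j ∧ g j)

-- `active` marks the rows that contain all columns chosen so far, so restriction to them leaves the
-- row index type unchanged.
ApartOn : ∀ {m n} → (Fin m → Bool) → ℕ → Matrix m n → Set
ApartOn active r A = ∀ i i′ → i ≢ i′ → active i ≡ true → active i′ ≡ true → common (A i) (A i′) <ℕ r

-- Every r-set of columns lies in at most one row; induction on the columns.
packing : ∀ n {m} r (active : Fin m → Bool) (A : Matrix m n) → ApartOn active r A →
  ∑ᶠ (λ i → bit (active i) *ℕ falling (rowOnes (A i)) r) ≤ℕ falling n r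
packing n zero active A apart = ℕₚ.≤-trans (ℕₚ.≤-reflexive (∑ᶠ-cong λ i → ℕₚ.*-identityʳ (bit (active i))))
  (at-most-one active λ i i′ i≢i′ p q → ℕₚ.n≮0 (apart i i′ i≢i′ p q))
  where
  none : ∀ {m} (active : Fin m → Bool) → (∀ i → active i ≡ true → ⊥) → ∀ i → bit (active i) ≡ 0
  none active h i with active i in eq
  ... | true = ⊥-elim (h i eq)
  ... | false = refl
  at-most-one : ∀ {m} (active : Fin m → Bool) → (∀ i i′ → i ≢ i′ → active i ≡ true → active i′ ≡ true → ⊥) → ∑ᶠ
      (λ i → bit (active i)) ≤ℕ 1
  at-most-one {zero} active h = z≤n
  at-most-one {suc m} active h with active Fin.zero in eq
  ... | true = ℕₚ.≤-reflexive (cong suc (∑ᶠ-zero (none (active ∘ Fin.suc) λ i p → h Fin.zero (Fin.suc i) (λ ()) eq p)))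
  ... | false = at-most-one (active ∘ Fin.suc) λ i i′ i≢i′ p q → h (Fin.suc i) (Fin.suc i′)
      (λ e → i≢i′ (Finₚ.suc-injective e)) p q
packing zero (suc r) active A apart = ℕₚ.≤-reflexive (∑ᶠ-zero λ i → ℕₚ.*-zeroʳ (bit (active i)))
packing (suc n) (suc r) active A apart = ℕₚ.≤-trans (ℕₚ.≤-reflexive (trans (∑ᶠ-cong λ i → split (active i)
    (A i Fin.zero) (rowOnes (rest i)))
    (trans (∑ᶠ-+ (λ i → suc r *ℕ (bit (link i) *ℕ falling (rowOnes (rest i)) r)) (λ i → bit (active i) *ℕ falling
        (rowOnes (rest i)) (suc r)))
      (cong (_+ℕ ∑ᶠ (λ i → bit (active i) *ℕ falling (rowOnes (rest i)) (suc r))) (∑ᶠ-* (suc r) (λ i → bit (link i) *ℕ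
          falling (rowOnes (rest i)) r))))))
  (ℕₚ.+-mono-≤ (ℕₚ.*-monoʳ-≤ (suc r) (packing n r link rest apart-link)) (packing n (suc r) active rest apart-rest))
  where
  rest : Matrix _ n
  rest i j = A i (Fin.suc j)
  link : _ → Bool
  link i = active i ∧ A i Fin.zero
  split : ∀ a b d → bit a *ℕ falling (bit b +ℕ d) (suc r) ≡ suc r *ℕ (bit (a ∧ b) *ℕ falling d r) +ℕ bit a *ℕ falling
      d (suc r)
  split false b d = sym (trans (ℕₚ.+-identityʳ _) (ℕₚ.*-zeroʳ r))
  split true false d = sym (cong (_+ℕ (falling d (suc r) +ℕ 0)) (ℕₚ.*-zeroʳ r))
  split true true d = lemma r (falling d r) (falling d (suc r))
    where
    lemma : ∀ r a b → suc r *ℕ a +ℕ b +ℕ 0 ≡ suc r *ℕ (a +ℕ 0) +ℕ (b +ℕ 0)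
    lemma = solveℕ-∀
  apart-rest : ApartOn active (suc r) rest
  apart-rest i i′ i≢i′ p q = ℕₚ.≤-<-trans (ℕₚ.m≤n+m _ (bit (A i Fin.zero ∧ A i′ Fin.zero))) (apart i i′ i≢i′ p q)
  apart-link : ApartOn link r rest
  apart-link i i′ i≢i′ p q = ℕ.s≤s⁻¹ (subst (λ b → suc (bit b +ℕ common (rest i) (rest i′)) ≤ℕ suc r)
    (cong₂ _∧_ (Boolₚ.∧-conicalʳ (active i) _ p) (Boolₚ.∧-conicalʳ (active i′) _ q))
    (apart i i′ i≢i′ (Boolₚ.∧-conicalˡ (active i) _ p) (Boolₚ.∧-conicalˡ (active i′) _ q)))

choose-subset : ∀ {n} (f : Fin n → Bool) r → r ≤ℕ rowOnes f → Σ (Sub.Subset n) λ T → Sub.∣ T ∣ ≡ r × (∀ j → j Sub.∈ T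
    → f j ≡ true)
choose-subset {zero} f zero z≤n = [] , refl , λ ()
choose-subset {suc n} f zero z≤n with choose-subset (f ∘ Fin.suc) zero z≤n
... | T , e , h = Sub.outside ∷ T , e , λ { (Fin.suc j) (there p) → h j p }
choose-subset {suc n} f (suc r) le with f Fin.zero in eq
... | true with choose-subset (f ∘ Fin.suc) r (ℕ.s≤s⁻¹ le)
...   | T , e , h = Sub.inside ∷ T , cong suc e , λ { Fin.zero _ → eq ; (Fin.suc j) (there p) → h j p }
choose-subset {suc n} f (suc r) le | false with choose-subset (f ∘ Fin.suc) (suc r) le
...   | T , e , h = Sub.outside ∷ T , e , λ { (Fin.suc j) (there p) → h j p }

pair-subset : ∀ {m} (i i′ : Fin m) → i ≢ i′ → Σ (Sub.Subset m) λ S → Sub.∣ S ∣ ≡ 2 × (∀ k → k Sub.∈ S → k ≡ i ⊎ k ≡ i′)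
pair-subset Fin.zero Fin.zero i≢i′ = ⊥-elim (i≢i′ refl)
pair-subset Fin.zero (Fin.suc i′) _ = Sub.inside ∷ Sub.⁅ i′ ⁆ , cong suc (Subₚ.∣⁅x⁆∣≡1 i′) ,
  λ { Fin.zero _ → inj₁ refl ; (Fin.suc k) (there p) → inj₂ (cong Fin.suc (Subₚ.x∈⁅y⁆⇒x≡y i′ p)) }
pair-subset (Fin.suc i) Fin.zero _ = Sub.inside ∷ Sub.⁅ i ⁆ , cong suc (Subₚ.∣⁅x⁆∣≡1 i) ,
  λ { Fin.zero _ → inj₂ refl ; (Fin.suc k) (there p) → inj₁ (cong Fin.suc (Subₚ.x∈⁅y⁆⇒x≡y i p)) }
pair-subset (Fin.suc i) (Fin.suc i′) i≢i′ with pair-subset i i′ (λ e → i≢i′ (cong Fin.suc e))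
... | S , e , h = Sub.outside ∷ S , e , λ { (Fin.suc k) (there p) → [ (λ z → inj₁ (cong Fin.suc z)) ,
    (λ z → inj₂ (cong Fin.suc z)) ]′ (h k p) }

free⇒apart : ∀ {m n} r (A : Matrix m n) → Free 2 r A → ∀ i i′ → i ≢ i′ → common (A i) (A i′) <ℕ r
free⇒apart r A free i i′ i≢i′ = ℕₚ.≰⇒> λ r≤ →
  let S , ∣S∣ , inS = pair-subset i i′ i≢i′
      T , ∣T∣ , inT = choose-subset (λ j → A i j ∧ A i′ j) r r≤
  in free (S , T , ∣S∣ , ∣T∣ , λ k j k∈S j∈T → entry k j (inS k k∈S) (inT j j∈T))
  where
  entry : ∀ k j → k ≡ i ⊎ k ≡ i′ → A i j ∧ A i′ j ≡ true → A k j ≡ true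
  entry k j (inj₁ refl) h = Boolₚ.∧-conicalˡ _ _ h
  entry k j (inj₂ refl) h = Boolₚ.∧-conicalʳ (A i j) _ h

-- Powers, falling factorials and the tangent inequality

falling≤^ : ∀ d r → falling d r ≤ℕ d ℕ.^ r
falling≤^ d zero = ℕₚ.≤-refl
falling≤^ zero (suc r) = z≤n
falling≤^ (suc d) (suc r) = ℕₚ.≤-trans (ℕₚ.+-mono-≤ (ℕₚ.*-monoʳ-≤ (suc r) (falling≤^ d r)) (falling≤^ d (suc r)))
    (bernoulli d r)
  where
  bernoulli : ∀ d r → suc r *ℕ d ℕ.^ r +ℕ d ℕ.^ suc r ≤ℕ suc d ℕ.^ suc r
  bernoulli d zero = ℕₚ.≤-reflexive (lemma d)
    where
    lemma : ∀ d → 1 *ℕ 1 +ℕ d *ℕ 1 ≡ (1 +ℕ d) *ℕ 1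
    lemma = solveℕ-∀
  bernoulli d (suc r) = ℕₚ.≤-trans (ℕₚ.≤-trans (ℕₚ.m≤m+n _ (suc r *ℕ d ℕ.^ r)) (ℕₚ.≤-reflexive (lemma d r (d ℕ.^ r))))
      (ℕₚ.*-monoʳ-≤ (suc d) (bernoulli d r))
    where
    lemma : ∀ d r p → (2 +ℕ r) *ℕ (d *ℕ p) +ℕ d *ℕ (d *ℕ p) +ℕ (1 +ℕ r) *ℕ p ≡ (1 +ℕ d) *ℕ ((1 +ℕ r) *ℕ p +ℕ d *ℕ p)
    lemma = solveℕ-∀

suc^≤ : ∀ e r → suc e ℕ.^ suc r ≤ℕ suc r *ℕ suc e ℕ.^ r +ℕ e ℕ.^ suc r
suc^≤ e zero = ℕₚ.≤-reflexive (lemma e)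
  where
  lemma : ∀ e → (1 +ℕ e) *ℕ 1 ≡ 1 *ℕ 1 +ℕ e *ℕ 1
  lemma = solveℕ-∀
suc^≤ e (suc r) = ℕₚ.≤-trans (ℕₚ.+-monoʳ-≤ (suc e ℕ.^ suc r) (ℕₚ.*-monoʳ-≤ e (suc^≤ e r)))
  (ℕₚ.≤-trans (ℕₚ.m≤m+n _ (suc r *ℕ suc e ℕ.^ r)) (ℕₚ.≤-reflexive (lemma e r (suc e ℕ.^ r) (e ℕ.^ suc r))))
  where
  lemma : ∀ e r p q → (1 +ℕ e) *ℕ p +ℕ e *ℕ ((1 +ℕ r) *ℕ p +ℕ q) +ℕ (1 +ℕ r) *ℕ p ≡ (2 +ℕ r) *ℕ ((1 +ℕ e) *ℕ p) +ℕ e *ℕ q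
  lemma = solveℕ-∀

-- Truncated subtraction makes short rows harmless. The induction compares the recurrence of
-- `falling` with the mean value bound (e + 1)^(r+1) - e^(r+1) ≤ (r + 1)(e + 1)^r.
∸^≤falling : ∀ d r → (d ℕ.∸ r) ℕ.^ r ≤ℕ falling d r
∸^≤falling d zero = ℕₚ.≤-refl
∸^≤falling zero (suc r) = z≤n
∸^≤falling (suc d) (suc r) = ℕₚ.≤-trans (step (d ℕ.∸ r) refl) (ℕₚ.+-mono-≤ (ℕₚ.*-monoʳ-≤ (suc r) (∸^≤falling d r))
    (∸^≤falling d (suc r)))
  where
  step : ∀ e → d ℕ.∸ r ≡ e → (d ℕ.∸ r) ℕ.^ suc r ≤ℕ suc r *ℕ (d ℕ.∸ r) ℕ.^ r +ℕ (d ℕ.∸ suc r) ℕ.^ suc r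
  step zero eq = subst (λ e → e ℕ.^ suc r ≤ℕ suc r *ℕ e ℕ.^ r +ℕ (d ℕ.∸ suc r) ℕ.^ suc r) (sym eq) z≤n
  step (suc e) eq = subst₂ (λ a b → a ℕ.^ suc r ≤ℕ suc r *ℕ a ℕ.^ r +ℕ b ℕ.^ suc r) (sym eq)
    (trans (cong ℕ.pred (sym eq)) (ℕₚ.pred[m∸n]≡m∸[1+n] d r)) (suc^≤ e r)

∑ᶠ-mono : ∀ {m} {f g : Fin m → ℕ} → (∀ i → f i ≤ℕ g i) → ∑ᶠ f ≤ℕ ∑ᶠ g
∑ᶠ-mono {zero} le = z≤n
∑ᶠ-mono {suc m} le = ℕₚ.+-mono-≤ (le Fin.zero) (∑ᶠ-mono λ i → le (Fin.suc i))

∑ᶠ-const : ∀ {m} c → ∑ᶠ {m} (λ _ → c) ≡ m *ℕ c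
∑ᶠ-const {zero} c = refl
∑ᶠ-const {suc m} c = cong (c +ℕ_) (∑ᶠ-const {m} c)

0≤square : ∀ a → ι 0 ≤ a * a
0≤square a with ≤-total (ι 0) a
... | inj₁ p = *-nonneg p p
... | inj₂ p = ≤-trans (*-nonneg (≤⇒0≤ p) (≤⇒0≤ p)) (≡⇒≤ (ring 1 (λ a → (con 0 :- a) :* (con 0 :- a) := a :* a) _))

-- Induction on q: multiply by e and add (q + 1) s^q (e - s)² ≥ 0.
tangent : ∀ q e s → suc q *ℕ (s ℕ.^ q *ℕ e) ≤ℕ e ℕ.^ suc q +ℕ q *ℕ s ℕ.^ suc q
tangent q e s = ι-cancel (≤-trans (≡⇒≤ (trans (ι-* (suc q) _) (cong (ι (suc q) *_) (ι-* (s ℕ.^ q) e)))) (≤-trans (go q)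
  (≡⇒≤ (sym (trans (ι-+ (e ℕ.^ suc q) _) (cong (ι (e ℕ.^ suc q) +_) (trans (ι-* q (s ℕ.^ suc q))
      (cong (ι q *_) (ι-* s (s ℕ.^ q))))))))))
  where
  go : ∀ q → ι (suc q) * (ι (s ℕ.^ q) * ι e) ≤ ι (e ℕ.^ suc q) + ι q * (ι s * ι (s ℕ.^ q))
  go zero = lin 3 (λ e a s → 1 −· a := e :* con 1 ∷ [] ⊢ 1 · con 1 :* (con 1 :* e) :≤ a :+ con 0 :* (s :* con 1)) _ _
      _ (ι-* e 1)
  go (suc q) = ≤-trans (≡⇒≤ (cong₂ _*_ (trans (ι-suc (suc q)) (cong (ι 1 +_) (ι-suc q))) (cong (_* ι e) (ι-* s (s ℕ.^ q)))))
    (≤-trans (lin 5 (λ q e s A B → 1 · e :* ((con 1 :+ q) :* (B :* e)) :≤ e :* (A :+ q :* (s :* B)) ∷ 1 · con 0 :≤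
        (con 1 :+ q) :* B :* ((e :- s) :* (e :- s)) ∷ [] ⊢ 1 · (con 1 :+ (con 1 :+ q)) :* (s :* B :* e) :≤ e :* A :+
        (con 1 :+ q) :* (s :* (s :* B))) _ _ _ _ _
      (*-monoʳ-0≤ (0≤ι e) (≤-trans (≡⇒≤ (cong (_* (ι (s ℕ.^ q) * ι e)) (sym (ι-suc q)))) (go q)))
          (*-nonneg (*-nonneg (≤-trans (0≤ι (suc q)) (≡⇒≤ (ι-suc q))) (0≤ι (s ℕ.^ q))) (0≤square _)))
      (≡⇒≤ (sym (cong₂ _+_ (ι-* e (e ℕ.^ suc q)) (cong₂ _*_ (ι-suc q) (cong (ι s *_) (ι-* s (s ℕ.^ q))))))))

-- The tangent is applied to row sums reduced by r, whose r-th powers lie below the falling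
-- factorials. The reduction loses at most m r ones, negligible against m √n.
apart-sum : ∀ {m n} q (A : Matrix m n) s → Free 2 (suc q) A →
  suc q *ℕ (s ℕ.^ q *ℕ ∑ᶠ (λ i → rowOnes (A i) ℕ.∸ suc q)) ≤ℕ n ℕ.^ suc q +ℕ m *ℕ (q *ℕ s ℕ.^ suc q)
apart-sum {m} {n} q A s free = ℕₚ.≤-trans (ℕₚ.≤-reflexive (trans (cong (suc q *ℕ_) (sym (∑ᶠ-* (s ℕ.^ q) excess)))
    (sym (∑ᶠ-* (suc q) (λ i → s ℕ.^ q *ℕ excess i)))))
  (ℕₚ.≤-trans (∑ᶠ-mono λ i → tangent q (rowOnes (A i) ℕ.∸ suc q) s)
      (ℕₚ.≤-trans (ℕₚ.≤-reflexive (trans (∑ᶠ-+ {m} (λ i → excess i ℕ.^ suc q) (λ _ → q *ℕ s ℕ.^ suc q))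
      (cong (∑ᶠ (λ i → excess i ℕ.^ suc q) +ℕ_) (∑ᶠ-const {m} _))))
  (ℕₚ.+-monoˡ-≤ _ (ℕₚ.≤-trans (∑ᶠ-mono λ i → ℕₚ.≤-trans (∸^≤falling (rowOnes (A i)) (suc q)) (ℕₚ.≤-reflexive
      (sym (ℕₚ.+-identityʳ _))))
    (ℕₚ.≤-trans (packing n (suc q) (λ _ → true) A λ i i′ i≢i′ _ _ → free⇒apart (suc q) A free i i′ i≢i′)
        (falling≤^ n (suc q)))))))
  where
  excess : Fin m → ℕ
  excess i = rowOnes (A i) ℕ.∸ suc q

ones≤ : ∀ {m n} r (A : Matrix m n) → ones A ≤ℕ ∑ᶠ (λ i → rowOnes (A i) ℕ.∸ r) +ℕ m *ℕ r
ones≤ {m} r A = ℕₚ.≤-trans (ℕₚ.≤-reflexive (ones≡∑ᶠ A)) (ℕₚ.≤-trans (∑ᶠ-mono λ i → ℕₚ.≤-trans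
    (ℕₚ.m≤n+m∸n (rowOnes (A i)) r) (ℕₚ.≤-reflexive (ℕₚ.+-comm r _)))
  (ℕₚ.≤-reflexive (trans (∑ᶠ-+ {m} (λ i → rowOnes (A i) ℕ.∸ r) (λ _ → r)) (cong (∑ᶠ (λ i → rowOnes (A i) ℕ.∸ r) +ℕ_)
      (∑ᶠ-const {m} r)))))

-- The lower bound

evalℤ : ∀ {d} → Vec ℤ.ℤ d → ℤ.ℤ → ℤ.ℤ
evalℤ [] x = ℤ.+ 0
evalℤ (c ∷ cs) x = c ℤ.+ x ℤ.* evalℤ cs x

-- Synthetic division by x - a: the values of Horner's scheme at a are the coefficients of (f(x) -
-- f(a)) / (x - a).
quotient : ∀ {d} → ℤ.ℤ → Vec ℤ.ℤ (suc d) → Vec ℤ.ℤ d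
quotient {zero} a (c ∷ []) = []
quotient {suc d} a (c ∷ h) = evalℤ h a ∷ quotient a h

quotient-spec : ∀ {d} (f : Vec ℤ.ℤ (suc d)) a x → evalℤ f x ℤ.- evalℤ f a ≡ (x ℤ.- a) ℤ.* evalℤ (quotient a f) x
quotient-spec {zero} (c ∷ []) a x = lemma c a x
  where
  lemma : ∀ c a x → (c ℤ.+ x ℤ.* ℤ.+ 0) ℤ.- (c ℤ.+ a ℤ.* ℤ.+ 0) ≡ (x ℤ.- a) ℤ.* ℤ.+ 0
  lemma = solveℤ-∀
quotient-spec {suc d} (c ∷ h) a x = trans (lemma c a x (evalℤ h x) (evalℤ h a))
    (trans (cong (λ z → (x ℤ.- a) ℤ.* evalℤ h a ℤ.+ x ℤ.* z) (quotient-spec h a x))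
    (lemma′ a x (evalℤ h a) (evalℤ (quotient a h) x)))
  where
  lemma : ∀ c a x u v → (c ℤ.+ x ℤ.* u) ℤ.- (c ℤ.+ a ℤ.* v) ≡ (x ℤ.- a) ℤ.* v ℤ.+ x ℤ.* (u ℤ.- v)
  lemma = solveℤ-∀
  lemma′ : ∀ a x v w → (x ℤ.- a) ℤ.* v ℤ.+ x ℤ.* ((x ℤ.- a) ℤ.* w) ≡ (x ℤ.- a) ℤ.* (v ℤ.+ x ℤ.* w)
  lemma′ = solveℤ-∀

enumerate : ∀ {n} (S : Sub.Subset n) → Fin Sub.∣ S ∣ → Fin n
enumerate (true ∷ S) Fin.zero = Fin.zero
enumerate (true ∷ S) (Fin.suc k) = Fin.suc (enumerate S k)
enumerate (false ∷ S) k = Fin.suc (enumerate S k)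

enumerate-∈ : ∀ {n} (S : Sub.Subset n) k → enumerate S k Sub.∈ S
enumerate-∈ (true ∷ S) Fin.zero = here
enumerate-∈ (true ∷ S) (Fin.suc k) = there (enumerate-∈ S k)
enumerate-∈ (false ∷ S) k = there (enumerate-∈ S k)

enumerate-injective : ∀ {n} (S : Sub.Subset n) {k l} → enumerate S k ≡ enumerate S l → k ≡ l
enumerate-injective (true ∷ S) {Fin.zero} {Fin.zero} e = refl
enumerate-injective (true ∷ S) {Fin.suc k} {Fin.suc l} e = cong Fin.suc (enumerate-injective S (Finₚ.suc-injective e))
enumerate-injective (false ∷ S) e = enumerate-injective S (Finₚ.suc-injective e)

listing : ∀ {n k} (S : Sub.Subset n) → Sub.∣ S ∣ ≡ k → Σ (Fin k → Fin n) λ g → (∀ i → g i Sub.∈ S) × (∀ {i j} → g i ≡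
    g j → i ≡ j)
listing S refl = enumerate S , enumerate-∈ S , enumerate-injective S

evalℕ : ∀ {d} → Vec ℕ d → ℕ → ℕ
evalℕ [] x = 0
evalℕ (c ∷ cs) x = c +ℕ x *ℕ evalℕ cs x

difference-vec : ∀ {d} → Vec ℕ d → Vec ℕ d → Vec ℤ.ℤ d
difference-vec [] [] = []
difference-vec (a ∷ as) (b ∷ bs) = (ℤ.+ a ℤ.- ℤ.+ b) ∷ difference-vec as bs

evalℤ-difference : ∀ {d} (as bs : Vec ℕ d) x → evalℤ (difference-vec as bs) (ℤ.+ x) ≡ ℤ.+ evalℕ as x ℤ.- ℤ.+ evalℕ bs x
evalℤ-difference [] [] x = refl
evalℤ-difference (a ∷ as) (b ∷ bs) x = trans (cong (λ z → (ℤ.+ a ℤ.- ℤ.+ b) ℤ.+ ℤ.+ x ℤ.* z) (evalℤ-difference as bs x))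
  (trans (lemma (ℤ.+ a) (ℤ.+ b) (ℤ.+ x) (ℤ.+ evalℕ as x) (ℤ.+ evalℕ bs x)) (cong₂ ℤ._-_ (pos a as) (pos b bs)))
  where
  lemma : ∀ a b x u v → (a ℤ.- b) ℤ.+ x ℤ.* (u ℤ.- v) ≡ (a ℤ.+ x ℤ.* u) ℤ.- (b ℤ.+ x ℤ.* v)
  lemma = solveℤ-∀
  pos : ∀ c cs → ℤ.+ c ℤ.+ ℤ.+ x ℤ.* ℤ.+ evalℕ cs x ≡ ℤ.+ (c +ℕ x *ℕ evalℕ cs x)
  pos c cs = cong (ℤ._+_ (ℤ.+ c)) (sym (ℤₚ.pos-* x (evalℕ cs x)))

module Polynomials {p : ℕ} (pr : Prime p) where
  private
    instance
      p-nonZero : NonZero p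
      p-nonZero = Pr.prime⇒nonZero pr

  infix 4 p∣_
  p∣_ : ℤ.ℤ → Set
  p∣ z = ℤ.+ p ℤ∣.∣ z

  p∣-* : ∀ a b → p∣ a ℤ.* b → p∣ a ⊎ p∣ b
  p∣-* a b d with Pr.euclidsLemma ℤ.∣ a ∣ ℤ.∣ b ∣ pr (subst (p ∣_) (ℤₚ.abs-* a b) (ℤ∣.∣⇒∣ᵤ d))
  ... | inj₁ h = inj₁ (ℤ∣.∣ᵤ⇒∣ h)
  ... | inj₂ h = inj₂ (ℤ∣.∣ᵤ⇒∣ h)

  residues-equal : ∀ {a b} → a <ℕ p → b <ℕ p → p∣ ℤ.+ a ℤ.- ℤ.+ b → a ≡ b
  residues-equal {a} {b} a<p b<p d = [ (λ a≤b → ℕₚ.≤-antisym a≤b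
      (go a≤b b<p (subst (p ∣_) (trans (cong ℤ.∣_∣ (ℤₚ.m-n≡m⊖n a b)) (ℤₚ.∣⊖∣-≤ a≤b)) (ℤ∣.∣⇒∣ᵤ d))))
    , (λ b≤a → ℕₚ.≤-antisym (go b≤a a<p (subst (p ∣_) (trans (cong ℤ.∣_∣ (ℤₚ.m-n≡m⊖n a b)) (trans (ℤₚ.∣m⊖n∣≡∣n⊖m∣ a b)
        (ℤₚ.∣⊖∣-≤ b≤a))) (ℤ∣.∣⇒∣ᵤ d))) b≤a) ]′ (ℕₚ.≤-total a b)
    where
    go : ∀ {a b} → a ≤ℕ b → b <ℕ p → p ∣ b ℕ.∸ a → b ≤ℕ a
    go {a} {b} a≤b b<p h with b ℕ.∸ a in eq
    ... | zero = ℕₚ.m∸n≡0⇒m≤n eq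
    ... | suc k = ⊥-elim (ℕₚ.<⇒≱ b<p (ℕₚ.≤-trans (∣ₚ.∣⇒≤ h) (ℕₚ.≤-trans (ℕₚ.≤-reflexive (sym eq)) (ℕₚ.m∸n≤m b a))))

  -- The zero polynomial over F_p; divisibility of integer coefficients takes the place of a
  -- construction of the field.
  AllDivisible : ∀ {d} → Vec ℤ.ℤ d → Set
  AllDivisible [] = ⊤
  AllDivisible (c ∷ cs) = p∣ c × AllDivisible cs

  recover : ∀ {d} (f : Vec ℤ.ℤ (suc d)) a → p∣ evalℤ f a → AllDivisible (quotient a f) → AllDivisible f
  recover {zero} (c ∷ []) a root _ = subst p∣_ (lemma c a) root , tt
    where
    lemma : ∀ c a → c ℤ.+ a ℤ.* ℤ.+ 0 ≡ c
    lemma = solveℤ-∀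
  recover {suc d} (c ∷ h) a root (h-root , rest) = subst p∣_ (lemma c a (evalℤ h a)) (ℤ∣.∣m∣n⇒∣m-n root
      (ℤ∣.∣n⇒∣m*n a h-root)) , recover h a h-root rest
    where
    lemma : ∀ c a v → (c ℤ.+ a ℤ.* v) ℤ.- a ℤ.* v ≡ c
    lemma = solveℤ-∀

  -- Lagrange's bound: one root is divided out, the others remain roots of the quotient because p is
  -- prime, and `recover` brings the conclusion back to f.
  too-many-roots : ∀ {d} (f : Vec ℤ.ℤ d) (xs : Fin d → ℤ.ℤ) → (∀ {i j} → p∣ xs i ℤ.- xs j → i ≡ j) → (∀ i → p∣ evalℤ f
      (xs i)) → AllDivisible f
  too-many-roots [] xs distinct roots = tt
  too-many-roots {suc d} f xs distinct roots = recover f a (roots Fin.zero) (too-many-roots (quotient a f)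
      (λ i → xs (Fin.suc i)) (λ h → Finₚ.suc-injective (distinct h)) rest)
    where
    a = xs Fin.zero
    rest : ∀ i → p∣ evalℤ (quotient a f) (xs (Fin.suc i))
    rest i with p∣-* (xs (Fin.suc i) ℤ.- a) _ (subst p∣_ (quotient-spec f a (xs (Fin.suc i)))
        (ℤ∣.∣m∣n⇒∣m-n (roots (Fin.suc i)) (roots Fin.zero)))
    ... | inj₂ h = h
    ... | inj₁ h with distinct h
    ... | ()

  digits : ∀ r → ℕ → Vec ℕ r
  digits zero i = []
  digits (suc r) i = i ℕ.% p ∷ digits r (i ℕ./ p)

  digits-injective : ∀ r {i j} → i <ℕ p ℕ.^ r → j <ℕ p ℕ.^ r → AllDivisible (difference-vec (digits r i) (digits r j))
      → i ≡ j
  digits-injective zero {zero} {zero} _ _ _ = refl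
  digits-injective zero {suc i} (s≤s ()) _ _
  digits-injective zero {zero} {suc j} _ (s≤s ()) _
  digits-injective (suc r) {i} {j} i< j< (h , hs) = trans (DM.m≡m%n+[m/n]*n i p) (trans (cong₂ (λ a b → a +ℕ b *ℕ p)
      (residues-equal (DM.m%n<n i p) (DM.m%n<n j p) h) (digits-injective r (quotient-bound i<) (quotient-bound j<)
          hs)) (sym (DM.m≡m%n+[m/n]*n j p)))
    where
    quotient-bound : ∀ {k} → k <ℕ p ℕ.^ suc r → k ℕ./ p <ℕ p ℕ.^ r
    quotient-bound {k} lt = DM.m<n*o⇒m/o<n (subst (k <ℕ_) (ℕₚ.*-comm p (p ℕ.^ r)) lt)

  %-equal⇒p∣ : ∀ {a b} → a ℕ.% p ≡ b ℕ.% p → p∣ ℤ.+ a ℤ.- ℤ.+ b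
  %-equal⇒p∣ {a} {b} e = ℤ∣.divides (ℤ.+ (a ℕ./ p) ℤ.- ℤ.+ (b ℕ./ p)) (trans (cong₂ ℤ._-_ (split a) (trans (split b)
      (cong (λ z → ℤ.+ z ℤ.+ ℤ.+ (b ℕ./ p) ℤ.* ℤ.+ p) (sym e)))) (lemma (ℤ.+ (a ℕ.% p)) (ℤ.+ (a ℕ./ p))
      (ℤ.+ (b ℕ./ p)) (ℤ.+ p)))
    where
    split : ∀ a → ℤ.+ a ≡ ℤ.+ (a ℕ.% p) ℤ.+ ℤ.+ (a ℕ./ p) ℤ.* ℤ.+ p
    split a = trans (cong ℤ.+_ (DM.m≡m%n+[m/n]*n a p)) (cong (ℤ._+_ (ℤ.+ (a ℕ.% p))) (ℤₚ.pos-* (a ℕ./ p) p))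
    lemma : ∀ c u v p → (c ℤ.+ u ℤ.* p) ℤ.- (c ℤ.+ v ℤ.* p) ≡ (u ℤ.- v) ℤ.* p
    lemma = solveℤ-∀

  -- Row i is the graph of the polynomial whose coefficients are the base-p digits of i; column x p + y is the point (x, y).
  value : ℕ → ℕ → ℕ → ℕ
  value r i x = evalℕ (digits r i) x ℕ.% p

  entry : ℕ → ℕ → ℕ → Bool
  entry r i j = (i ℕ.<ᵇ p ℕ.^ r) ∧ ((j ℕ.<ᵇ p *ℕ p) ∧ (value r i (j ℕ./ p) ℕ.≡ᵇ j ℕ.% p))

  graphs : ∀ r m n → Matrix m n
  graphs r m n i j = entry r (toℕ i) (toℕ j)

  entry-sound : ∀ r i j → entry r i j ≡ true → i <ℕ p ℕ.^ r × j <ℕ p *ℕ p × value r i (j ℕ./ p) ≡ j ℕ.% p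
  entry-sound r i j e with Equivalence.to T-∧ (Equivalence.from Boolₚ.T-≡ e)
  ... | t , t′ with Equivalence.to T-∧ t′
  ... | u , v = ℕₚ.<ᵇ⇒< i _ t , ℕₚ.<ᵇ⇒< j _ u , ℕₚ.≡ᵇ⇒≡ _ _ v

  entry-complete : ∀ r i j → i <ℕ p ℕ.^ r → j <ℕ p *ℕ p → value r i (j ℕ./ p) ≡ j ℕ.% p → entry r i j ≡ true
  entry-complete r i j a b c = Equivalence.to Boolₚ.T-≡ (Equivalence.from T-∧ (ℕₚ.<⇒<ᵇ a , Equivalence.from T-∧
      (ℕₚ.<⇒<ᵇ b , ℕₚ.≡⇒≡ᵇ _ _ c)))

  -- Common points of two graphs have distinct abscissae, since a graph meets each vertical line
  -- once. So r common columns give r roots of a difference with r coefficients; the digits agree,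
  -- and with them the row indices.
  graphs-free : ∀ q {m n} → Free 2 (suc q) (graphs (suc q) m n)
  graphs-free q {m} {n} (S , T , ∣S∣ , ∣T∣ , all-ones) with listing S ∣S∣ | listing T ∣T∣
  ... | row , row-∈ , row-injective | column , column-∈ , column-injective = 0≢1 (row-injective (Finₚ.toℕ-injective equal))
    where
    r : ℕ
    r = suc q
    0≢1 : Fin.zero {1} ≡ Fin.suc Fin.zero → ⊥
    0≢1 ()
    index : Fin 2 → ℕ
    index k = toℕ (row k)
    col x : Fin r → ℕ
    col k = toℕ (column k)
    x l = col l ℕ./ p
    sound : ∀ k l → index k <ℕ p ℕ.^ r × col l <ℕ p *ℕ p × value r (index k) (x l) ≡ col l ℕ.% p
    sound k l = entry-sound r (index k) (col l) (all-ones (row k) (column l) (row-∈ k) (column-∈ l))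
    distinct : ∀ {k l} → p∣ ℤ.+ x k ℤ.- ℤ.+ x l → k ≡ l
    distinct {k} {l} d = column-injective (Finₚ.toℕ-injective (trans (DM.m≡m%n+[m/n]*n (col k) p)
        (trans (cong₂ (λ a b → a +ℕ b *ℕ p) same-y same-x) (sym (DM.m≡m%n+[m/n]*n (col l) p)))))
      where
      x<p : ∀ l → x l <ℕ p
      x<p l = DM.m<n*o⇒m/o<n (proj₁ (proj₂ (sound Fin.zero l)))
      same-x : x k ≡ x l
      same-x = residues-equal (x<p k) (x<p l) d
      same-y : col k ℕ.% p ≡ col l ℕ.% p
      same-y = trans (sym (proj₂ (proj₂ (sound Fin.zero k)))) (trans (cong (value r (index Fin.zero)) same-x)
          (proj₂ (proj₂ (sound Fin.zero l))))
    i i′ : ℕ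
    i = index Fin.zero
    i′ = index (Fin.suc Fin.zero)
    all-divisible : AllDivisible (difference-vec (digits r i) (digits r i′))
    all-divisible = too-many-roots _ (λ l → ℤ.+ x l) distinct λ l → subst p∣_ (sym (evalℤ-difference (digits r i)
        (digits r i′) (x l)))
      (%-equal⇒p∣ (trans (proj₂ (proj₂ (sound Fin.zero l))) (sym (proj₂ (proj₂ (sound (Fin.suc Fin.zero) l))))))
    equal : i ≡ i′
    equal = digits-injective r (proj₁ (sound Fin.zero Fin.zero)) (proj₁ (sound (Fin.suc Fin.zero) Fin.zero)) all-divisible

  private
    count : ∀ n → (ℕ → Bool) → ℕ
    count n f = rowOnes {n} (λ j → f (toℕ j))

    count-+ : ∀ a b f → count (a +ℕ b) f ≡ count a f +ℕ count b (λ k → f (a +ℕ k))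
    count-+ zero b f = refl
    count-+ (suc a) b f = trans (cong (bit (f 0) +ℕ_) (count-+ a b (λ k → f (suc k)))) (sym (ℕₚ.+-assoc (bit (f 0)) _ _))

    count-≥1 : ∀ n f {y} → y <ℕ n → f y ≡ true → 1 ≤ℕ count n f
    count-≥1 (suc n) f {zero} _ e rewrite e = s≤s z≤n
    count-≥1 (suc n) f {suc y} (s≤s y<n) e = ℕₚ.≤-trans (count-≥1 n (λ k → f (suc k)) y<n e) (ℕₚ.m≤n+m _ (bit (f 0)))

    count-blocks : ∀ k f → (∀ x → x <ℕ k → ∃ λ y → y <ℕ p × f (x *ℕ p +ℕ y) ≡ true) → k ≤ℕ count (k *ℕ p) f
    count-blocks zero f h = z≤n
    count-blocks (suc k) f h = ℕₚ.≤-trans (ℕₚ.+-mono-≤ (count-≥1 p f (proj₁ (proj₂ (h 0 (s≤s z≤n))))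
        (proj₂ (proj₂ (h 0 (s≤s z≤n)))))
        (count-blocks k (λ j → f (p +ℕ j)) λ x x<k → proj₁ (h (suc x) (s≤s x<k)) , proj₁ (proj₂ (h (suc x) (s≤s x<k))) ,
          trans (cong f (sym (ℕₚ.+-assoc p (x *ℕ p) _))) (proj₂ (proj₂ (h (suc x) (s≤s x<k))))))
      (ℕₚ.≤-reflexive (sym (count-+ p (k *ℕ p) f)))

  row-count : ∀ r i {n} → i <ℕ p ℕ.^ r → p *ℕ p ≤ℕ n → p ≤ℕ rowOnes {n} (λ j → entry r i (toℕ j))
  row-count r i {n} i< p²≤n = ℕₚ.≤-trans (ℕₚ.≤-trans (count-blocks p (entry r i) point)
      (ℕₚ.m≤m+n _ (count (n ℕ.∸ p *ℕ p) (λ k → entry r i (p *ℕ p +ℕ k)))))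
    (ℕₚ.≤-reflexive (trans (sym (count-+ (p *ℕ p) (n ℕ.∸ p *ℕ p) (entry r i))) (cong (λ k → count k (entry r i))
        (ℕₚ.m+[n∸m]≡n p²≤n))))
    where
    point : ∀ x → x <ℕ p → ∃ λ y → y <ℕ p × entry r i (x *ℕ p +ℕ y) ≡ true
    point x x<p = y , y<p , entry-complete r i _ i< below (trans (cong (value r i) /≡) (sym %≡))
      where
      y : ℕ
      y = value r i x
      y<p : y <ℕ p
      y<p = DM.m%n<n (evalℕ (digits r i) x) p
      below : x *ℕ p +ℕ y <ℕ p *ℕ p
      below = ℕₚ.<-≤-trans (ℕₚ.+-monoʳ-< (x *ℕ p) y<p) (ℕₚ.≤-trans (ℕₚ.≤-reflexive (ℕₚ.+-comm (x *ℕ p) p))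
          (ℕₚ.*-monoˡ-≤ p x<p))
      %≡ : (x *ℕ p +ℕ y) ℕ.% p ≡ y
      %≡ = trans (cong (ℕ._% p) (ℕₚ.+-comm (x *ℕ p) y)) (trans (DM.[m+kn]%n≡m%n y x p) (DM.m<n⇒m%n≡m y<p))
      /≡ : (x *ℕ p +ℕ y) ℕ./ p ≡ x
      /≡ = ℕₚ.*-cancelʳ-≡ _ _ p (ℕₚ.+-cancelˡ-≡ y _ _ (trans (cong (_+ℕ (x *ℕ p +ℕ y) ℕ./ p *ℕ p) (sym %≡))
          (trans (sym (DM.m≡m%n+[m/n]*n (x *ℕ p +ℕ y) p)) (ℕₚ.+-comm (x *ℕ p) y))))

  -- There are only p^r polynomials; further rows are zero, whence the minimum. Each polynomial has
  -- one point over every x < p.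
  graphs-ones : ∀ r {m n} → p *ℕ p ≤ℕ n → (m ℕ.⊓ p ℕ.^ r) *ℕ p ≤ℕ ones (graphs r m n)
  graphs-ones r {m} {n} p²≤n = ℕₚ.≤-trans (rows (m ℕ.⊓ p ℕ.^ r) (λ i → rowOnes (graphs r m n i)) (ℕₚ.m⊓n≤m m _)
      λ i lt → row-count r (toℕ i) (ℕₚ.<-≤-trans lt (ℕₚ.m⊓n≤n m _)) p²≤n) (ℕₚ.≤-reflexive (sym (ones≡∑ᶠ (graphs r m n))))
    where
    rows : ∀ {m} b (f : Fin m → ℕ) → b ≤ℕ m → (∀ i → toℕ i <ℕ b → p ≤ℕ f i) → b *ℕ p ≤ℕ ∑ᶠ f
    rows zero f _ _ = z≤n
    rows {suc m} (suc b) f (s≤s b≤m) h = ℕₚ.+-mono-≤ (h Fin.zero (s≤s z≤n)) (rows b (f ∘ Fin.suc) b≤m λ i lt → h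
        (Fin.suc i) (s≤s lt))

-- Asymptotics

square-cancel-≤ : ∀ {a b} → ι 0 ≤ b → a * a ≤ b * b → a ≤ b
square-cancel-≤ {a} {b} 0≤b le with ≤-total a b
... | inj₁ p = p
... | inj₂ b≤a = lin 2 (λ a b → 1 · a :- b :≤ con 0 ∷ [] ⊢ 1 · a :≤ b) _ _ (nilpotent (≤⇒0≤ b≤a)
    (lin 2 (λ a b → 1 · a :* a :≤ b :* b ∷ 2 · con 0 :≤ (a :- b) :* b ∷ [] ⊢ 1 · (a :- b) :* (a :- b) :≤ con 0) _ _ le
        (*-nonneg (≤⇒0≤ b≤a) 0≤b)))
  where
  opaque
    unfolding _+_
    nilpotent : ∀ {d} → ι 0 ≤ d → d * d ≤ ι 0 → d ≤ ι 0
    nilpotent {d} 0≤d dd≤0 = ℚₚ.≮⇒≥ λ 0<d → ℚₚ.<-irrefl refl (ℚₚ.<-≤-trans (ℚₚ.positive⁻¹ (d ℚ.* d)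
        {{ℚₚ.pos*pos⇒pos d {{ℚ.positive 0<d}} d {{ℚ.positive 0<d}}}}) dd≤0)

pw : ℚ → ℕ → ℚ
pw a zero = ι 1
pw a (suc r) = a * pw a r

0≤pw : ∀ {a} r → ι 0 ≤ a → ι 0 ≤ pw a r
0≤pw zero _ = 0≤ι 1
0≤pw (suc r) p = *-nonneg p (0≤pw r p)

pw-mono : ∀ {a b} r → ι 0 ≤ a → a ≤ b → pw a r ≤ pw b r
pw-mono zero _ _ = ≤-refl
pw-mono (suc r) 0≤a a≤b = *-mono-0≤ 0≤a a≤b (0≤pw r 0≤a) (pw-mono r 0≤a a≤b)

pw-* : ∀ a b r → pw (a * b) r ≡ pw a r * pw b r
pw-* a b zero = sym (*-identityˡ _)
pw-* a b (suc r) = trans (cong (a * b *_) (pw-* a b r)) (ring 4 (λ a b c d → a :* b :* (c :* d) := a :* c :* (b :* d))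
    _ _ _ _)

ι-^ : ∀ x r → ι (x ℕ.^ r) ≡ pw (ι x) r
ι-^ x zero = refl
ι-^ x (suc r) = trans (ι-* x (x ℕ.^ r)) (cong (ι x *_) (ι-^ x r))

ι-² : ∀ x → ι (x ℕ.^ 2) ≡ ι x * ι x
ι-² x = trans (ι-^ x 2) (ring 1 (λ x → x :* (x :* con 1) := x :* x) _)

ι-n*m² : ∀ n m → ι (n *ℕ m ℕ.^ 2) ≡ ι n * (ι m * ι m)
ι-n*m² n m = trans (ι-* n (m ℕ.^ 2)) (cong (ι n *_) (ι-² m))

-- The chord of the convex function (1 + h)^r over [0, 1].
pw-1+h-≤ : ∀ {h} r → ι 0 ≤ h → h ≤ ι 1 → pw (ι 1 + h) r ≤ ι 1 + (ι (2 ℕ.^ r) - ι 1) * h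
pw-1+h-≤ zero 0≤h h≤1 = lin 1 (λ h → [] ⊢ 1 · con 1 :≤ con 1 :+ (con 1 :- con 1) :* h) _
pw-1+h-≤ {h} (suc r) 0≤h h≤1 = ≤-trans
  (lin 3 (λ h P w → 1 · (con 1 :+ h) :* w :≤ (con 1 :+ h) :* (con 1 :+ (P :- con 1) :* h) ∷ 1 · con 0 :≤ (P :- con 1)
      :* (h :* (con 1 :- h)) ∷ [] ⊢ 1 · (con 1 :+ h) :* w :≤ con 1 :+ (con 2 :* P :- con 1) :* h) _ _ _
    (*-monoʳ-0≤ (≤-trans 0≤h (lin 1 (λ h → [] ⊢ 1 · h :≤ con 1 :+ h) _)) (pw-1+h-≤ r 0≤h h≤1))
    (*-nonneg (≤⇒0≤ (ι-mono (1≤^ r (s≤s z≤n)))) (*-nonneg 0≤h (≤⇒0≤ h≤1))))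
  (≡⇒≤ (cong (λ P → ι 1 + (P - ι 1) * h) (sym (ι-* 2 (2 ℕ.^ r)))))

bernoulli-≤ : ∀ {η} r → ι 0 ≤ η → η ≤ ι 1 → ι 1 - ι r * η ≤ pw (ι 1 - η) r
bernoulli-≤ zero 0≤η η≤1 = lin 1 (λ η → [] ⊢ 1 · con 1 :- con 0 :* η :≤ con 1) _
bernoulli-≤ {η} (suc r) 0≤η η≤1 = ≤-trans (≡⇒≤ (cong (λ k → ι 1 - k * η) (ι-suc r)))
  (lin 3 (λ η r w → 1 · (con 1 :- η) :* (con 1 :- r :* η) :≤ (con 1 :- η) :* w ∷ 1 · con 0 :≤ r :* (η :* η) ∷ [] ⊢ 1 ·
      con 1 :- (con 1 :+ r) :* η :≤ (con 1 :- η) :* w) _ _ _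
    (*-monoʳ-0≤ (≤⇒0≤ η≤1) (bernoulli-≤ r 0≤η η≤1)) (*-nonneg (0≤ι r) (*-nonneg 0≤η 0≤η)))

isqrt-≥ : ∀ {S n} → S *ℕ S ≤ℕ n → S ≤ℕ proj₁ (isqrt n)
isqrt-≥ {S} {n} le = ℕ.s≤s⁻¹ (ℕₚ.≰⇒> λ s<S → ℕₚ.<⇒≱ (proj₂ (proj₂ (isqrt n))) (ℕₚ.≤-trans (square-mono s<S) le))

module Asymptotics (q : ℕ) (m z : ℕ → ℕ) (zarankiewicz : ∀ n → IsZarankiewicz (m n) n 2 (suc q) (z n)) where
  private
    r : ℕ
    r = suc q

  -- The halves are separated because they are used crosswise: the lower bound for z needs m not too
  -- large, since only p^r rows carry ones, and the upper bound needs m not too small for the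
  -- tangent at √n to be sharp.
  Below Above : (ℕ → ℕ) → (ℕ → ℕ) → ℕ → Set
  Below f g b = ∃ λ N → ∀ n → N ≤ℕ n → (ι 1 - recip b) * (ι 1 - recip b) * ι (g n) ≤ ι (f n ℕ.^ 2)
  Above f g b = ∃ λ N → ∀ n → N ≤ℕ n → ι (f n ℕ.^ 2) ≤ (ι 1 + recip b) * (ι 1 + recip b) * ι (g n)

  nm² : ℕ → ℕ
  nm² n = n *ℕ m n ℕ.^ 2

  module LowerBound {b : ℕ} (1≤b : 1 ≤ℕ b) (m-above : Above m (λ n → n ℕ.^ r) (2 *ℕ b)) where
    private
      g c : ℕ
      -- The prime has p ≥ θ (s + 1) with θ = 1 - 4/(g + 4), and p is raised to the power r + 1;
      -- this g keeps the loss 4 (r + 1)/(g + 4) below 1/(2b).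
      g = 8 *ℕ (b *ℕ suc r)
      c = g +ℕ 4
      8≤g : 8 ≤ℕ g
      8≤g = ℕₚ.*-monoʳ-≤ 8 (1≤* 1≤b (s≤s z≤n))
      1≤g : 1 ≤ℕ g
      1≤g = ℕₚ.≤-trans (s≤s z≤n) 8≤g
      1≤c : 1 ≤ℕ c
      1≤c = ℕₚ.≤-trans 1≤g (ℕₚ.m≤m+n g 4)
      x₀ S : ℕ
      x₀ = proj₁ (prime-gaps 8≤g)
      S = (g +ℕ 3) *ℕ (x₀ +ℕ 3)
      β h η θ : ℚ
      β = recip b
      h = recip (2 *ℕ b)
      η = ι 4 * recip c
      θ = ι g * recip c
      c*recip : (ι g + ι 4) * recip c ≡ ι 1
      c*recip = trans (cong (_* recip c) (sym (ι-+ g 4))) (recip-inv 1≤c)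
      θ≡ : θ ≡ ι 1 - η
      θ≡ = trans (ring 2 (λ g c → g :* c := (g :+ con 4) :* c :- con 4 :* c) _ _) (cong (_- η) c*recip)
      0≤η : ι 0 ≤ η
      0≤η = *-nonneg (0≤ι 4) (0≤recip c)
      0≤θ : ι 0 ≤ θ
      0≤θ = *-nonneg (0≤ι g) (0≤recip c)
      η≤1 : η ≤ ι 1
      η≤1 = lin 2 (λ t e → 1 · con 0 :≤ t ∷ 1 · t := con 1 :- e ∷ [] ⊢ 1 · e :≤ con 1) _ _ 0≤θ θ≡
      2h≡β : ι 2 * h ≡ β
      2h≡β = recip-double 1≤b
      0≤h : ι 0 ≤ h
      0≤h = 0≤recip (2 *ℕ b)
      β≤1 : β ≤ ι 1
      β≤1 = ≤-trans (recip-anti (s≤s z≤n) 1≤b) (≡⇒≤ (trans (sym (*-identityˡ _)) (recip-inverse 0)))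
      srη≤h : ι (suc r) * η ≤ h
      srη≤h = lin 6 (λ b s e h β C → 1 −· con 2 :* h := β ∷ 1 · C :* (con 8 :* (b :* s) :* e) :≤ C :* con 1 ∷ 1 −·
          (con 4 :* s :* e) :* (con 2 :* (b :* C)) := (con 4 :* s :* e) :* (con 2 :* con 1) ∷ 1 · C := β ∷ [] ⊢ 2 · s
          :* (con 4 :* e) :≤ h) _ _ _ _ _ β
        2h≡β (*-monoʳ-0≤ (0≤recip b) 8bse≤1) (cong (λ z → ι 4 * ι (suc r) * recip c * (ι 2 * z)) (recip-inv 1≤b)) refl
        where
        8bse≤1 : ι 8 * (ι b * ι (suc r)) * recip c ≤ ι 1
        8bse≤1 = lin 3 (λ G g e → 1 · G :* e := g :* e ∷ 1 · (g :+ con 4) :* e := con 1 ∷ 4 · con 0 :≤ e ∷ [] ⊢ 1 · G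
            :* e :≤ con 1) _ _ _
          (cong (_* recip c) (sym (trans (ι-* 8 _) (cong (ι 8 *_) (ι-* b (suc r)))))) c*recip (0≤recip c)
      θ^≥ : (ι 1 - β) * (ι 1 + h) ≤ pw θ (suc r)
      θ^≥ = lin 5 (λ β h R η w → 1 · con 1 :- R :* η :≤ w ∷ 1 · R :* η :≤ h ∷ 1 · con 2 :* h := β ∷ 1 · con 0 :≤ β :*
          h ∷ [] ⊢ 1 · (con 1 :- β) :* (con 1 :+ h) :≤ w) _ _ _ _ _
        (subst (λ t → ι 1 - ι (suc r) * η ≤ pw t (suc r)) (sym θ≡) (bernoulli-≤ (suc r) 0≤η η≤1)) srη≤h 2h≡β
            (*-nonneg (0≤recip b) 0≤h)
      1-β≤θ : ι 1 - β ≤ θ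
      1-β≤θ = lin 5 (λ β h η θ R → 1 −· θ := con 1 :- η ∷ 1 · R :* η :≤ h ∷ 1 · con 1 :* η :≤ R :* η ∷ 1 · con 2 :* h
          := β ∷ 1 · con 0 :≤ h ∷ [] ⊢ 1 · con 1 :- β :≤ θ) _ _ _ _ _
        θ≡ srη≤h (*-mono-0≤ (0≤ι 1) (ι-mono (s≤s z≤n)) 0≤η ≤-refl) 2h≡β 0≤h

    below : Below z nm² b
    below = S *ℕ S +ℕ proj₁ m-above , λ n N≤n → bound n (ℕₚ.≤-trans (ℕₚ.m≤m+n (S *ℕ S) _) N≤n) (proj₂ m-above n
        (ℕₚ.≤-trans (ℕₚ.m≤n+m _ (S *ℕ S)) N≤n))
      where
      bound : ∀ n → S *ℕ S ≤ℕ n → ι (m n ℕ.^ 2) ≤ (ι 1 + h) * (ι 1 + h) * ι (n ℕ.^ r) →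
        (ι 1 - β) * (ι 1 - β) * ι (nm² n) ≤ ι (z n ℕ.^ 2)
      bound n S²≤n m≤ = ≤-trans (≡⇒≤ (cong ((ι 1 - β) * (ι 1 - β) *_) (ι-n*m² n (m n))))
          (≤-trans (by-cases (ℕₚ.≤-total (m n) (p ℕ.^ r))) (≡⇒≤ (sym (ι-² (z n)))))
        where
        s x : ℕ
        s = proj₁ (isqrt n)
        x = (g *ℕ s) ÷ (g +ℕ 3)
        S≤s : S ≤ℕ s
        S≤s = isqrt-≥ S²≤n
        1≤g+3 : 1 ≤ℕ g +ℕ 3
        1≤g+3 = ℕₚ.≤-trans 1≤g (ℕₚ.m≤m+n g 3)
        scaled-≤x : ∀ {k} → k *ℕ (g +ℕ 3) ≤ℕ s → k ≤ℕ x
        scaled-≤x le = *≤⇒≤÷ 1≤g+3 (ℕₚ.≤-trans le (ℕₚ.m≤n*m s g {{ℕ.>-nonZero 1≤g}}))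
        gs≤ : ι g * ι s ≤ (ι x + ι 1) * (ι g + ι 3)
        gs≤ = ≤-trans (≤-trans (≡⇒≤ (sym (ι-* g s))) (÷-lower (g *ℕ s) 1≤g+3))
            (≡⇒≤ (trans (cong (λ k → ι x * k + k) (ι-+ g 3)) (ring 2 (λ x k → x :* k :+ k := (x :+ con 1) :* k) _ _)))
        3[g+3]≤s : 3 *ℕ (g +ℕ 3) ≤ℕ s
        3[g+3]≤s = ℕₚ.≤-trans (ℕₚ.≤-reflexive (ℕₚ.*-comm 3 (g +ℕ 3))) (ℕₚ.≤-trans (ℕₚ.*-monoʳ-≤ (g +ℕ 3)
            (ℕₚ.m≤n+m 3 x₀)) S≤s)
        2s≤3x : 2 *ℕ s ≤ℕ 3 *ℕ x
        2s≤3x = ι-cancel (≤-trans (≡⇒≤ (ι-* 2 s)) (≤-trans (*-cancel-≤ {ι g + ι 3} (≤-trans (ι-mono 1≤g+3) (≡⇒≤ (ι-+ g 3)))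
          (lin 3 (λ g s x → 3 · g :* s :≤ (x :+ con 1) :* (g :+ con 3) ∷ 1 · con 3 :* (g :+ con 3) :≤ s ∷ 1 · con 8 :*
              s :≤ g :* s ∷ 1 · con 0 :≤ s ∷ [] ⊢ 1 · (g :+ con 3) :* (con 2 :* s) :≤ (g :+ con 3) :* (con 3 :* x)) _ _ _
            gs≤ (≤-trans (≡⇒≤ (sym (trans (ι-* 3 (g +ℕ 3)) (cong (ι 3 *_) (ι-+ g 3))))) (ι-mono 3[g+3]≤s))
                (*-mono-0≤ (0≤ι 8) (ι-mono 8≤g) (0≤ι s) ≤-refl) (0≤ι s)))
          (≡⇒≤ (sym (ι-* 3 x)))))
        x₀≤x : x₀ ≤ℕ x
        x₀≤x = scaled-≤x (ℕₚ.≤-trans (ℕₚ.≤-trans (ℕₚ.≤-reflexive (ℕₚ.*-comm x₀ (g +ℕ 3))) (ℕₚ.*-monoʳ-≤ (g +ℕ 3)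
            (ℕₚ.m≤m+n x₀ 3))) S≤s)
        prime-near : PrimeBetween x s
        prime-near = proj₂ (prime-gaps 8≤g) x s x₀≤x (ℕₚ.≤-trans (ℕₚ.≤-reflexive (ℕₚ.*-comm (g +ℕ 3) x))
            (÷*≤ (g *ℕ s) (g +ℕ 3))) 2s≤3x
        p = proj₁ prime-near
        pr = proj₁ (proj₂ prime-near)
        x<p = proj₁ (proj₂ (proj₂ prime-near))
        p≤s = proj₂ (proj₂ (proj₂ prime-near))
        open Polynomials pr using (graphs; graphs-free; graphs-ones)
        z≥ : (m n ℕ.⊓ p ℕ.^ r) *ℕ p ≤ℕ z n
        z≥ = ℕₚ.≤-trans (graphs-ones r {m n} {n} (ℕₚ.≤-trans (square-mono p≤s) (proj₁ (proj₂ (isqrt n)))))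
            (proj₂ (zarankiewicz n) (graphs r (m n) n) (graphs-free q {m n} {n}))
        g≤p : ι g ≤ ι p
        g≤p = ι-mono (ℕₚ.≤-trans (scaled-≤x′ g≤s) (ℕₚ.<⇒≤ x<p))
          where
          g≤s : g +ℕ 3 ≤ℕ s
          g≤s = ℕₚ.≤-trans (ℕₚ.m≤n*m (g +ℕ 3) 3) 3[g+3]≤s
          scaled-≤x′ : g +ℕ 3 ≤ℕ s → g ≤ℕ x
          scaled-≤x′ le = *≤⇒≤÷ 1≤g+3 (ℕₚ.*-monoʳ-≤ g le)
        -- The prime gap gives g s ≤ (g + 3) p. The bound is needed for s + 1, because n < (s + 1)²,
        -- and g ≤ p turns g + 3 into g + 4.
        p≥θ : θ * (ι s + ι 1) ≤ ι p
        p≥θ = lin 5 (λ g s x p e → 1 · e :* (g :* s) :≤ e :* ((x :+ con 1) :* (g :+ con 3)) ∷ 1 · e :* (g :+ con 3) :*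
            (x :+ con 1) :≤ e :* (g :+ con 3) :* p ∷ 1 · e :* g :≤ e :* p ∷ 1 · p :* ((g :+ con 4) :* e) := p :* con 1
            ∷ [] ⊢ 1 · g :* e :* (s :+ con 1) :≤ p) _ _ _ _ _
          (*-monoʳ-0≤ (0≤recip c) gs≤) (*-monoʳ-0≤ (*-nonneg (0≤recip c) (≤-trans (0≤ι (g +ℕ 3)) (≡⇒≤ (ι-+ g 3))))
              (≤-trans (≡⇒≤ (trans (+-comm _ _) (sym (ι-suc x)))) (ι-mono x<p)))
          (*-monoʳ-0≤ (0≤recip c) g≤p) (cong (ι p *_) c*recip)
        n≤ : ι n ≤ (ι s + ι 1) * (ι s + ι 1)
        n≤ = ≤-trans (ι-mono (ℕₚ.<⇒≤ (proj₂ (proj₂ (isqrt n))))) (≡⇒≤ (trans (ι-* (suc s) (suc s))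
            (cong₂ _*_ (trans (ι-suc s) (+-comm _ _)) (trans (ι-suc s) (+-comm _ _)))))
        0≤s+1 : ι 0 ≤ ι s + ι 1
        0≤s+1 = ≤-trans (0≤ι s) (lin 1 (λ s → [] ⊢ 1 · s :≤ s :+ con 1) _)
        θ²n≤p² : θ * θ * ι n ≤ ι p * ι p
        θ²n≤p² = ≤-trans (*-monoʳ-0≤ (*-nonneg 0≤θ 0≤θ) n≤) (≤-trans (≡⇒≤ (ring 2 (λ t s → t :* t :* (s :* s) := t :*
            s :* (t :* s)) _ _))
          (*-mono-0≤ (*-nonneg 0≤θ 0≤s+1) p≥θ (*-nonneg 0≤θ 0≤s+1) p≥θ))
        0≤1-β : ι 0 ≤ ι 1 - β
        0≤1-β = ≤⇒0≤ β≤1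
        mₙ w : ℚ
        mₙ = ι (m n)
        w = pw (ι p) (suc r)
        by-cases : m n ≤ℕ p ℕ.^ r ⊎ p ℕ.^ r ≤ℕ m n → (ι 1 - β) * (ι 1 - β) * (ι n * (mₙ * mₙ)) ≤ ι (z n) * ι (z n)
        by-cases (inj₁ m≤) = ≤-trans (*-mono-0≤ (*-nonneg 0≤1-β 0≤1-β) (*-mono-0≤ 0≤1-β 1-β≤θ 0≤1-β 1-β≤θ)
            (*-nonneg (0≤ι n) (0≤square mₙ)) ≤-refl)
          (≤-trans (lin 4 (λ t n mₙ p → 1 · (mₙ :* mₙ) :* (t :* t :* n) :≤ (mₙ :* mₙ) :* (p :* p) ∷ [] ⊢ 1 · t :* t :*
              (n :* (mₙ :* mₙ)) :≤ mₙ :* p :* (mₙ :* p)) _ _ _ _ (*-monoʳ-0≤ (0≤square mₙ) θ²n≤p²))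
            (*-mono-0≤ (*-nonneg (0≤ι (m n)) (0≤ι p)) mp≤z (*-nonneg (0≤ι (m n)) (0≤ι p)) mp≤z))
          where
          mp≤z : mₙ * ι p ≤ ι (z n)
          mp≤z = ≤-trans (≡⇒≤ (sym (ι-* (m n) p))) (ι-mono (subst (λ k → k *ℕ p ≤ℕ z n) (ℕₚ.m≤n⇒m⊓n≡m m≤) z≥))
        -- Here z is compared with p^(r+1). The bound for m reduces the claim to n^(r+1), and θ² n ≤
        -- p² is raised to the power r + 1.
        by-cases (inj₂ p^≤m) = ≤-trans (lin 5 (λ u n mₙ h N → 1 · u :* u :* n :* (mₙ :* mₙ) :≤ u :* u :* n :*
            ((con 1 :+ h) :* (con 1 :+ h) :* N) ∷ [] ⊢ 1 · u :* u :* (n :* (mₙ :* mₙ)) :≤ (u :* (con 1 :+ h)) :*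
            (u :* (con 1 :+ h)) :* (n :* N)) _ _ _ _ _
              (*-monoʳ-0≤ (*-nonneg (*-nonneg 0≤1-β 0≤1-β) (0≤ι n)) (≤-trans (≡⇒≤ (sym (ι-² (m n)))) m≤)))
          (≤-trans (*-mono-0≤ (0≤square _) (*-mono-0≤ 0≤u θ^≥ 0≤u θ^≥) (*-nonneg (0≤ι n) (0≤ι (n ℕ.^ r))) ≤-refl)
          (≤-trans (≡⇒≤ (trans (cong (λ N → pw θ (suc r) * pw θ (suc r) * (ι n * N)) (ι-^ n r))
              (sym (trans (pw-* (θ * θ) (ι n) (suc r)) (cong (_* pw (ι n) (suc r)) (pw-* θ θ (suc r)))))))
          (≤-trans (pw-mono (suc r) (*-nonneg (*-nonneg 0≤θ 0≤θ) (0≤ι n)) θ²n≤p²)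
          (≤-trans (≡⇒≤ (pw-* (ι p) (ι p) (suc r))) (*-mono-0≤ 0≤w w≤z 0≤w w≤z)))))
          where
          0≤u : ι 0 ≤ (ι 1 - β) * (ι 1 + h)
          0≤u = *-nonneg 0≤1-β (≤-trans 0≤h (lin 1 (λ h → [] ⊢ 1 · h :≤ con 1 :+ h) _))
          0≤w : ι 0 ≤ w
          0≤w = 0≤pw (suc r) (0≤ι p)
          w≤z : w ≤ ι (z n)
          w≤z = ≤-trans (≡⇒≤ (trans (*-comm _ _) (trans (cong (_* ι p) (sym (ι-^ p r))) (sym (ι-* (p ℕ.^ r) p)))))
              (ι-mono (subst (λ k → k *ℕ p ≤ℕ z n) (ℕₚ.m≥n⇒m⊓n≡n p^≤m) z≥))

  module UpperBound {b : ℕ} (1≤b : 1 ≤ℕ b) (m-below : Below m (λ n → n ℕ.^ r) (4 *ℕ 2 ℕ.^ r *ℕ b)) where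
    private
      k : ℕ
      -- With h = 1/k this makes 2 ρ = 4 · 2^r h equal to 1/b: one ρ for the tangent estimate, one
      -- for the m r ones lost by reducing the rows.
      k = 4 *ℕ 2 ℕ.^ r *ℕ b
      P β h ρ : ℚ
      P = ι (2 ℕ.^ r)
      β = recip b
      h = recip k
      ρ = ι 2 * P * h
      1≤k : 1 ≤ℕ k
      1≤k = 1≤* (1≤* {4} (s≤s z≤n) (1≤^ r (s≤s z≤n))) 1≤b
      0≤h : ι 0 ≤ h
      0≤h = 0≤recip k
      2≤P : ι 2 ≤ P
      2≤P = ι-mono (ℕₚ.*-monoʳ-≤ 2 (1≤^ q (s≤s z≤n)))
      0≤P : ι 0 ≤ P
      0≤P = 0≤ι (2 ℕ.^ r)
      4h≤1 : ι 4 * h ≤ ι 1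
      4h≤1 = ≤-trans (*-mono-0≤ (0≤ι 4) (ι-mono 4≤k) 0≤h ≤-refl) (≡⇒≤ (recip-inv 1≤k))
        where
        4≤k : 4 ≤ℕ k
        4≤k = ℕₚ.≤-trans (ℕₚ.*-monoʳ-≤ 4 (1≤* (1≤^ r (s≤s z≤n)) 1≤b)) (ℕₚ.≤-reflexive (sym (ℕₚ.*-assoc 4 (2 ℕ.^ r) b)))
      ι-k : ι k ≡ ι 4 * P * ι b
      ι-k = trans (ι-* (4 *ℕ 2 ℕ.^ r) b) (cong (_* ι b) (ι-* 4 (2 ℕ.^ r)))
      2ρ≤β : ι 2 * ρ ≤ β
      2ρ≤β = lin 4 (λ P b h β → 1 · β :* (con 4 :* P :* b :* h) := β :* con 1 ∷ 1 −· (con 4 :* P :* h) :* (b :* β) :=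
          (con 4 :* P :* h) :* con 1 ∷ [] ⊢ 1 · con 2 :* (con 2 :* P :* h) :≤ β) _ _ _ _
        (cong (β *_) (trans (cong (_* h) (sym ι-k)) (recip-inv 1≤k))) (cong (ι 4 * P * h *_) (recip-inv 1≤b))
      0≤ρ : ι 0 ≤ ρ
      0≤ρ = *-nonneg (*-nonneg (0≤ι 2) 0≤P) 0≤h
      S : ℕ
      -- For s ≥ r k both r and 1 are at most h s, so m r and the step from s to s + 1 cost only a
      -- relative error h.
      S = r *ℕ k

    above : Above z nm² b
    above = S *ℕ S +ℕ proj₁ m-below , λ n N≤n → bound n (ℕₚ.≤-trans (ℕₚ.m≤m+n (S *ℕ S) _) N≤n) (proj₂ m-below n
        (ℕₚ.≤-trans (ℕₚ.m≤n+m _ (S *ℕ S)) N≤n))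
      where
      bound : ∀ n → S *ℕ S ≤ℕ n → (ι 1 - h) * (ι 1 - h) * ι (n ℕ.^ r) ≤ ι (m n ℕ.^ 2) →
        ι (z n ℕ.^ 2) ≤ (ι 1 + β) * (ι 1 + β) * ι (nm² n)
      bound n S²≤n m≥ = ≤-trans (≡⇒≤ (ι-² (z n))) (≤-trans (*-mono-0≤ (0≤ι _) z≤ (0≤ι _) z≤)
        (≤-trans (lin 4 (λ s mₙ B n → 1 · B :* B :* (mₙ :* mₙ) :* (s :* s) :≤ B :* B :* (mₙ :* mₙ) :* n ∷ [] ⊢ 1 · s
            :* mₙ :* B :* (s :* mₙ :* B) :≤ B :* B :* (n :* (mₙ :* mₙ))) _ _ _ _ (*-monoʳ-0≤ (*-nonneg (0≤square _)
            (0≤square _)) s²≤n))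
          (≡⇒≤ (cong ((ι 1 + β) * (ι 1 + β) *_) (sym (ι-n*m² n (m n)))))))
        where
        s : ℕ
        s = proj₁ (isqrt n)
        mₙ σ R N : ℚ
        mₙ = ι (m n)
        σ = ι (s ℕ.^ r)
        R = pw (ι 1 + h) r
        N = ι (n ℕ.^ r)
        0≤mₙ : ι 0 ≤ mₙ
        0≤mₙ = 0≤ι (m n)
        s²≤n : ι s * ι s ≤ ι n
        s²≤n = ≤-trans (≡⇒≤ (sym (ι-* s s))) (ι-mono (proj₁ (proj₂ (isqrt n))))
        S≤s : S ≤ℕ s
        S≤s = isqrt-≥ S²≤n
        1≤s : 1 ≤ℕ s
        1≤s = ℕₚ.≤-trans (1≤* {r} (s≤s z≤n) 1≤k) S≤s
        r≤hs : ι r ≤ h * ι s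
        r≤hs = lin 4 (λ r k h s → 1 · h :* (r :* k) :≤ h :* s ∷ 1 −· r :* (k :* h) := r :* con 1 ∷ [] ⊢ 1 · r :≤ h :*
            s) _ _ _ _ (*-monoʳ-0≤ 0≤h (≤-trans (≡⇒≤ (sym (ι-* r k))) (ι-mono S≤s))) (cong (ι r *_) (recip-inv 1≤k))
        0≤1+h : ι 0 ≤ ι 1 + h
        0≤1+h = ≤-trans 0≤h (lin 1 (λ h → [] ⊢ 1 · h :≤ con 1 :+ h) _)
        h≤1 : h ≤ ι 1
        h≤1 = lin 1 (λ h → 1 · con 4 :* h :≤ con 1 ∷ 3 · con 0 :≤ h ∷ [] ⊢ 1 · h :≤ con 1) _ 4h≤1 0≤h
        t : ℚ
        t = (ι 1 + h) * ι s
        s+1≤t : ι (suc s) ≤ t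
        s+1≤t = lin 4 (λ ss s h r → 1 · ss := con 1 :+ s ∷ 1 · con 1 :≤ r ∷ 1 · r :≤ h :* s ∷ [] ⊢ 1 · ss :≤
            (con 1 :+ h) :* s) _ _ _ _ (ι-suc s) (ι-mono {1} {r} (s≤s z≤n)) r≤hs
        N≤ : N ≤ (R * σ) * (R * σ)
        N≤ = ≤-trans (≡⇒≤ (ι-^ n r)) (≤-trans (pw-mono r (0≤ι n)
            (≤-trans (≤-trans (ι-mono (ℕₚ.<⇒≤ (proj₂ (proj₂ (isqrt n))))) (≡⇒≤ (ι-* (suc s) (suc s))))
            (*-mono-0≤ (0≤ι _) s+1≤t (0≤ι _) s+1≤t)))
          (≡⇒≤ (trans (pw-* t t r) (cong₂ _*_ pw-t pw-t))))
          where
          pw-t : pw t r ≡ R * σ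
          pw-t = trans (pw-* (ι 1 + h) (ι s) r) (cong (R *_) (sym (ι-^ s r)))
        0≤R : ι 0 ≤ R
        0≤R = 0≤pw r 0≤1+h
        0≤σ : ι 0 ≤ σ
        0≤σ = 0≤ι (s ℕ.^ r)
        -- Of the two factors √N of N = n^r, one is bounded through m and the other through s^r; the
        -- comparison of squares avoids the roots.
        [1-h]N≤ : (ι 1 - h) * N ≤ R * σ * mₙ
        [1-h]N≤ = square-cancel-≤ (*-nonneg (*-nonneg 0≤R 0≤σ) 0≤mₙ)
          (≤-trans (lin 3 (λ u N mₙ → 1 · N :* (u :* u :* N) :≤ N :* (mₙ :* mₙ) ∷ [] ⊢ 1 · u :* N :* (u :* N) :≤ N :*
              (mₙ :* mₙ)) _ _ _ (*-monoʳ-0≤ (0≤ι _) (≤-trans m≥ (≡⇒≤ (ι-² (m n))))))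
            (≤-trans (*-mono-0≤ (0≤ι _) N≤ (0≤square mₙ) ≤-refl) (≡⇒≤ (ring 2 (λ a mₙ → a :* a :* (mₙ :* mₙ) := a :*
                mₙ :* (a :* mₙ)) _ _))))
        R≤ : R ≤ (ι 1 - h) * (ι 1 + ρ)
        R≤ = ≤-trans (pw-1+h-≤ r 0≤h h≤1) (lin 2 (λ P h → 1 · con 0 :≤ P :* h :* (con 1 :- con 4 :* h) ∷ 1 · con 0 :≤
            P :* h ∷ [] ⊢ 2 · con 1 :+ (P :- con 1) :* h :≤ (con 1 :- h) :* (con 1 :+ con 2 :* P :* h)) _ _
          (*-nonneg (*-nonneg 0≤P 0≤h) (≤⇒0≤ 4h≤1)) (*-nonneg 0≤P 0≤h))
        N≤′ : N ≤ (ι 1 + ρ) * (σ * mₙ)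
        N≤′ = *-cancel-≤ {ι 2 * (ι 1 - h)} (lin 1 (λ h → 1 · con 4 :* h :≤ con 1 ∷ 2 · con 0 :≤ h ∷ [] ⊢ 1 · con 1 :≤
            con 2 :* (con 1 :- h)) _ 4h≤1 0≤h)
          (lin 5 (λ u N R v c → 2 · u :* N :≤ R :* c ∷ 2 · c :* R :≤ c :* (u :* v) ∷ [] ⊢ 1 · con 2 :* u :* N :≤ con 2
              :* u :* (v :* c)) _ _ _ _ _ (≤-trans [1-h]N≤ (≡⇒≤ (*-assoc _ _ _))) (*-monoʳ-0≤ (*-nonneg 0≤σ 0≤mₙ) R≤))
        optimum = proj₁ (zarankiewicz n)
        A = proj₁ optimum
        E : ℚ
        E = ι (∑ᶠ (λ i → rowOnes (A i) ℕ.∸ r))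
        σ′ : ℚ
        σ′ = ι (s ℕ.^ q)
        sum≤ : ι r * (σ′ * E) ≤ N + mₙ * (ι q * σ)
        sum≤ = ≤-trans (≡⇒≤ (sym (trans (ι-* r _) (cong (ι r *_) (ι-* (s ℕ.^ q) _)))))
            (≤-trans (ι-mono (apart-sum q A s (proj₁ (proj₂ optimum))))
          (≡⇒≤ (trans (ι-+ (n ℕ.^ r) _) (cong (N +_) (trans (ι-* (m n) _) (cong (mₙ *_) (ι-* q (s ℕ.^ r))))))))
        E≤ : E ≤ ι s * mₙ * (ι 1 + ρ)
        E≤ = *-cancel-≤ {ι r} (ι-mono (s≤s z≤n)) (*-cancel-≤ {σ′} (ι-mono (1≤^ q 1≤s))
          (lin 9 (λ r q σ σ′ s mₙ ρ E N → 1 · r :* (σ′ :* E) :≤ N :+ mₙ :* (q :* σ) ∷ 1 · N :≤ (con 1 :+ ρ) :*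
              (σ :* mₙ) ∷ 1 · σ :* mₙ := s :* σ′ :* mₙ ∷ 1 · ρ :* (σ :* mₙ) := ρ :* (s :* σ′ :* mₙ) ∷ 1 · q :*
              (σ :* mₙ) := q :* (s :* σ′ :* mₙ) ∷ 1 −· r :* (σ′ :* s :* mₙ :* (con 1 :+ ρ)) := (con 1 :+ q) :*
              (σ′ :* s :* mₙ :* (con 1 :+ ρ)) ∷ 1 · con 0 :≤ q :* ρ :* (s :* σ′ :* mₙ) ∷ [] ⊢ 1 · σ′ :* (r :* E) :≤ σ′
              :* (r :* (s :* mₙ :* (con 1 :+ ρ)))) _ _ _ _ _ _ _ _ _
            sum≤ N≤′ σmₙ (cong (ρ *_) σmₙ) (cong (ι q *_) σmₙ) (cong (_* (σ′ * ι s * mₙ * (ι 1 + ρ))) (ι-suc q))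
                (*-nonneg (*-nonneg (0≤ι q) 0≤ρ) (*-nonneg (*-nonneg (0≤ι s) (0≤ι _)) 0≤mₙ))))
          where
          σmₙ : σ * mₙ ≡ ι s * σ′ * mₙ
          σmₙ = cong (_* mₙ) (ι-* s (s ℕ.^ q))
        z≤ : ι (z n) ≤ ι s * mₙ * (ι 1 + β)
        z≤ = lin 8 (λ z E r s mₙ ρ h β → 1 · z :≤ E :+ mₙ :* r ∷ 1 · E :≤ s :* mₙ :* (con 1 :+ ρ) ∷ 1 · mₙ :* r :≤ mₙ
            :* (h :* s) ∷ 1 · (s :* mₙ) :* h :≤ (s :* mₙ) :* ρ ∷ 1 · (s :* mₙ) :* (con 2 :* ρ) :≤ (s :* mₙ) :* β ∷ []
            ⊢ 1 · z :≤ s :* mₙ :* (con 1 :+ β)) _ _ _ _ _ _ _ _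
          (≤-trans (≤-trans (≡⇒≤ (cong ι (sym (proj₂ (proj₂ optimum))))) (ι-mono (ones≤ r A)))
              (≡⇒≤ (trans (ι-+ (∑ᶠ (λ i → rowOnes (A i) ℕ.∸ r)) _) (cong (E +_) (ι-* (m n) r)))))
          E≤ (*-monoʳ-0≤ 0≤mₙ r≤hs) (*-monoʳ-0≤ 0≤smₙ (lin 2 (λ P h → 2 · con 0 :≤ h :* (P :- con 2) ∷ 3 · con 0 :≤ h
              ∷ [] ⊢ 1 · h :≤ con 2 :* P :* h) _ _ (*-nonneg 0≤h (≤⇒0≤ 2≤P)) 0≤h)) (*-monoʳ-0≤ 0≤smₙ 2ρ≤β)
          where
          0≤smₙ : ι 0 ≤ ι s * mₙ
          0≤smₙ = *-nonneg (0≤ι s) 0≤mₙ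

-- From reciprocals of integers to arbitrary ε

Within : (ℕ → ℕ) → (ℕ → ℕ) → ℚ → ℕ → Set
Within f g ε n = (ι 1 - ε) * (ι 1 - ε) * ι (g n) ≤ ι (f n ℕ.^ 2) × ι (f n ℕ.^ 2) ≤ (ι 1 + ε) * (ι 1 + ε) * ι (g n)

-- The same statement over the sealed operations; `seal` and `unseal` hold definitionally once these
-- are unfolded.
SealedAsympSqrt : (ℕ → ℕ) → (ℕ → ℕ) → Set
SealedAsympSqrt f g = ∀ ε → 0ℚ ℚ.< ε → ε ℚ.< 1ℚ → ∃ λ N → ∀ n → N ≤ℕ n → Within f g ε n

opaque
  unfolding _+_

  seal : ∀ f g → AsympSqrt f g → SealedAsympSqrt f g
  seal f g h = h

  unseal : ∀ f g → SealedAsympSqrt f g → AsympSqrt f g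
  unseal f g h = h

  ≰0⇒0< : ∀ {a} → ¬ (a ≤ ι 0) → 0ℚ ℚ.< a
  ≰0⇒0< = ℚₚ.≰⇒>

  ≱1⇒<1 : ∀ {a} → ¬ (ι 1 ≤ a) → a ℚ.< 1ℚ
  ≱1⇒<1 = ℚₚ.≰⇒>

  <1⇒≤1 : ∀ {a} → a ℚ.< 1ℚ → a ≤ ι 1
  <1⇒≤1 = ℚₚ.<⇒≤

  -- The denominator of ε serves as b, since the numerator of a positive fraction is at least 1.
  recip-below : ∀ ε → 0ℚ ℚ.< ε → ∃ λ b → 1 ≤ℕ b × recip b ≤ ε
  recip-below (ℚ.mkℚ (ℤ.+ zero) d c) (ℚ.*<* (ℤ.+<+ ()))
  recip-below (ℚ.mkℚ ℤ.-[1+ n ] d c) (ℚ.*<* ())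
  recip-below (ℚ.mkℚ (ℤ.+ suc n) d c) _ = suc d , s≤s z≤n ,
    ℚₚ.toℚᵘ-cancel-≤ (ℚᵘₚ.≤-respˡ-≃ (ℚᵘₚ.≃-sym (ℚₚ.toℚᵘ-fromℚᵘ (ℚᵘ.mkℚᵘ (ℤ.+ 1) d)))
      (ℚᵘ.*≤* (ℤₚ.*-monoʳ-≤-nonNeg (ℤ.+ suc d) (ℤ.+≤+ (s≤s (z≤n {n}))))))

asymp-at : ∀ f g → AsympSqrt f g → ∀ b → 2 ≤ℕ b → ∃ λ N → ∀ n → N ≤ℕ n → Within f g (recip b) n
asymp-at f g asymp b 2≤b = seal f g asymp (recip b)
    (≰0⇒0< λ le → ℕₚ.1+n≰n (ι-cancel {1} {0} (≤-trans (≡⇒≤ (sym b*β≡1)) (lin 2 (λ b r → 1 · con 0 :≤ b :* (con 0 :- r)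
        ∷ [] ⊢ 1 · b :* r :≤ con 0) _ _ (*-nonneg (0≤ι b) (≤⇒0≤ le))))))
    (≱1⇒<1 λ le → ℕₚ.<⇒≱ 2≤b (ι-cancel {b} {1} (≤-trans (lin 2 (λ b r → 1 · con 0 :≤ b :* (r :- con 1) ∷ [] ⊢ 1 · b :≤
        b :* r) _ _ (*-nonneg (0≤ι b) (≤⇒0≤ le))) (≡⇒≤ b*β≡1))))
  where
  b*β≡1 : ι b * recip b ≡ ι 1
  b*β≡1 = recip-inv (ℕₚ.≤-trans (s≤s z≤n) 2≤b)

Within-mono : ∀ f g {β ε} n → ι 0 ≤ β → β ≤ ε → ε ≤ ι 1 → Within f g β n → Within f g ε n
Within-mono f g {β} {ε} n 0≤β β≤ε ε≤1 (l , u) =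
    ≤-trans (*-mono-0≤ (*-nonneg 0≤1-ε 0≤1-ε) (*-mono-0≤ 0≤1-ε 1-ε≤1-β 0≤1-ε 1-ε≤1-β) (0≤ι (g n)) ≤-refl) l
  , ≤-trans u (*-mono-0≤ (*-nonneg 0≤1+β 0≤1+β) (*-mono-0≤ 0≤1+β 1+β≤1+ε 0≤1+β 1+β≤1+ε) (0≤ι (g n)) ≤-refl)
  where
  0≤1-ε : ι 0 ≤ ι 1 - ε
  0≤1-ε = ≤⇒0≤ ε≤1
  1-ε≤1-β : ι 1 - ε ≤ ι 1 - β
  1-ε≤1-β = lin 2 (λ e b → 1 · b :≤ e ∷ [] ⊢ 1 · con 1 :- e :≤ con 1 :- b) _ _ β≤ε
  0≤1+β : ι 0 ≤ ι 1 + β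
  0≤1+β = ≤-trans 0≤β (lin 1 (λ b → [] ⊢ 1 · b :≤ con 1 :+ b) _)
  1+β≤1+ε : ι 1 + β ≤ ι 1 + ε
  1+β≤1+ε = lin 2 (λ e b → 1 · b :≤ e ∷ [] ⊢ 1 · con 1 :+ b :≤ con 1 :+ e) _ _ β≤ε

asymp-intro : ∀ f g → (∀ b → 1 ≤ℕ b → ∃ λ N → ∀ n → N ≤ℕ n → Within f g (recip b) n) → AsympSqrt f g
asymp-intro f g bounds = unseal f g λ ε 0<ε ε<1 →
  let b , 1≤b , β≤ε = recip-below ε 0<ε
      N , h = bounds b 1≤b
  in N , λ n N≤n → Within-mono f g n (0≤recip b) β≤ε (<1⇒≤1 ε<1) (h n N≤n)

theorem5 : (r : ℕ) → 3 ≤ℕ r → (m : ℕ → ℕ) → AsympSqrt m (λ n → n ℕ.^ r) →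
    (z : ℕ → ℕ) → (∀ n → IsZarankiewicz (m n) n 2 r (z n)) →
    AsympSqrt z (λ n → n *ℕ (m n ℕ.^ 2))
theorem5 (suc q) _ m m-asymp z zarankiewicz = asymp-intro z nm² λ b 1≤b → combine b (lower b 1≤b) (upper b 1≤b)
  where
  open Asymptotics q m z zarankiewicz
  m-at = asymp-at m (λ n → n ℕ.^ suc q) m-asymp
  lower : ∀ b → 1 ≤ℕ b → Below z nm² b
  lower b 1≤b = LowerBound.below {b} 1≤b (proj₁ (m-at (2 *ℕ b) 2≤2b) , λ n N≤n → proj₂ (proj₂ (m-at (2 *ℕ b) 2≤2b) n N≤n))
    where
    2≤2b : 2 ≤ℕ 2 *ℕ b
    2≤2b = ℕₚ.*-monoʳ-≤ 2 1≤b
  upper : ∀ b → 1 ≤ℕ b → Above z nm² b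
  upper b 1≤b = UpperBound.above {b} 1≤b (proj₁ (m-at k 2≤k) , λ n N≤n → proj₁ (proj₂ (m-at k 2≤k) n N≤n))
    where
    k : ℕ
    k = 4 *ℕ 2 ℕ.^ suc q *ℕ b
    2≤k : 2 ≤ℕ k
    2≤k = ℕₚ.≤-trans (ℕₚ.*-mono-≤ {2} {4} (s≤s (s≤s z≤n)) (1≤* (1≤^ (suc q) (s≤s z≤n)) 1≤b)) (ℕₚ.≤-reflexive
        (sym (ℕₚ.*-assoc 4 (2 ℕ.^ suc q) b)))
  combine : ∀ b → Below z nm² b → Above z nm² b → ∃ λ N → ∀ n → N ≤ℕ n → Within z nm² (recip b) n
  combine b (N , l) (N′ , u) = N +ℕ N′ , λ n le → l n (ℕₚ.≤-trans (ℕₚ.m≤m+n N N′) le) , u n (ℕₚ.≤-trans (ℕₚ.m≤n+m N′ N) le)
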